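{- Let $k \geq 2$ be an integer, put $a = -6k-3$, and let $$P(x) = x^6 + a x^5 - 2a x^4 + (2a-3) x^3 - 2a x^2 + a x + 1.$$ Then $P(x)$ is a Salem polynomial, and if $\beta > 1$ is the Salem number with minimal polynomial $P(x)$, then the greedy beta expansion $d_\beta(1)$ of $1$ is eventually periodic with preperiod length $m = 1$ and period length $p = 8k+6$.
   Context: A Salem number is a real algebraic integer $\beta>1$ whose other Galois conjugates all satisfy $|\alpha|\le 1$, with at least one satisfying $|\alpha|=1$. A Salem polynomial is the minimal polynomial of a Salem number. For real $\beta>1$, the greedy beta expansion $d_\beta(1)=(c_n)_{n\ge1}$ is defined by $r_0=1$, and for $n\ge 1$: $c_n=\lfloor \beta r_{n-1}\rfloor$, $r_n=\beta r_{n-1}-\lfloor \beta r_{n-1}\rfloor$. It is eventually periodic if there are $m\ge 0$, $p\ge 1$ with $c_{n+m}=c_{n+m+p}$ for all $n\ge1$; the smallest such $m\geq 0$ and $p\geq 1$ are called the preperiod length and the period length, respectively. (By convention $p=0$ if $r_N=0$ for some $N$; this never happens for Salem numbers.) -}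

module Defs where

open import Algebra.Bundles.Raw using (RawRing)
open import Data.Integer as ℤ using (ℤ; +_)
open import Data.Nat as ℕ using (ℕ; suc)
import Data.Nat.Properties as ℕₚ
open import Data.Product using (Σ; ∃; ∃-syntax; _×_; _,_; proj₁; proj₂)
open import Data.Rational as ℚ using (ℚ; 0ℚ; 1ℚ; ½)
import Data.Rational.Properties as ℚₚ
open import Data.Rational.Solver using (module +-*-Solver)
open import Data.Sum using (_⊎_)
open import Data.Vec as Vec using (Vec; []; _∷_)
open import Level using (0ℓ)
open import Relation.Binary.PropositionalEquality
  using (_≡_; refl; sym; trans; cong; cong₂; subst; subst₂)
open import Relation.Nullary using (¬_)

-- Real numbers: Cauchy sequences of rationals, considered up to _≈_.

Eventually : (ℕ → Set) → Set
Eventually A = ∃[ N ] (∀ n → N ℕ.≤ n → A n)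

IsCauchy : (ℕ → ℚ) → Set
IsCauchy x = ∀ ε → 0ℚ ℚ.< ε →
  ∃[ N ] (∀ m n → N ℕ.≤ m → N ℕ.≤ n → ℚ.∣ x m ℚ.- x n ∣ ℚ.< ε)

record ℝ : Set where
  constructor mkℝ
  field
    seq    : ℕ → ℚ
    cauchy : IsCauchy seq

open ℝ public

infix 4 _≈_ _<_ _≤_

_≈_ : ℝ → ℝ → Set
x ≈ y = ∀ ε → 0ℚ ℚ.< ε → Eventually λ n → ℚ.∣ seq x n ℚ.- seq y n ∣ ℚ.< ε

_<_ : ℝ → ℝ → Set
x < y = ∃[ ε ] (0ℚ ℚ.< ε × Eventually λ n → seq x n ℚ.+ ε ℚ.≤ seq y n)

_≤_ : ℝ → ℝ → Set
x ≤ y = ¬ (y < x)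

private
  open +-*-Solver using (solve; _:+_; _:*_; _:-_; :-_; _:=_)

  sum-diff : ∀ a b c d → (a ℚ.+ b) ℚ.- (c ℚ.+ d) ≡ (a ℚ.- c) ℚ.+ (b ℚ.- d)
  sum-diff = solve 4 (λ a b c d → (a :+ b) :- (c :+ d) := (a :- c) :+ (b :- d)) refl

  neg-diff : ∀ a b → ℚ.- (a ℚ.- b) ≡ (ℚ.- a) ℚ.- (ℚ.- b)
  neg-diff = solve 2 (λ a b → :- (a :- b) := (:- a) :- (:- b)) refl

  diff-cancel : ∀ a b → a ≡ (a ℚ.- b) ℚ.+ b
  diff-cancel = solve 2 (λ a b → a := (a :- b) :+ b) refl

  product-diff : ∀ a b c d →
    a ℚ.* b ℚ.- c ℚ.* d ≡ a ℚ.* (b ℚ.- d) ℚ.+ d ℚ.* (a ℚ.- c)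
  product-diff = solve 4 (λ a b c d → a :* b :- c :* d := a :* (b :- d) :+ d :* (a :- c)) refl

  half-pos : ∀ {ε} → 0ℚ ℚ.< ε → 0ℚ ℚ.< ½ ℚ.* ε
  half-pos {ε} p = subst (ℚ._< ½ ℚ.* ε) (ℚₚ.*-zeroʳ ½) (ℚₚ.*-monoʳ-<-pos ½ p)

  halves : ∀ ε → ½ ℚ.* ε ℚ.+ ½ ℚ.* ε ≡ ε
  halves ε = trans (sym (ℚₚ.*-distribʳ-+ ε ½ ½)) (ℚₚ.*-identityˡ ε)

  const-cauchy : ∀ q → IsCauchy (λ _ → q)
  const-cauchy q ε 0<ε = 0 , λ _ _ _ _ →
    subst (ℚ._< ε) (cong ℚ.∣_∣ (sym (ℚₚ.+-inverseʳ q))) 0<ε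

  +-cauchy : ∀ x y → IsCauchy x → IsCauchy y → IsCauchy (λ n → x n ℚ.+ y n)
  +-cauchy x y cx cy ε 0<ε with cx (½ ℚ.* ε) (half-pos 0<ε) | cy (½ ℚ.* ε) (half-pos 0<ε)
  ... | M , hx | N , hy = M ℕ.⊔ N , λ m n p q → begin-strict
    ℚ.∣ (x m ℚ.+ y m) ℚ.- (x n ℚ.+ y n) ∣
      ≡⟨ cong ℚ.∣_∣ (sum-diff (x m) (y m) (x n) (y n)) ⟩
    ℚ.∣ (x m ℚ.- x n) ℚ.+ (y m ℚ.- y n) ∣
      ≤⟨ ℚₚ.∣p+q∣≤∣p∣+∣q∣ (x m ℚ.- x n) (y m ℚ.- y n) ⟩
    ℚ.∣ x m ℚ.- x n ∣ ℚ.+ ℚ.∣ y m ℚ.- y n ∣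
      <⟨ ℚₚ.+-mono-< (hx m n (ℕₚ.m⊔n≤o⇒m≤o M N p) (ℕₚ.m⊔n≤o⇒m≤o M N q))
                     (hy m n (ℕₚ.m⊔n≤o⇒n≤o M N p) (ℕₚ.m⊔n≤o⇒n≤o M N q)) ⟩
    ½ ℚ.* ε ℚ.+ ½ ℚ.* ε ≡⟨ halves ε ⟩
    ε ∎
    where open ℚₚ.≤-Reasoning

  neg-cauchy : ∀ x → IsCauchy x → IsCauchy (λ n → ℚ.- x n)
  neg-cauchy x cx ε 0<ε with cx ε 0<ε
  ... | N , h = N , λ m n p q → subst (ℚ._< ε)
    (trans (sym (ℚₚ.∣-p∣≡∣p∣ (x m ℚ.- x n)))
      (cong ℚ.∣_∣ (neg-diff (x m) (x n))))
    (h m n p q)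

  bound : ∀ x → IsCauchy x → ∃[ B ] (0ℚ ℚ.< B × Eventually λ n → ℚ.∣ x n ∣ ℚ.≤ B)
  bound x cx with cx 1ℚ (ℚₚ.positive⁻¹ 1ℚ)
  ... | N , h = 1ℚ ℚ.+ ℚ.∣ x N ∣ , ℚₚ.+-mono-<-≤ (ℚₚ.positive⁻¹ 1ℚ) (ℚₚ.0≤∣p∣ (x N)) , N , λ n p → begin
    ℚ.∣ x n ∣
      ≡⟨ cong ℚ.∣_∣ (diff-cancel (x n) (x N)) ⟩
    ℚ.∣ (x n ℚ.- x N) ℚ.+ x N ∣       ≤⟨ ℚₚ.∣p+q∣≤∣p∣+∣q∣ (x n ℚ.- x N) (x N) ⟩
    ℚ.∣ x n ℚ.- x N ∣ ℚ.+ ℚ.∣ x N ∣   ≤⟨ ℚₚ.+-monoˡ-≤ ℚ.∣ x N ∣ (ℚₚ.<⇒≤ (h n N p ℕₚ.≤-refl)) ⟩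
    1ℚ ℚ.+ ℚ.∣ x N ∣ ∎
    where open ℚₚ.≤-Reasoning

  scale : ∀ {B ε} → 0ℚ ℚ.< B → 0ℚ ℚ.< ε → ∃[ δ ] (0ℚ ℚ.< δ × B ℚ.* δ ≡ ε)
  scale {B} {ε} 0<B 0<ε = B⁻¹ ℚ.* ε ,
    subst (ℚ._< B⁻¹ ℚ.* ε) (ℚₚ.*-zeroʳ B⁻¹) (ℚₚ.*-monoʳ-<-pos B⁻¹ 0<ε) ,
    trans (sym (ℚₚ.*-assoc B B⁻¹ ε))
      (trans (cong (ℚ._* ε) (ℚₚ.*-inverseʳ B)) (ℚₚ.*-identityˡ ε))
    where
    instance
      posB : ℚ.Positive B
      posB = ℚ.positive 0<B
      nzB : ℚ.NonZero B
      nzB = ℚₚ.pos⇒nonZero B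
    B⁻¹ : ℚ
    B⁻¹ = ℚ.1/ B
    instance
      posB⁻¹ : ℚ.Positive B⁻¹
      posB⁻¹ = ℚₚ.1/pos⇒pos B

  ∣*∣-bound : ∀ {p q B δ} → 0ℚ ℚ.< B → ℚ.∣ p ∣ ℚ.≤ B → ℚ.∣ q ∣ ℚ.< δ → ℚ.∣ p ℚ.* q ∣ ℚ.< B ℚ.* δ
  ∣*∣-bound {p} {q} {B} {δ} 0<B p≤B q<δ = begin-strict
    ℚ.∣ p ℚ.* q ∣        ≡⟨ ℚₚ.∣p*q∣≡∣p∣*∣q∣ p q ⟩
    ℚ.∣ p ∣ ℚ.* ℚ.∣ q ∣  ≤⟨ ℚₚ.*-monoʳ-≤-nonNeg ℚ.∣ q ∣ {{ℚ.nonNegative (ℚₚ.0≤∣p∣ q)}} p≤B ⟩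
    B ℚ.* ℚ.∣ q ∣        <⟨ ℚₚ.*-monoʳ-<-pos B {{ℚ.positive 0<B}} q<δ ⟩
    B ℚ.* δ ∎
    where open ℚₚ.≤-Reasoning

  product-close : ∀ {B C δ η ε} a b c d → 0ℚ ℚ.< B → 0ℚ ℚ.< C →
    B ℚ.* δ ≡ ½ ℚ.* ε → C ℚ.* η ≡ ½ ℚ.* ε →
    ℚ.∣ a ∣ ℚ.≤ B → ℚ.∣ d ∣ ℚ.≤ C → ℚ.∣ b ℚ.- d ∣ ℚ.< δ → ℚ.∣ a ℚ.- c ∣ ℚ.< η →
    ℚ.∣ a ℚ.* b ℚ.- c ℚ.* d ∣ ℚ.< ε
  product-close {B} {C} {δ} {η} {ε} a b c d 0<B 0<C Bδ Cη a≤B d≤C b-d a-c = begin-strict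
    ℚ.∣ a ℚ.* b ℚ.- c ℚ.* d ∣
      ≡⟨ cong ℚ.∣_∣ (product-diff a b c d) ⟩
    ℚ.∣ a ℚ.* (b ℚ.- d) ℚ.+ d ℚ.* (a ℚ.- c) ∣
      ≤⟨ ℚₚ.∣p+q∣≤∣p∣+∣q∣ (a ℚ.* (b ℚ.- d)) (d ℚ.* (a ℚ.- c)) ⟩
    ℚ.∣ a ℚ.* (b ℚ.- d) ∣ ℚ.+ ℚ.∣ d ℚ.* (a ℚ.- c) ∣
      <⟨ ℚₚ.+-mono-< (∣*∣-bound {a} {b ℚ.- d} {B} {δ} 0<B a≤B b-d)
                     (∣*∣-bound {d} {a ℚ.- c} {C} {η} 0<C d≤C a-c) ⟩
    B ℚ.* δ ℚ.+ C ℚ.* η   ≡⟨ cong₂ ℚ._+_ Bδ Cη ⟩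
    ½ ℚ.* ε ℚ.+ ½ ℚ.* ε   ≡⟨ halves ε ⟩
    ε ∎
    where open ℚₚ.≤-Reasoning

  *-cauchy : ∀ x y → IsCauchy x → IsCauchy y → IsCauchy (λ n → x n ℚ.* y n)
  *-cauchy x y cx cy ε 0<ε =
    let B , 0<B , K , x≤B = bound x cx
        C , 0<C , L , y≤C = bound y cy
        δ , 0<δ , Bδ = scale {B} {½ ℚ.* ε} 0<B (half-pos 0<ε)
        η , 0<η , Cη = scale {C} {½ ℚ.* ε} 0<C (half-pos 0<ε)
        M , hy = cy δ 0<δ
        N , hx = cx η 0<η
    in (K ℕ.⊔ L) ℕ.⊔ (M ℕ.⊔ N) , λ m n p q →
    let MN≤m = ℕₚ.m⊔n≤o⇒n≤o (K ℕ.⊔ L) (M ℕ.⊔ N) p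
        MN≤n = ℕₚ.m⊔n≤o⇒n≤o (K ℕ.⊔ L) (M ℕ.⊔ N) q
    in product-close {B} {C} {δ} {η} {ε} (x m) (y m) (x n) (y n) 0<B 0<C Bδ Cη
         (x≤B m (ℕₚ.m⊔n≤o⇒m≤o K L (ℕₚ.m⊔n≤o⇒m≤o (K ℕ.⊔ L) (M ℕ.⊔ N) p)))
         (y≤C n (ℕₚ.m⊔n≤o⇒n≤o K L (ℕₚ.m⊔n≤o⇒m≤o (K ℕ.⊔ L) (M ℕ.⊔ N) q)))
         (hy m n (ℕₚ.m⊔n≤o⇒m≤o M N MN≤m) (ℕₚ.m⊔n≤o⇒m≤o M N MN≤n))
         (hx m n (ℕₚ.m⊔n≤o⇒n≤o M N MN≤m) (ℕₚ.m⊔n≤o⇒n≤o M N MN≤n))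

infixl 6 _+_ _-_
infixl 7 _*_
infix  8 -_

fromℚ : ℚ → ℝ
fromℚ q = mkℝ (λ _ → q) (const-cauchy q)

0ℝ 1ℝ : ℝ
0ℝ = fromℚ 0ℚ
1ℝ = fromℚ 1ℚ

_+_ : ℝ → ℝ → ℝ
x + y = mkℝ (λ n → seq x n ℚ.+ seq y n) (+-cauchy (seq x) (seq y) (cauchy x) (cauchy y))

_*_ : ℝ → ℝ → ℝ
x * y = mkℝ (λ n → seq x n ℚ.* seq y n) (*-cauchy (seq x) (seq y) (cauchy x) (cauchy y))

-_ : ℝ → ℝ
- x = mkℝ (λ n → ℚ.- seq x n) (neg-cauchy (seq x) (cauchy x))

_-_ : ℝ → ℝ → ℝ
x - y = x + (- y)

ℤ→ℚ : ℤ → ℚ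
ℤ→ℚ z = z ℚ./ 1

fromℤ : ℤ → ℝ
fromℤ z = fromℚ (ℤ→ℚ z)

ℝ-rawRing : RawRing 0ℓ 0ℓ
ℝ-rawRing = record
  { Carrier = ℝ ; _≈_ = _≈_ ; _+_ = _+_ ; _*_ = _*_ ; -_ = -_ ; 0# = 0ℝ ; 1# = 1ℝ }

record ℂ : Set where
  constructor _+i_
  field
    re im : ℝ

open ℂ public

infix 4 _≈ᶜ_

_≈ᶜ_ : ℂ → ℂ → Set
z ≈ᶜ w = re z ≈ re w × im z ≈ im w

fromℝ : ℝ → ℂ
fromℝ x = x +i 0ℝ

ℂ-rawRing : RawRing 0ℓ 0ℓ
ℂ-rawRing = record
  { Carrier = ℂ
  ; _≈_ = _≈ᶜ_
  ; _+_ = λ z w → (re z + re w) +i (im z + im w)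
  ; _*_ = λ z w → (re z * re w - im z * im w) +i (re z * im w + im z * re w)
  ; -_  = λ z → (- re z) +i (- im z)
  ; 0#  = fromℝ 0ℝ
  ; 1#  = fromℝ 1ℝ
  }

-- The modulus as a relation: ρ is the nonnegative square root of re² + im².
∣_∣≔_ : ℂ → ℝ → Set
∣ z ∣≔ ρ = 0ℝ ≤ ρ × ρ * ρ ≈ re z * re z + im z * im z

-- A polynomial of formal degree n is its vector of n + 1 coefficients,
-- constant term first; a monic one therefore has degree exactly n.
Poly : Set → ℕ → Set
Poly A n = Vec A (suc n)

Monic : ∀ {n} → Poly ℚ n → Set
Monic p = Vec.last p ≡ 1ℚ

module Evaluation (R : RawRing 0ℓ 0ℓ) (ι : ℚ → RawRing.Carrier R) where
  private module R = RawRing R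

  eval : ∀ {n} → Vec ℚ n → R.Carrier → R.Carrier
  eval []       x = R.0#
  eval (c ∷ cs) x = ι c R.+ x R.* eval cs x

  IsRoot : ∀ {n} → Vec ℚ n → R.Carrier → Set
  IsRoot p x = eval p x R.≈ R.0#

open Evaluation ℝ-rawRing fromℚ public
  using () renaming (eval to evalℝ; IsRoot to IsRealRoot)
open Evaluation ℂ-rawRing (λ q → fromℝ (fromℚ q)) public
  using () renaming (eval to evalℂ; IsRoot to IsComplexRoot)

ℤ→ℚ[x] : ∀ {n} → Poly ℤ n → Poly ℚ n
ℤ→ℚ[x] = Vec.map ℤ→ℚ

-- The minimal polynomial over ℚ: monic of least degree among those vanishing at β.
record IsMinimalPolynomial {n : ℕ} (p : Poly ℚ n) (β : ℝ) : Set where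
  field
    monic   : Monic p
    root    : IsRealRoot p β
    minimal : ∀ {m} (q : Poly ℚ m) → Monic q → IsRealRoot q β → n ℕ.≤ m

IsAlgebraicInteger : ℝ → Set
IsAlgebraicInteger β =
  ∃[ n ] Σ (Poly ℤ n) λ f → Monic (ℤ→ℚ[x] f) × IsRealRoot (ℤ→ℚ[x] f) β

-- The Galois conjugates of β, including β itself.
IsConjugate : ℝ → ℂ → Set
IsConjugate β α =
  ∃[ n ] Σ (Poly ℚ n) λ p → IsMinimalPolynomial p β × IsComplexRoot p α

IsOtherConjugate : ℝ → ℂ → Set
IsOtherConjugate β α = IsConjugate β α × ¬ (α ≈ᶜ fromℝ β)

record IsSalemNumber (β : ℝ) : Set where
  field
    algebraicInteger : IsAlgebraicInteger β
    >1               : 1ℝ < β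
    conjugates≤1     : ∀ α → IsOtherConjugate β α → ∃[ ρ ] (∣ α ∣≔ ρ × ρ ≤ 1ℝ)
    conjugate≈1      : ∃[ α ] (IsOtherConjugate β α × ∃[ ρ ] (∣ α ∣≔ ρ × ρ ≈ 1ℝ))

IsSalemPolynomial : ∀ {n} → Poly ℚ n → Set
IsSalemPolynomial p = ∃[ β ] (IsSalemNumber β × IsMinimalPolynomial p β)

IsFloor : ℤ → ℝ → Set
IsFloor z x = fromℤ z ≤ x × x < fromℤ (z ℤ.+ ℤ.1ℤ)

-- c is the digit sequence d_β(1) and r its sequence of remainders.  The digits
-- are c 1, c 2, …; the value c 0 is unused and unconstrained.  The floor
-- function is not computable on ℝ, hence a relation; it determines r (up to _≈_)
-- and the digits uniquely.
record IsGreedyExpansion (β : ℝ) (c : ℕ → ℤ) (r : ℕ → ℝ) : Set where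
  field
    initial   : r 0 ≈ 1ℝ
    digit     : ∀ n → IsFloor (c (suc n)) (β * r n)
    remainder : ∀ n → r (suc n) ≈ β * r n - fromℤ (c (suc n))

PeriodicFrom : (ℕ → ℤ) → ℕ → ℕ → Set
PeriodicFrom c m p =
  1 ℕ.≤ p × (∀ n → 1 ℕ.≤ n → c (n ℕ.+ m) ≡ c (n ℕ.+ m ℕ.+ p))

IsPreperiodLength : (ℕ → ℤ) → ℕ → Set
IsPreperiodLength c m =
  (∃[ p ] PeriodicFrom c m p) × (∀ m′ p′ → PeriodicFrom c m′ p′ → m ℕ.≤ m′)

-- The first alternative is the convention that the period length is 0 when the
-- expansion terminates.
IsPeriodLength : (ℕ → ℤ) → (ℕ → ℝ) → ℕ → Set
IsPeriodLength c r p =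
  ((∃[ N ] r N ≈ 0ℝ) × p ≡ 0) ⊎
  ((∀ N → ¬ (r N ≈ 0ℝ)) ×
   (∃[ m ] PeriodicFrom c m p) × (∀ m′ p′ → PeriodicFrom c m′ p′ → p ℕ.≤ p′))

salemCoefficients : ℤ → Poly ℤ 6
salemCoefficients a =
  + 1 ∷ a ∷ ℤ.- (+ 2 ℤ.* a) ∷ + 2 ℤ.* a ℤ.- + 3 ∷ ℤ.- (+ 2 ℤ.* a) ∷ a ∷ + 1 ∷ []

P : ℕ → Poly ℚ 6
P k = ℤ→ℚ[x] (salemCoefficients (ℤ.- (+ 6 ℤ.* + k) ℤ.- + 3))

{-# OPTIONS --safe #-}

-- P(x) = x³ Q(x + 1/x) for the cubic Q(y) = y (y - 2) (y - 6k - 1) + y - 3, which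
-- has two roots in (-2, 2) and one root y > 3.  The former give conjugates on the
-- unit circle, the latter gives β and 1/β with 6k < β < 6k + 1.
--
-- Q is an Eisenstein polynomial at 3.  By infinite descent with the norm form of
-- ℚ(y), the powers 1, y, y² are linearly independent over ℚ.  The norm A² + AB y + B²
-- of A + Bβ from ℚ(β) to ℚ(y) is anisotropic at 3 as well, because -1 is not a
-- square modulo 3; hence β has degree 6.
--
-- The digits of the expansion of 1 come in blocks of four whose remainders, multiplied
-- by (β - 1)² (β² + 1), are linear in the index of the block, so the remainder
-- r₁ = β - 6k is seen to recur after 8k + 6 steps.  Going backwards from r₁, each
-- digit < 6k propagates 0 < r < 1, and the two digits 6k in the period are compared
-- with the first digits of r₁ = 0.(6k-2)(6k)2….

module Submission where

open import Algebra.Bundles using (CommutativeRing)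
import Algebra.Solver.Ring
open import Algebra.Solver.Ring.AlmostCommutativeRing
  using (fromCommutativeRing; _-Raw-AlmostCommutative⟶_)
open import Data.Empty using (⊥; ⊥-elim)
open import Data.Fin using (Fin; #_)
open import Data.Integer as ℤ using (ℤ; +_; -[1+_]; 0ℤ; 1ℤ)
import Data.Integer.DivMod as ℤ
import Data.Integer.Properties as ℤₚ
import Data.Integer.Solver
open import Data.List as List using (List; []; _∷_; _++_; take; length)
import Data.List.Properties as Listₚ
open import Data.List.Relation.Binary.Pointwise using (Pointwise; []; _∷_)
open import Data.List.Relation.Unary.All as All using (All; []; _∷_)
import Data.List.Relation.Unary.All.Properties as Allₚ
open import Data.Maybe as Maybe using (Maybe)
open import Data.Nat as ℕ using (ℕ; zero; suc; z≤n; s≤s; _%_; _/_)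
open import Data.Nat.Divisibility using (_∣_; _∣?_; divides; ∣m+n∣m⇒∣n; ∣⇒≤; n∣m*n)
import Data.Nat.DivMod as ℕ
import Data.Nat.Properties as ℕₚ
import Data.Nat.Solver
open import Data.Product using (Σ; ∃; ∃-syntax; ∃₂; _×_; _,_; proj₁; proj₂)
open import Data.Rational as ℚ using (ℚ; 0ℚ; 1ℚ; ½)
import Data.Rational.Properties as ℚₚ
import Data.Rational.Solver
import Data.Rational.Unnormalised as ℚᵘ
import Data.Rational.Unnormalised.Properties as ℚᵘₚ
open import Data.Sum using (_⊎_; inj₁; inj₂)
open import Data.Vec as Vec using (Vec; []; _∷_)
open import Data.Vec.N-ary using (N-ary; _$ⁿ_; Eq; curryⁿ; curryⁿ-cong)
import Data.Vec.Properties as Vecₚ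
open import Data.Vec.Relation.Binary.Pointwise.Inductive as Pointwiseᵛ
  using ([]; _∷_) renaming (Pointwise to Pointwiseᵛ)
open import Data.Vec.Relation.Unary.All as VecAll using ([]; _∷_) renaming (All to Allᵛ)
open import Level using (0ℓ)
open import Relation.Binary.PropositionalEquality as ≡ using (_≡_; _≢_)
open import Relation.Nullary using (¬_)
open import Relation.Nullary.Decidable using (dec⇒maybe; from-no; from-yes)

open import Defs using (PeriodicFrom)

-- Rings with a copy of ℤ, and ordered rings

-- Neither equality nor order of Cauchy reals is decidable. The algebra is therefore done in an
-- abstract ring with a positivity predicate: an inequality is multiplied by a positive factor until
-- it is visibly a sum of positive terms, and the alternative between two equations is obtained only
-- up to double negation. Witnesses are explicit: inverses of roots are polynomials in the roots,
-- and points of the unit circle come from its rational parametrisation, so that neither a division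
-- nor a square root of real numbers is taken.
--
-- Linear independence replaces the factorisation of polynomials: the minimal polynomial is a monic
-- one of least degree, so it is relations of degree at most 5 that must be excluded.
--
-- The digits are verified, not computed. If the digit d and the next remainder r' satisfy d ≤ 6k -
-- 1 and r' < 1, then r = (d + r')/β < 6k/β < 1. Only the digit 6k fails this test: it needs r' < β
-- - 6k = r₁, hence the comparison with r₁ at just these places.

infixl 6 _⊕_
infixl 7 _⊗_

-- The norm forms occur both as elements of the ring that contains the root and as integers whose
-- divisibility by 3 matters. One syntax with two evaluations, related by `ι-eval`, carries the
-- vanishing of a norm from the first to the second.
data Expr (n : ℕ) : Set where
  con     : ℤ → Expr n
  var     : Fin n → Expr n
  _⊕_ _⊗_ : Expr n → Expr n → Expr n
  ⊝_      : Expr n → Expr n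

-- The ring solver needs coefficients with decidable equality, which ℤ provides and the carrier need
-- not have. `ι` is a field so that each ring keeps its own constants, such as `fromℤ`.
record IntegerAlgebra : Set₁ where
  field
    commutativeRing : CommutativeRing 0ℓ 0ℓ

  open CommutativeRing commutativeRing public

  field
    ι     : ℤ → Carrier
    ι-+   : ∀ m n → ι (m ℤ.+ n) ≈ ι m + ι n
    ι-*   : ∀ m n → ι (m ℤ.* n) ≈ ι m * ι n
    ι-neg : ∀ m → ι (ℤ.- m) ≈ - ι m
    ι-0   : ι 0ℤ ≈ 0#
    ι-1   : ι 1ℤ ≈ 1#

  ⌞_⌟ : ℕ → Carrier
  ⌞ n ⌟ = ι (+ n)

  private
    ι-morphism : CommutativeRing.rawRing ℤₚ.+-*-commutativeRing -Raw-AlmostCommutative⟶ fromCommutativeRing commutativeRing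
    ι-morphism = record
      { ⟦_⟧ = ι ; +-homo = ι-+ ; *-homo = ι-* ; -‿homo = ι-neg ; 0-homo = ι-0 ; 1-homo = ι-1 }

    _ι≟_ : ∀ m n → Maybe (ι m ≈ ι n)
    m ι≟ n = Maybe.map (λ m≡n → reflexive (≡.cong ι m≡n)) (dec⇒maybe (m ℤₚ.≟ n))

    module RingSolver = Algebra.Solver.Ring
      (CommutativeRing.rawRing ℤₚ.+-*-commutativeRing) (fromCommutativeRing commutativeRing) ι-morphism _ι≟_

  -- The library's solver, except that the normal forms are compared as syntax:
  -- comparing their values in an abstract ring would put these into the proof terms.
  module Solver where
    open RingSolver public using (Polynomial; con; _:+_; _:*_; _:-_; :-_; _:^_; _:=_)
    open RingSolver using (⟦_⟧; ⟦_⟧N; normalise; var)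

    prove : ∀ {n} (ρ : Vec Carrier n) (e₁ e₂ : Polynomial n) → normalise e₁ ≡ normalise e₂ → ⟦ e₁ ⟧ ρ ≈ ⟦ e₂ ⟧ ρ
    prove ρ e₁ e₂ eq = RingSolver.prove ρ e₁ e₂ (reflexive (≡.cong (λ e → ⟦ e ⟧N ρ) eq))

    close : ∀ n → N-ary n (Polynomial n) (Polynomial n × Polynomial n) → Polynomial n × Polynomial n
    close n f = f $ⁿ Vec.map var (Vec.allFin n)

    solve : ∀ n (f : N-ary n (Polynomial n) (Polynomial n × Polynomial n)) →
      normalise (proj₁ (close n f)) ≡ normalise (proj₂ (close n f)) →
      Eq n _≈_ (curryⁿ ⟦ proj₁ (close n f) ⟧) (curryⁿ ⟦ proj₂ (close n f) ⟧)
    solve n f eq = curryⁿ-cong _≈_ ⟦ proj₁ (close n f) ⟧ ⟦ proj₂ (close n f) ⟧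
      (λ ρ → prove ρ (proj₁ (close n f)) (proj₂ (close n f)) eq)

  eval : ∀ {n} → Expr n → Vec Carrier n → Carrier
  eval (con c) ρ = ι c
  eval (var i) ρ = Vec.lookup ρ i
  eval (e ⊕ f) ρ = eval e ρ + eval f ρ
  eval (e ⊗ f) ρ = eval e ρ * eval f ρ
  eval (⊝ e)   ρ = - eval e ρ

  eval-cong : ∀ {n} (e : Expr n) {ρ σ} → Pointwiseᵛ _≈_ ρ σ → eval e ρ ≈ eval e σ
  eval-cong (con c) h = refl
  eval-cong (var i) h = Pointwiseᵛ.lookup h i
  eval-cong (e ⊕ f) h = +-cong (eval-cong e h) (eval-cong f h)
  eval-cong (e ⊗ f) h = *-cong (eval-cong e h) (eval-cong f h)
  eval-cong (⊝ e)   h = -‿cong (eval-cong e h)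

  toPolynomial : ∀ {n} → Expr n → Solver.Polynomial n
  toPolynomial (con c) = Solver.con c
  toPolynomial (var i) = RingSolver.var i
  toPolynomial (e ⊕ f) = toPolynomial e Solver.:+ toPolynomial f
  toPolynomial (e ⊗ f) = toPolynomial e Solver.:* toPolynomial f
  toPolynomial (⊝ e)   = Solver.:- toPolynomial e

  affine : ∀ a b n → ⌞ a ℕ.+ b ℕ.* n ⌟ ≈ ι (+ a) + ι (+ b) * ⌞ n ⌟
  affine a b n = trans (ι-+ (+ a) (+ (b ℕ.* n)))
    (+-congˡ (trans (reflexive (≡.cong ι (ℤₚ.pos-* b n))) (ι-* (+ b) (+ n))))

  x-y≈0⇒x≈y : ∀ {x y} → x - y ≈ 0# → x ≈ y
  x-y≈0⇒x≈y {x} {y} h = trans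
    (solve 2 (λ x y → x := (x :- y) :+ y) ≡.refl x y)
    (trans (+-congʳ h) (+-identityˡ y))
    where open Solver

  x≈y⇒x-y≈0 : ∀ {x y} → x ≈ y → x - y ≈ 0#
  x≈y⇒x-y≈0 {x} {y} h = trans (+-congʳ h) (-‿inverseʳ y)

  -- Calculations modulo a relation `p` are certified by the quotient `c`; what remains is a
  -- polynomial identity for the solver.
  modulo : ∀ {x y p c} → p ≈ 0# → x ≈ y + c * p → x ≈ y
  modulo {y = y} {c = c} p≈0 h =
    trans h (trans (+-congˡ (trans (*-congˡ p≈0) (zeroʳ c))) (+-identityʳ y))

  *-zero-cong : ∀ {x} c → x ≈ 0# → c * x ≈ 0#
  *-zero-cong c h = trans (*-congˡ h) (zeroʳ c)

ℤ-algebra : IntegerAlgebra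
ℤ-algebra = record
  { commutativeRing = ℤₚ.+-*-commutativeRing
  ; ι     = λ n → n
  ; ι-+   = λ _ _ → ≡.refl
  ; ι-*   = λ _ _ → ≡.refl
  ; ι-neg = λ _ → ≡.refl
  ; ι-0   = ≡.refl
  ; ι-1   = ≡.refl
  }

open IntegerAlgebra ℤ-algebra public using () renaming (eval to evalℤ)

module _ (A : IntegerAlgebra) where
  open IntegerAlgebra A

  ι-eval : ∀ {n} (e : Expr n) ρ → ι (evalℤ e ρ) ≈ eval e (Vec.map ι ρ)
  ι-eval (con c) ρ = refl
  ι-eval (var i) ρ = reflexive (≡.sym (Vecₚ.lookup-map i ι ρ))
  ι-eval (e ⊕ f) ρ = trans (ι-+ _ _) (+-cong (ι-eval e ρ) (ι-eval f ρ))
  ι-eval (e ⊗ f) ρ = trans (ι-* _ _) (*-cong (ι-eval e ρ) (ι-eval f ρ))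
  ι-eval (⊝ e)   ρ = trans (ι-neg _) (-‿cong (ι-eval e ρ))

-- Strict positivity is the primitive notion, as a constructive order is not total. Cancelling a
-- positive factor takes the place of division, and squares, which may vanish, enter only when added
-- to something positive. `tight` is the substitute for trichotomy in proofs of equations.
record OrderedRing : Set₁ where
  field
    integerAlgebra : IntegerAlgebra

  open IntegerAlgebra integerAlgebra public

  field
    Pos         : Carrier → Set
    Pos-cong    : ∀ {x y} → x ≈ y → Pos x → Pos y
    Pos-+       : ∀ {x y} → Pos x → Pos y → Pos (x + y)
    Pos-*       : ∀ {x y} → Pos x → Pos y → Pos (x * y)
    Pos-1       : Pos 1#
    ¬Pos-0      : ¬ Pos 0#
    Pos-cancel  : ∀ {x w} → Pos w → Pos (x * w) → Pos x
    zero-cancel : ∀ {x w} → Pos w → x * w ≈ 0# → x ≈ 0#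
    Pos-+-*-self : ∀ {x} y → Pos x → Pos (x + y * y)
    tight       : ∀ {x} → ¬ Pos x → ¬ Pos (- x) → x ≈ 0#

  Pos-ι-suc : ∀ n → Pos ⌞ suc n ⌟
  Pos-ι-suc zero    = Pos-cong (sym ι-1) Pos-1
  Pos-ι-suc (suc n) = Pos-cong (sym (ι-+ (+ 1) (+ suc n))) (Pos-+ (Pos-ι-suc 0) (Pos-ι-suc n))

  ι-injective : ∀ {m} → ι m ≈ 0# → m ≡ 0ℤ
  ι-injective {+ zero}   h = ≡.refl
  ι-injective {+ suc n}  h = ⊥-elim (¬Pos-0 (Pos-cong h (Pos-ι-suc n)))
  ι-injective { -[1+ n ]} h = ⊥-elim (¬Pos-0 (Pos-cong
    (trans (sym (trans (+-congʳ h) (+-identityˡ _)))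
      (trans (sym (ι-+ -[1+ n ] (+ suc n))) (trans (reflexive (≡.cong ι (ℤₚ.+-inverseˡ (+ suc n)))) ι-0)))
    (Pos-ι-suc n)))

-- The polynomial P and its trace polynomial

module SalemPolynomial (A : IntegerAlgebra) where
  open IntegerAlgebra A
  open Solver

  salem : Carrier → Carrier → Carrier
  salem κ x = ι (+ 1) + x * (a + x * (- (ι (+ 2) * a) + x * (ι (+ 2) * a - ι (+ 3)
                + x * (- (ι (+ 2) * a) + x * (a + x * ι (+ 1))))))
    where a = - (ι (+ 6) * κ) - ι (+ 3)

  :salem : ∀ {n} → Polynomial n → Polynomial n → Polynomial n
  :salem κ x = con (+ 1) :+ x :* (a :+ x :* (:- (con (+ 2) :* a) :+ x :* (con (+ 2) :* a :- con (+ 3)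
                :+ x :* (:- (con (+ 2) :* a) :+ x :* (a :+ x :* con (+ 1))))))
    where a = :- (con (+ 6) :* κ) :- con (+ 3)

  -- The left side is what the evaluation of `P k` unfolds to, over ℝ as well as over ℂ; `salem` has
  -- k as a ring element, so that the solver can treat it as a variable.
  salem-integral : ∀ k x → let a = ℤ.- (+ 6 ℤ.* + k) ℤ.- + 3 in
    ι (+ 1) + x * (ι a + x * (ι (ℤ.- (+ 2 ℤ.* a)) + x * (ι (+ 2 ℤ.* a ℤ.- + 3)
      + x * (ι (ℤ.- (+ 2 ℤ.* a)) + x * (ι a + x * (ι (+ 1) + x * 0#))))))
    ≈ salem (ι (+ k)) x
  salem-integral k x = +-congˡ (*-congˡ (+-cong a (*-congˡ (+-cong b (*-congˡ (+-cong c (*-congˡ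
      (+-cong b (*-congˡ (+-cong a (*-congˡ (trans (+-congˡ (zeroʳ x)) (+-identityʳ (ι (+ 1)))))))))))))))
    where
    minus : ∀ m n → ι (m ℤ.- n) ≈ ι m - ι n
    minus m n = trans (ι-+ m (ℤ.- n)) (+-congˡ (ι-neg n))
    a = trans (minus (ℤ.- (+ 6 ℤ.* + k)) (+ 3)) (+-congʳ (trans (ι-neg (+ 6 ℤ.* + k)) (-‿cong (ι-* (+ 6) (+ k)))))
    2a = trans (ι-* (+ 2) (ℤ.- (+ 6 ℤ.* + k) ℤ.- + 3)) (*-congˡ a)
    b = trans (ι-neg (+ 2 ℤ.* (ℤ.- (+ 6 ℤ.* + k) ℤ.- + 3))) (-‿cong 2a)
    c = trans (minus (+ 2 ℤ.* (ℤ.- (+ 6 ℤ.* + k) ℤ.- + 3)) (+ 3)) (+-congʳ 2a)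

  salem-cong : ∀ κ {x x′} → x ≈ x′ → salem κ x ≈ salem κ x′
  salem-cong κ h = +-congˡ (*-cong h (+-congˡ (*-cong h (+-congˡ (*-cong h (+-congˡ
    (*-cong h (+-congˡ (*-cong h (+-congˡ (*-cong h refl)))))))))))

  -- The trace polynomial: salem κ x = x³ · trace κ (x + 1/x).
  trace : Carrier → Carrier → Carrier
  trace κ y = y * (y - ι (+ 2)) * (y - ι (+ 6) * κ - ι (+ 1)) + (y - ι (+ 3))

  trace-cong : ∀ κ {x y} → x ≈ y → trace κ x ≈ trace κ y
  trace-cong κ h = +-cong (*-cong (*-cong h (+-congʳ h)) (+-congʳ (+-congʳ h))) (+-congʳ h)

  :trace : ∀ {n} → Polynomial n → Polynomial n → Polynomial n
  :trace κ y = y :* (y :- con (+ 2)) :* (y :- con (+ 6) :* κ :- con (+ 1)) :+ (y :- con (+ 3))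

  -- P has constant term 1, so at a root 1 is -x times the rest of the Horner scheme, and 1/x is
  -- available without a division.
  inverse : Carrier → Carrier → Carrier
  inverse κ x = - (a + x * (- (ι (+ 2) * a) + x * (ι (+ 2) * a - ι (+ 3)
                  + x * (- (ι (+ 2) * a) + x * (a + x * ι (+ 1))))))
    where a = - (ι (+ 6) * κ) - ι (+ 3)

  x*inverse≈1 : ∀ {κ x} → salem κ x ≈ 0# → x * inverse κ x ≈ 1#
  x*inverse≈1 {κ} {x} h = trans (modulo {c = - ι (+ 1)} h
    (solve 2 (λ κ x → let a = :- (con (+ 6) :* κ) :- con (+ 3) in
      x :* (:- (a :+ x :* (:- (con (+ 2) :* a) :+ x :* (con (+ 2) :* a :- con (+ 3)
                :+ x :* (:- (con (+ 2) :* a) :+ x :* (a :+ x :* con (+ 1)))))))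
      := con (+ 1) :+ (:- con (+ 1)) :* :salem κ x) ≡.refl κ x)) ι-1

  private
    -- This is x³ times the trace polynomial at (x² + u)/x. The slot `u` allows 1 to be exchanged
    -- for x z: the former gives `salem`, the latter makes the factor x³ split off.
    homogenised : Carrier → Carrier → Carrier → Carrier
    homogenised κ x u =
      let s = x * x + u in
      s * (s - ι (+ 2) * x) * (s - (ι (+ 6) * κ + ι (+ 1)) * x) + x * x * (s - ι (+ 3) * x)

    :homogenised : ∀ {n} → Polynomial n → Polynomial n → Polynomial n → Polynomial n
    :homogenised κ x u =
      let s = x :* x :+ u in
      s :* (s :- con (+ 2) :* x) :* (s :- (con (+ 6) :* κ :+ con (+ 1)) :* x) :+ x :* x :* (s :- con (+ 3) :* x)

    homogenised-cong : ∀ κ x {u v} → u ≈ v → homogenised κ x u ≈ homogenised κ x v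
    homogenised-cong κ x h = +-cong
      (*-cong (*-cong (+-congˡ h) (+-congʳ (+-congˡ h))) (+-congʳ (+-congˡ h)))
      (*-congˡ (+-congʳ (+-congˡ h)))

  salem≈x³trace : ∀ {κ x z} → x * z ≈ 1# → salem κ x ≈ x * x * x * trace κ (x + z)
  salem≈x³trace {κ} {x} {z} h = trans
    (solve 2 (λ κ x → :salem κ x := :homogenised κ x (con (+ 1))) ≡.refl κ x)
    (trans (homogenised-cong κ x (trans ι-1 (sym h)))
      (solve 3 (λ κ x z → :homogenised κ x (x :* z) := x :* x :* x :* :trace κ (x :+ z)) ≡.refl κ x z))

  salem≈0⇒trace≈0 : ∀ {κ x z} → x * z ≈ 1# → salem κ x ≈ 0# → trace κ (x + z) ≈ 0#
  salem≈0⇒trace≈0 {κ} {x} {z} h root = begin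
    trace κ (x + z)                            ≈⟨ *-identityˡ _ ⟨
    1# * trace κ (x + z)                       ≈⟨ *-congʳ (trans (*-cong (*-cong h h) h)
                                                    (trans (*-congʳ (*-identityˡ _)) (*-identityˡ _))) ⟨
    x * z * (x * z) * (x * z) * trace κ (x + z)
      ≈⟨ solve 3 (λ x z q → x :* z :* (x :* z) :* (x :* z) :* q := z :* z :* z :* (x :* x :* x :* q))
           ≡.refl x z (trace κ (x + z)) ⟩
    z * z * z * (x * x * x * trace κ (x + z))  ≈⟨ *-zero-cong _ (trans (sym (salem≈x³trace h)) root) ⟩
    0#                                         ∎
    where open import Relation.Binary.Reasoning.Setoid setoid

  trace≈0⇒salem≈0 : ∀ {κ x z} → x * z ≈ 1# → trace κ (x + z) ≈ 0# → salem κ x ≈ 0#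
  trace≈0⇒salem≈0 h q = trans (salem≈x³trace h) (*-zero-cong _ q)

  record TraceRoots (κ y₁ y₂ y₃ : Carrier) : Set where
    field
      e₁ : y₁ + y₂ + y₃ ≈ ι (+ 6) * κ + ι (+ 3)
      e₂ : y₁ * y₂ + y₁ * y₃ + y₂ * y₃ ≈ ι (+ 12) * κ + ι (+ 3)
      e₃ : y₁ * y₂ * y₃ ≈ ι (+ 3)

  -- The product depends on the three roots only through their elementary symmetric functions;
  -- `expanded` is this dependence, to be evaluated at either form of their values.
  salem-factors : ∀ {κ y₁ y₂ y₃} → TraceRoots κ y₁ y₂ y₃ → ∀ x → salem κ x ≈
    (x * x - y₁ * x + ι (+ 1)) * (x * x - y₂ * x + ι (+ 1)) * (x * x - y₃ * x + ι (+ 1))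
  salem-factors {κ} {y₁} {y₂} {y₃} roots x = begin
    salem κ x
      ≈⟨ solve 2 (λ κ x → :salem κ x := :expanded x
           (con (+ 6) :* κ :+ con (+ 3)) (con (+ 12) :* κ :+ con (+ 3)) (con (+ 3))) ≡.refl κ x ⟩
    expanded (ι (+ 6) * κ + ι (+ 3)) (ι (+ 12) * κ + ι (+ 3)) (ι (+ 3))
      ≈⟨ +-cong (+-congˡ (*-cong (+-congʳ (+-cong e₃ (*-congˡ e₁))) refl))
           (+-cong (*-cong e₁ refl) (*-cong (+-congʳ e₂) refl)) ⟨
    expanded (y₁ + y₂ + y₃) (y₁ * y₂ + y₁ * y₃ + y₂ * y₃) (y₁ * y₂ * y₃)
      ≈⟨ solve 4 (λ y₁ y₂ y₃ x → :expanded x (y₁ :+ y₂ :+ y₃) (y₁ :* y₂ :+ y₁ :* y₃ :+ y₂ :* y₃) (y₁ :* y₂ :* y₃)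
           := (x :* x :- y₁ :* x :+ con (+ 1)) :* (x :* x :- y₂ :* x :+ con (+ 1)) :* (x :* x :- y₃ :* x :+ con (+ 1)))
           ≡.refl y₁ y₂ y₃ x ⟩
    (x * x - y₁ * x + ι (+ 1)) * (x * x - y₂ * x + ι (+ 1)) * (x * x - y₃ * x + ι (+ 1)) ∎
    where
    open TraceRoots roots
    open import Relation.Binary.Reasoning.Setoid setoid
    expanded : Carrier → Carrier → Carrier → Carrier
    expanded e₁ e₂ e₃ = x ^ 6 + ι (+ 1) + (e₃ + ι (+ 2) * e₁ + ι (+ 0)) * (- (x ^ 3))
      + (e₁ * (- (x + x ^ 5)) + (e₂ + ι (+ 3)) * (x ^ 2 + x ^ 4))
      where open import Algebra.Properties.Semiring.Exp semiring
    :expanded : ∀ {n} → Polynomial n → Polynomial n → Polynomial n → Polynomial n → Polynomial n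
    :expanded x e₁ e₂ e₃ = x :^ 6 :+ con (+ 1) :+ (e₃ :+ con (+ 2) :* e₁ :+ con (+ 0)) :* (:- (x :^ 3))
      :+ (e₁ :* (:- (x :+ x :^ 5)) :+ (e₂ :+ con (+ 3)) :* (x :^ 2 :+ x :^ 4))

-- The location of β between 6k and 6k + 1

module SalemRoot (O : OrderedRing) (m : ℕ) where
  open OrderedRing O
  open SalemPolynomial integerAlgebra
  open Solver

  κ : Carrier
  κ = ⌞ suc (suc m) ⌟

  κ≈2+m : κ ≈ ι (+ 2) + ⌞ m ⌟
  κ≈2+m = ι-+ (+ 2) (+ m)

  Pos-⌞⌟+ : ∀ {x} n → Pos x → Pos (⌞ n ⌟ + x)
  Pos-⌞⌟+ zero    p = Pos-cong (sym (trans (+-congʳ ι-0) (+-identityˡ _))) p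
  Pos-⌞⌟+ (suc n) p = Pos-+ (Pos-ι-suc n) p

  Pos-6κ-2 : Pos (ι (+ 6) * κ - ι (+ 2))
  Pos-6κ-2 = Pos-cong
    (trans (solve 1 (λ μ → μ :+ (μ :+ (μ :+ (μ :+ (μ :+ (μ :+ con (+ 10))))))
       := con (+ 6) :* (con (+ 2) :+ μ) :- con (+ 2)) ≡.refl ⌞ m ⌟)
      (+-congʳ (*-congˡ (sym κ≈2+m))))
    (Pos-⌞⌟+ m (Pos-⌞⌟+ m (Pos-⌞⌟+ m (Pos-⌞⌟+ m (Pos-⌞⌟+ m (Pos-⌞⌟+ m (Pos-ι-suc 9)))))))

  record IsSalemRoot (β : Carrier) : Set where
    field
      >1   : Pos (β - 1#)
      root : salem κ β ≈ 0#

    z y s : Carrier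
    z = inverse κ β
    y = β + z
    s = ι (+ 6) * κ + ι (+ 1) - y

    β*z≈1 : β * z ≈ 1#
    β*z≈1 = x*inverse≈1 root

    trace≈0 : trace κ y ≈ 0#
    trace≈0 = salem≈0⇒trace≈0 β*z≈1 root

    Pos-β : Pos β
    Pos-β = Pos-cong (trans (+-cong refl (sym ι-1)) (trans (+-congʳ (+-congˡ (-‿cong (sym ι-1))))
      (solve 1 (λ β → β :- con (+ 1) :+ con (+ 1) := β) ≡.refl β))) (Pos-+ >1 Pos-1)

    Pos-z : Pos z
    Pos-z = Pos-cancel Pos-β (Pos-cong (trans (sym β*z≈1) (*-comm β z)) Pos-1)

    Pos-1-z : Pos (1# - z)
    Pos-1-z = Pos-cancel Pos-β (Pos-cong (sym (trans (distribʳ β 1# (- z))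
      (+-cong (*-identityˡ β) (trans (solve 2 (λ z β → (:- z) :* β := :- (β :* z)) ≡.refl z β)
        (-‿cong β*z≈1))))) >1)

    -- Since β z = 1, (y - 2) β = (β - 1)².
    Pos-y-2 : Pos (y - ι (+ 2))
    Pos-y-2 = Pos-cancel Pos-β (Pos-cong
      (trans (*-cong (+-congˡ (-‿cong (sym ι-1))) (+-congˡ (-‿cong (sym ι-1))))
      (trans (modulo {c = - ι (+ 1)} (x≈y⇒x-y≈0 (trans β*z≈1 (sym ι-1)))
        (solve 2 (λ β z → (β :- con (+ 1)) :* (β :- con (+ 1)) :=
          (β :+ z :- con (+ 2)) :* β :+ (:- con (+ 1)) :* (β :* z :- con (+ 1))) ≡.refl β z)) refl))
      (Pos-* >1 >1))

    w : Carrier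
    w = y * (y - ι (+ 2))

    Pos-w : Pos w
    Pos-w = Pos-* (Pos-+ Pos-β Pos-z) Pos-y-2

    -- The trace equation reads y - 3 = w (6κ + 1 - y). Adding w (y - 3) removes y from the second
    -- factor: (y - 3) (1 + w) = w (6κ - 2).
    Pos-y-3 : Pos (y - ι (+ 3))
    Pos-y-3 = Pos-cancel (Pos-+ Pos-1 Pos-w) (Pos-cong
      (trans (modulo {c = - ι (+ 1)} trace≈0
        (solve 2 (λ κ y → (con (+ 6) :* κ :- con (+ 2)) :* (y :* (y :- con (+ 2))) :=
          (y :- con (+ 3)) :* (con (+ 1) :+ y :* (y :- con (+ 2))) :+ (:- con (+ 1)) :* :trace κ y) ≡.refl κ y))
        (*-congˡ (+-congʳ ι-1)))
      (Pos-* Pos-6κ-2 Pos-w))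

    Pos-s : Pos s
    Pos-s = Pos-cancel Pos-w (Pos-cong (modulo {c = ι (+ 1)} trace≈0
      (solve 2 (λ κ y → y :- con (+ 3) := (con (+ 6) :* κ :+ con (+ 1) :- y) :* (y :* (y :- con (+ 2)))
        :+ con (+ 1) :* :trace κ y) ≡.refl κ y)) Pos-y-3)

    -- As β - 6κ = 1 - s - z, it suffices that s and z are both below ½. Here w s = y - 3 gives (1 -
    -- 2s) w = (y - 2)² + 2.
    Pos-1-2s : Pos (ι (+ 1) - ι (+ 2) * s)
    Pos-1-2s = Pos-cancel Pos-w (Pos-cong (modulo {c = - ι (+ 2)} trace≈0
      (solve 2 (λ κ y → (y :- con (+ 2)) :* (y :- con (+ 2)) :+ con (+ 2) :=
        (con (+ 1) :- con (+ 2) :* (con (+ 6) :* κ :+ con (+ 1) :- y)) :* (y :* (y :- con (+ 2)))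
        :+ (:- con (+ 2)) :* :trace κ y) ≡.refl κ y)) (Pos-+ (Pos-* Pos-y-2 Pos-y-2) (Pos-ι-suc 1)))

    -- (1 - 2z) β = β - 2, which is (y - 3) + (1 - z).
    Pos-1-2z : Pos (ι (+ 1) - ι (+ 2) * z)
    Pos-1-2z = Pos-cancel Pos-β (Pos-cong
      (trans (+-congˡ (+-congʳ (sym ι-1)))
      (modulo {c = ι (+ 2)} (x≈y⇒x-y≈0 (trans β*z≈1 (sym ι-1)))
      (solve 2 (λ β z → (β :+ z :- con (+ 3)) :+ (con (+ 1) :- z) :=
        (con (+ 1) :- con (+ 2) :* z) :* β :+ con (+ 2) :* (β :* z :- con (+ 1))) ≡.refl β z)))
      (Pos-+ Pos-y-3 Pos-1-z))

    Pos-β-6κ : Pos (β - ι (+ 6) * κ)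
    Pos-β-6κ = Pos-cancel (Pos-ι-suc 1) (Pos-cong
      (solve 3 (λ κ β z → (con (+ 1) :- con (+ 2) :* (con (+ 6) :* κ :+ con (+ 1) :- (β :+ z)))
          :+ (con (+ 1) :- con (+ 2) :* z) := (β :- con (+ 6) :* κ) :* con (+ 2)) ≡.refl κ β z)
      (Pos-+ Pos-1-2s Pos-1-2z))

    Pos-6κ+1-β : Pos (ι (+ 1) - (β - ι (+ 6) * κ))
    Pos-6κ+1-β = Pos-cong
      (solve 3 (λ κ β z → (con (+ 6) :* κ :+ con (+ 1) :- (β :+ z)) :+ z :=
        con (+ 1) :- (β :- con (+ 6) :* κ)) ≡.refl κ β z)
      (Pos-+ Pos-s Pos-z)

-- The expansion of 1

ups : ℕ → ℕ → List ℕ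
ups i zero    = []
ups i (suc n) = 6 ℕ.* i ∷ 6 ℕ.* i ∷ 6 ℕ.* i ∷ 3 ℕ.+ 6 ℕ.* i ∷ ups (suc i) n

downs : ℕ → List ℕ
downs zero    = []
downs (suc n) = 12 ℕ.+ 6 ℕ.* n ∷ 12 ℕ.+ 6 ℕ.* n ∷ 12 ℕ.+ 6 ℕ.* n ∷ 9 ℕ.+ 6 ℕ.* n ∷ downs n

-- The block of index m + 1 = k - 1 is the first that breaks the ascending pattern: it ends in 6 (m
-- + 1) + 4 instead of 6 (m + 1) + 3.
turn : ℕ → List ℕ
turn m = 6 ℕ.+ 6 ℕ.* m ∷ 6 ℕ.+ 6 ℕ.* m ∷ 6 ℕ.+ 6 ℕ.* m ∷ 10 ℕ.+ 6 ℕ.* m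
       ∷ 0 ∷ 2 ∷ 1 ∷ 1 ∷ 2 ∷ 0 ∷ 10 ℕ.+ 6 ℕ.* m ∷ []

-- The last descending block, of index 1, is not part of `downs` because it ends in 2, where the
-- pattern would have 3.
middle : ℕ → List ℕ
middle m = 2 ∷ ups 1 m ++ turn m ++ downs m ++ 6 ∷ 6 ∷ 6 ∷ 2 ∷ []

ending : ℕ → List ℕ
ending m = 12 ℕ.+ 6 ℕ.* m ∷ 10 ℕ.+ 6 ℕ.* m ∷ 11 ℕ.+ 6 ℕ.* m ∷ 11 ℕ.+ 6 ℕ.* m ∷ []

-- The period of the expansion for k = m + 2, so that 6k = 12 + 6m.
word : ℕ → List ℕ
word m = 10 ℕ.+ 6 ℕ.* m ∷ 12 ℕ.+ 6 ℕ.* m ∷ middle m ++ ending m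

length-ups : ∀ i n → length (ups i n) ≡ 4 ℕ.* n
length-ups i zero    = ≡.refl
length-ups i (suc n) = ≡.trans (≡.cong (4 ℕ.+_) (length-ups (suc i) n)) (≡.sym (ℕₚ.*-suc 4 n))

length-downs : ∀ n → length (downs n) ≡ 4 ℕ.* n
length-downs zero    = ≡.refl
length-downs (suc n) = ≡.trans (≡.cong (4 ℕ.+_) (length-downs n)) (≡.sym (ℕₚ.*-suc 4 n))

length-middle : ∀ m → length (middle m) ≡ 16 ℕ.+ 8 ℕ.* m
length-middle m = begin
  suc (length (ups 1 m ++ turn m ++ downs m ++ 6 ∷ 6 ∷ 6 ∷ 2 ∷ []))
    ≡⟨ ≡.cong suc (Listₚ.length-++ (ups 1 m)) ⟩
  suc (length (ups 1 m) ℕ.+ (11 ℕ.+ length (downs m ++ 6 ∷ 6 ∷ 6 ∷ 2 ∷ [])))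
    ≡⟨ ≡.cong (λ l → suc (length (ups 1 m) ℕ.+ (11 ℕ.+ l))) (Listₚ.length-++ (downs m)) ⟩
  suc (length (ups 1 m) ℕ.+ (11 ℕ.+ (length (downs m) ℕ.+ 4)))
    ≡⟨ ≡.cong₂ (λ a b → suc (a ℕ.+ (11 ℕ.+ (b ℕ.+ 4)))) (length-ups 1 m) (length-downs m) ⟩
  suc (4 ℕ.* m ℕ.+ (11 ℕ.+ (4 ℕ.* m ℕ.+ 4)))
    ≡⟨ solve 1 (λ m → con 1 :+ (con 4 :* m :+ (con 11 :+ (con 4 :* m :+ con 4))) := con 16 :+ con 8 :* m) ≡.refl m ⟩
  16 ℕ.+ 8 ℕ.* m ∎
  where
  open ≡.≡-Reasoning
  open Data.Nat.Solver.+-*-Solver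

length-word : ∀ m → length (word m) ≡ 8 ℕ.* (2 ℕ.+ m) ℕ.+ 6
length-word m = begin
  2 ℕ.+ length (middle m ++ ending m)     ≡⟨ ≡.cong (2 ℕ.+_) (Listₚ.length-++ (middle m)) ⟩
  2 ℕ.+ (length (middle m) ℕ.+ 4)         ≡⟨ ≡.cong (λ l → 2 ℕ.+ (l ℕ.+ 4)) (length-middle m) ⟩
  2 ℕ.+ (16 ℕ.+ 8 ℕ.* m ℕ.+ 4)
    ≡⟨ solve 1 (λ m → con 2 :+ (con 16 :+ con 8 :* m :+ con 4) := con 8 :* (con 2 :+ m) :+ con 6) ≡.refl m ⟩
  8 ℕ.* (2 ℕ.+ m) ℕ.+ 6 ∎
  where
  open ≡.≡-Reasoning
  open Data.Nat.Solver.+-*-Solver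

ups-bound : ∀ {m} i n → i ℕ.+ n ℕ.≤ suc m → All (ℕ._< 11 ℕ.+ 6 ℕ.* m) (ups i n)
ups-bound i zero    i+n≤1+m = []
ups-bound {m} i (suc n) i+n≤1+m = d<  ∷ d< ∷ d< ∷ ℕₚ.+-monoʳ-< 3 d<8 ∷
  ups-bound (suc i) n (ℕₚ.≤-trans (ℕₚ.≤-reflexive (≡.sym (ℕₚ.+-suc i n))) i+n≤1+m)
  where
  i≤m : i ℕ.≤ m
  i≤m = ℕₚ.≤-pred (ℕₚ.≤-trans (ℕₚ.m≤m+n (suc i) n)
          (ℕₚ.≤-trans (ℕₚ.≤-reflexive (≡.sym (ℕₚ.+-suc i n))) i+n≤1+m))
  d<8 : 6 ℕ.* i ℕ.< 8 ℕ.+ 6 ℕ.* m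
  d<8 = s≤s (ℕₚ.≤-trans (ℕₚ.*-monoʳ-≤ 6 i≤m) (ℕₚ.m≤n+m _ 7))
  d< : 6 ℕ.* i ℕ.< 11 ℕ.+ 6 ℕ.* m
  d< = ℕₚ.≤-trans d<8 (ℕₚ.m≤n+m _ 3)

downs-bound : ∀ {m} n → n ℕ.≤ m → All (ℕ._< 11 ℕ.+ 6 ℕ.* m) (downs n)
downs-bound     zero    n≤m = []
downs-bound {m} (suc n) n<m =
  d< ∷ d< ∷ d< ∷ ℕₚ.≤-trans (ℕₚ.m≤n+m _ 3) d< ∷ downs-bound n (ℕₚ.<⇒≤ n<m)
  where
  d< : 12 ℕ.+ 6 ℕ.* n ℕ.< 11 ℕ.+ 6 ℕ.* m
  d< = ℕₚ.≤-trans (ℕₚ.+-monoʳ-≤ 7 (ℕₚ.≤-trans (ℕₚ.≤-reflexive (≡.sym (ℕₚ.*-suc 6 n))) (ℕₚ.*-monoʳ-≤ 6 n<m)))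
         (ℕₚ.m≤n+m _ 4)

-- The bound 6k - 1 serves twice: digits up to 6k - 1 propagate 0 < r < 1 backwards, and the absence
-- of the digit 6k - 1 lets its double occurrence mark the end of the period.
middle-bound : ∀ m → All (ℕ._< 11 ℕ.+ 6 ℕ.* m) (middle m)
middle-bound m = small 2 8 ∷ Allₚ.++⁺ (ups-bound 1 m ℕₚ.≤-refl) (Allₚ.++⁺ turn-bound
    (Allₚ.++⁺ (downs-bound m ℕₚ.≤-refl) (small 6 4 ∷ small 6 4 ∷ small 6 4 ∷ small 2 8 ∷ [])))
  where
  small : ∀ a b → a ℕ.< suc (a ℕ.+ b) ℕ.+ 6 ℕ.* m
  small a b = ℕₚ.≤-trans (s≤s (ℕₚ.m≤m+n a b)) (ℕₚ.m≤m+n _ (6 ℕ.* m))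
  large : ∀ a b → a ℕ.+ 6 ℕ.* m ℕ.< suc (b ℕ.+ a) ℕ.+ 6 ℕ.* m
  large a b = s≤s (ℕₚ.+-monoˡ-≤ (6 ℕ.* m) (ℕₚ.m≤n+m a b))
  turn-bound : All (ℕ._< 11 ℕ.+ 6 ℕ.* m) (turn m)
  turn-bound = large 6 4 ∷ large 6 4 ∷ large 6 4 ∷ large 10 0 ∷ small 0 10 ∷ small 2 8 ∷
    small 1 9 ∷ small 1 9 ∷ small 2 8 ∷ small 0 10 ∷ large 10 0 ∷ []

module Expansion (O : OrderedRing) (m : ℕ) where
  open OrderedRing O
  open SalemPolynomial integerAlgebra
  open SalemRoot O m
  open Solver
  open import Relation.Binary.Reasoning.Setoid setoid

  step : Carrier → Carrier → ℕ → Carrier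
  step β x d = β * x - ⌞ d ⌟

  run : Carrier → Carrier → List ℕ → Carrier
  run β x []      = x
  run β x (d ∷ w) = run β (step β x d) w

  run-cong : ∀ {β x y} w → x ≈ y → run β x w ≈ run β y w
  run-cong []      h = h
  run-cong (d ∷ w) h = run-cong w (+-congʳ (*-congˡ h))

  run-++ : ∀ {β x} v w → run β x (v ++ w) ≡ run β (run β x v) w
  run-++ []      w = ≡.refl
  run-++ (d ∷ v) w = run-++ v w

  -- Multiplying by 𝒟 makes the remainder at the start of a block of four
  -- digits linear in the index of the block: it is up i or down i.
  𝒟 𝒰 : Carrier → Carrier
  𝒟 β = (β - ι (+ 1)) * (β - ι (+ 1)) * (β * β + ι (+ 1))
  𝒰 β = ι (+ 6) * ((β - ι (+ 1)) * (β * β + ι (+ 1)))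

  -- If the blocks went on for ever, the remainder before block i would be the sum of the digits
  -- divided by powers of β. For ascending blocks this series is 6i/(β - 1) + 3/`𝒟 β`, and for
  -- descending ones formally 6i/(β - 1) - 3/`𝒟 β`; `𝒟 β` clears the denominators.
  up down : Carrier → Carrier → Carrier
  up β i   = i * 𝒰 β + ι (+ 3)
  down β i = i * 𝒰 β - ι (+ 3)

  -- The digits are ring elements here, so that a run through digits affine in κ or in the index of
  -- a block is one polynomial expression for the solver.
  scaledRun : Carrier → Carrier → List Carrier → Carrier
  scaledRun β v []      = v
  scaledRun β v (d ∷ w) = scaledRun β (β * v - 𝒟 β * d) w

  private
    :𝒟 :𝒰 : ∀ {n} → Polynomial n → Polynomial n
    :𝒟 β = (β :- con (+ 1)) :* (β :- con (+ 1)) :* (β :* β :+ con (+ 1))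
    :𝒰 β = con (+ 6) :* ((β :- con (+ 1)) :* (β :* β :+ con (+ 1)))

    :up :down : ∀ {n} → Polynomial n → Polynomial n → Polynomial n
    :up β i   = i :* :𝒰 β :+ con (+ 3)
    :down β i = i :* :𝒰 β :- con (+ 3)

    :scaledRun : ∀ {n} → Polynomial n → Polynomial n → List (Polynomial n) → Polynomial n
    :scaledRun β v []      = v
    :scaledRun β v (d ∷ w) = :scaledRun β (β :* v :- :𝒟 β :* d) w

  scaledRun-cong : ∀ {β u v ds es} → u ≈ v → Pointwise _≈_ ds es → scaledRun β u ds ≈ scaledRun β v es
  scaledRun-cong h []       = h
  scaledRun-cong h (p ∷ ps) = scaledRun-cong (+-cong (*-congˡ h) (-‿cong (*-congˡ p))) ps

  𝒟*run≈scaledRun : ∀ {β x v} w → 𝒟 β * x ≈ v → 𝒟 β * run β x w ≈ scaledRun β v (List.map ⌞_⌟ w)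
  𝒟*run≈scaledRun []      h = h
  𝒟*run≈scaledRun {β} {x} {v} (d ∷ w) h = 𝒟*run≈scaledRun w (begin
    𝒟 β * (β * x - ⌞ d ⌟)       ≈⟨ solve 4 (λ D b x d → D :* (b :* x :- d) := b :* (D :* x) :- D :* d)
                                      ≡.refl (𝒟 β) β x ⌞ d ⌟ ⟩
    β * (𝒟 β * x) - 𝒟 β * ⌞ d ⌟ ≈⟨ +-congʳ (*-congˡ h) ⟩
    β * v - 𝒟 β * ⌞ d ⌟         ∎)

  multiple : ∀ b n → ⌞ b ℕ.* n ⌟ ≈ ι (+ b) * ⌞ n ⌟
  multiple b n = trans (reflexive (≡.cong ι (ℤₚ.pos-* b n))) (ι-* (+ b) (+ n))

  ⌞m⌟≈κ-2 : ⌞ m ⌟ ≈ κ - ι (+ 2)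
  ⌞m⌟≈κ-2 = trans (solve 1 (λ μ → μ := (con (+ 2) :+ μ) :- con (+ 2)) ≡.refl ⌞ m ⌟) (+-congʳ (sym κ≈2+m))

  affine-κ : ∀ a → ⌞ a ℕ.+ 6 ℕ.* m ⌟ ≈ ι (+ a) + ι (+ 6) * (κ - ι (+ 2))
  affine-κ a = trans (affine a 6 m) (+-congˡ (*-congˡ ⌞m⌟≈κ-2))

  ⌞1+m⌟≈κ-1 : ⌞ suc m ⌟ ≈ κ - ι (+ 1)
  ⌞1+m⌟≈κ-1 = trans (ι-+ (+ 1) (+ m)) (trans (+-congˡ ⌞m⌟≈κ-2)
    (solve 1 (λ κ → con (+ 1) :+ (κ :- con (+ 2)) := κ :- con (+ 1)) ≡.refl κ))

  run-ups : ∀ {β x} i n → 𝒟 β * x ≈ up β ⌞ i ⌟ → 𝒟 β * run β x (ups i n) ≈ up β ⌞ n ℕ.+ i ⌟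
  run-ups i zero    h = h
  run-ups {β} {x} i (suc n) h = trans
    (run-ups (suc i) n (begin
      𝒟 β * run β x (6 ℕ.* i ∷ 6 ℕ.* i ∷ 6 ℕ.* i ∷ 3 ℕ.+ 6 ℕ.* i ∷ [])
        ≈⟨ 𝒟*run≈scaledRun (6 ℕ.* i ∷ 6 ℕ.* i ∷ 6 ℕ.* i ∷ 3 ℕ.+ 6 ℕ.* i ∷ []) h ⟩
      scaledRun β (up β ⌞ i ⌟) (⌞ 6 ℕ.* i ⌟ ∷ ⌞ 6 ℕ.* i ⌟ ∷ ⌞ 6 ℕ.* i ⌟ ∷ ⌞ 3 ℕ.+ 6 ℕ.* i ⌟ ∷ [])
        ≈⟨ scaledRun-cong refl (multiple 6 i ∷ multiple 6 i ∷ multiple 6 i ∷ affine 3 6 i ∷ []) ⟩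
      scaledRun β (up β ⌞ i ⌟) (ι (+ 6) * ⌞ i ⌟ ∷ ι (+ 6) * ⌞ i ⌟ ∷ ι (+ 6) * ⌞ i ⌟ ∷ ι (+ 3) + ι (+ 6) * ⌞ i ⌟ ∷ [])
        ≈⟨ solve 2 (λ β i → :scaledRun β (:up β i) (con (+ 6) :* i ∷ con (+ 6) :* i ∷ con (+ 6) :* i ∷ con (+ 3) :+ con (+ 6) :* i ∷ [])
             := :up β (con (+ 1) :+ i)) ≡.refl β ⌞ i ⌟ ⟩
      up β (ι (+ 1) + ⌞ i ⌟) ≈⟨ +-congʳ (*-congʳ (ι-+ (+ 1) (+ i))) ⟨
      up β ⌞ suc i ⌟         ∎))
    (reflexive (≡.cong (λ n → up β ⌞ n ⌟) (ℕₚ.+-suc n i)))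

  run-downs : ∀ {β x} n → 𝒟 β * x ≈ down β ⌞ suc n ⌟ → 𝒟 β * run β x (downs n) ≈ down β ⌞ 1 ⌟
  run-downs zero    h = h
  run-downs {β} {x} (suc n) h = run-downs n (begin
    𝒟 β * run β x block
      ≈⟨ 𝒟*run≈scaledRun block (trans h (+-congʳ (*-congʳ (ι-+ (+ 2) (+ n))))) ⟩
    scaledRun β (down β (ι (+ 2) + ⌞ n ⌟)) (List.map ⌞_⌟ block)
      ≈⟨ scaledRun-cong refl (affine 12 6 n ∷ affine 12 6 n ∷ affine 12 6 n ∷ affine 9 6 n ∷ []) ⟩
    scaledRun β (down β (ι (+ 2) + ⌞ n ⌟))
        (ι (+ 12) + ι (+ 6) * ⌞ n ⌟ ∷ ι (+ 12) + ι (+ 6) * ⌞ n ⌟ ∷ ι (+ 12) + ι (+ 6) * ⌞ n ⌟ ∷ ι (+ 9) + ι (+ 6) * ⌞ n ⌟ ∷ [])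
      ≈⟨ solve 2 (λ β n → :scaledRun β (:down β (con (+ 2) :+ n))
             (con (+ 12) :+ con (+ 6) :* n ∷ con (+ 12) :+ con (+ 6) :* n ∷ con (+ 12) :+ con (+ 6) :* n ∷ con (+ 9) :+ con (+ 6) :* n ∷ [])
           := :down β (con (+ 1) :+ n)) ≡.refl β ⌞ n ⌟ ⟩
    down β (ι (+ 1) + ⌞ n ⌟) ≈⟨ +-congʳ (*-congʳ (ι-+ (+ 1) (+ n))) ⟨
    down β ⌞ suc n ⌟         ∎)
    where
    block : List ℕ
    block = 12 ℕ.+ 6 ℕ.* n ∷ 12 ℕ.+ 6 ℕ.* n ∷ 12 ℕ.+ 6 ℕ.* n ∷ 9 ℕ.+ 6 ℕ.* n ∷ []

  module _ {β : Carrier} (isRoot : IsSalemRoot β) where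
    open IsSalemRoot isRoot

    r₁ : Carrier
    r₁ = β - ⌞ 12 ℕ.+ 6 ℕ.* m ⌟

    private
      r₁≈β-6κ : r₁ ≈ β - ι (+ 6) * κ
      r₁≈β-6κ = +-congˡ (-‿cong (trans (affine-κ 12)
        (solve 1 (λ κ → con (+ 12) :+ con (+ 6) :* (κ :- con (+ 2)) := con (+ 6) :* κ) ≡.refl κ)))

      :digit : ∀ {n} → ℕ → Polynomial n → Polynomial n
      :digit a κ = con (+ a) :+ con (+ 6) :* (κ :- con (+ 2))

      -- The regular blocks are identities in β. The equation of β enters at the three irregular
      -- places, here, in the turn and in the ending, each time through an explicit multiple of
      -- `salem κ β`.
      run-start : 𝒟 β * run β r₁ (10 ℕ.+ 6 ℕ.* m ∷ 12 ℕ.+ 6 ℕ.* m ∷ 2 ∷ []) ≈ up β ⌞ 1 ⌟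
      run-start = begin
        𝒟 β * run β r₁ (10 ℕ.+ 6 ℕ.* m ∷ 12 ℕ.+ 6 ℕ.* m ∷ 2 ∷ [])
          ≈⟨ 𝒟*run≈scaledRun (10 ℕ.+ 6 ℕ.* m ∷ 12 ℕ.+ 6 ℕ.* m ∷ 2 ∷ []) (*-congˡ r₁≈β-6κ) ⟩
        scaledRun β (𝒟 β * (β - ι (+ 6) * κ)) (⌞ 10 ℕ.+ 6 ℕ.* m ⌟ ∷ ⌞ 12 ℕ.+ 6 ℕ.* m ⌟ ∷ ⌞ 2 ⌟ ∷ [])
          ≈⟨ scaledRun-cong refl (affine-κ 10 ∷ affine-κ 12 ∷ refl ∷ []) ⟩
        scaledRun β (𝒟 β * (β - ι (+ 6) * κ))
            (ι (+ 10) + ι (+ 6) * (κ - ι (+ 2)) ∷ ι (+ 12) + ι (+ 6) * (κ - ι (+ 2)) ∷ ι (+ 2) ∷ [])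
          ≈⟨ modulo root (solve 2 (λ κ β →
              :scaledRun β (:𝒟 β :* (β :- con (+ 6) :* κ)) (:digit 10 κ ∷ :digit 12 κ ∷ con (+ 2) ∷ [])
              := :up β (con (+ 1)) :+ (β :* β :+ β :+ con (+ 1)) :* :salem κ β) ≡.refl κ β) ⟩
        up β ⌞ 1 ⌟ ∎

      run-turn : ∀ {x} → 𝒟 β * x ≈ up β ⌞ suc m ⌟ → 𝒟 β * run β x (turn m) ≈ down β ⌞ suc m ⌟
      run-turn {x} h = begin
        𝒟 β * run β x (turn m)
          ≈⟨ 𝒟*run≈scaledRun (turn m) (trans h (+-congʳ (*-congʳ ⌞1+m⌟≈κ-1))) ⟩
        scaledRun β (up β (κ - ι (+ 1))) (List.map ⌞_⌟ (turn m))
          ≈⟨ scaledRun-cong refl (affine-κ 6 ∷ affine-κ 6 ∷ affine-κ 6 ∷ affine-κ 10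
               ∷ refl ∷ refl ∷ refl ∷ refl ∷ refl ∷ refl ∷ affine-κ 10 ∷ []) ⟩
        scaledRun β (up β (κ - ι (+ 1))) (d 6 ∷ d 6 ∷ d 6 ∷ d 10
               ∷ ⌞ 0 ⌟ ∷ ⌞ 2 ⌟ ∷ ⌞ 1 ⌟ ∷ ⌞ 1 ⌟ ∷ ⌞ 2 ⌟ ∷ ⌞ 0 ⌟ ∷ d 10 ∷ [])
          ≈⟨ modulo root (solve 2 (λ κ β →
              :scaledRun β (:up β (κ :- con (+ 1))) (:digit 6 κ ∷ :digit 6 κ ∷ :digit 6 κ ∷ :digit 10 κ
                ∷ con (+ 0) ∷ con (+ 2) ∷ con (+ 1) ∷ con (+ 1) ∷ con (+ 2) ∷ con (+ 0) ∷ :digit 10 κ ∷ [])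
              := :down β (κ :- con (+ 1))
                 :+ (:- ((β :* β :+ β :+ con (+ 1)) :* (β :* β :* β :+ con (+ 1)))) :* :salem κ β) ≡.refl κ β) ⟩
        down β (κ - ι (+ 1)) ≈⟨ +-congʳ (*-congʳ ⌞1+m⌟≈κ-1) ⟨
        down β ⌞ suc m ⌟     ∎
        where
        d : ℕ → Carrier
        d a = ι (+ a) + ι (+ 6) * (κ - ι (+ 2))

      run-ending : ∀ {x} → 𝒟 β * x ≈ down β ⌞ 1 ⌟ →
        𝒟 β * run β x (6 ∷ 6 ∷ 6 ∷ 2 ∷ ending m) ≈ 𝒟 β * r₁
      run-ending {x} h = begin
        𝒟 β * run β x (6 ∷ 6 ∷ 6 ∷ 2 ∷ ending m)
          ≈⟨ 𝒟*run≈scaledRun (6 ∷ 6 ∷ 6 ∷ 2 ∷ ending m) h ⟩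
        scaledRun β (down β ⌞ 1 ⌟) (List.map ⌞_⌟ (6 ∷ 6 ∷ 6 ∷ 2 ∷ ending m))
          ≈⟨ scaledRun-cong refl (refl ∷ refl ∷ refl ∷ refl ∷
               affine-κ 12 ∷ affine-κ 10 ∷ affine-κ 11 ∷ affine-κ 11 ∷ []) ⟩
        scaledRun β (down β ⌞ 1 ⌟) (⌞ 6 ⌟ ∷ ⌞ 6 ⌟ ∷ ⌞ 6 ⌟ ∷ ⌞ 2 ⌟ ∷ d 12 ∷ d 10 ∷ d 11 ∷ d 11 ∷ [])
          ≈⟨ modulo root (solve 2 (λ κ β →
              :scaledRun β (:down β (con (+ 1))) (con (+ 6) ∷ con (+ 6) ∷ con (+ 6) ∷ con (+ 2)
                ∷ :digit 12 κ ∷ :digit 10 κ ∷ :digit 11 κ ∷ :digit 11 κ ∷ [])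
              := :𝒟 β :* (β :- con (+ 6) :* κ) :+ (β :* β :+ β :+ con (+ 1)) :* :salem κ β) ≡.refl κ β) ⟩
        𝒟 β * (β - ι (+ 6) * κ) ≈⟨ *-congˡ r₁≈β-6κ ⟨
        𝒟 β * r₁ ∎
        where
        d : ℕ → Carrier
        d a = ι (+ a) + ι (+ 6) * (κ - ι (+ 2))

      Pos-𝒟 : Pos (𝒟 β)
      Pos-𝒟 = Pos-* (Pos-* Pos-β-1 Pos-β-1) (Pos-+ (Pos-* Pos-β Pos-β) (Pos-ι-suc 0))
        where
        Pos-β-1 : Pos (β - ι (+ 1))
        Pos-β-1 = Pos-cong (+-congˡ (-‿cong (sym ι-1))) >1

      𝒟-cancel : ∀ {x y} → 𝒟 β * x ≈ 𝒟 β * y → x ≈ y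
      𝒟-cancel {x} {y} h = x-y≈0⇒x≈y (zero-cancel Pos-𝒟 (trans
        (solve 3 (λ D x y → (x :- y) :* D := D :* x :- D :* y) ≡.refl (𝒟 β) x y) (x≈y⇒x-y≈0 h)))

    run-word : run β r₁ (word m) ≈ r₁
    run-word = 𝒟-cancel (begin
      𝒟 β * run β r₄ ((ups 1 m ++ turn m ++ downs m ++ 6 ∷ 6 ∷ 6 ∷ 2 ∷ []) ++ ending m)
        ≡⟨ ≡.cong (𝒟 β *_) (≡.trans (≡.cong (run β r₄) regroup)
             (≡.trans (run-++ (ups 1 m) (turn m ++ downs m ++ tail))
               (≡.trans (run-++ {x = run β r₄ (ups 1 m)} (turn m) (downs m ++ tail)) (run-++ (downs m) tail)))) ⟩
      𝒟 β * run β (run β (run β (run β r₄ (ups 1 m)) (turn m)) (downs m)) (6 ∷ 6 ∷ 6 ∷ 2 ∷ ending m)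
        ≈⟨ run-ending (run-downs m (run-turn (trans (run-ups 1 m run-start)
             (reflexive (≡.cong (λ n → up β ⌞ n ⌟) (ℕₚ.+-comm m 1)))))) ⟩
      𝒟 β * r₁ ∎)
      where
      tail : List ℕ
      tail = 6 ∷ 6 ∷ 6 ∷ 2 ∷ ending m
      r₄ : Carrier
      r₄ = run β r₁ (10 ℕ.+ 6 ℕ.* m ∷ 12 ℕ.+ 6 ℕ.* m ∷ 2 ∷ [])
      regroup : (ups 1 m ++ turn m ++ downs m ++ 6 ∷ 6 ∷ 6 ∷ 2 ∷ []) ++ ending m
              ≡ ups 1 m ++ turn m ++ downs m ++ 6 ∷ 6 ∷ 6 ∷ 2 ∷ ending m
      regroup = ≡.trans (Listₚ.++-assoc (ups 1 m) _ _) (≡.cong (ups 1 m ++_)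
        (≡.cong (turn m ++_) (Listₚ.++-assoc (downs m) _ _)))

    InUnit : Carrier → Set
    InUnit x = Pos x × Pos (ι (+ 1) - x)

    InUnit-cong : ∀ {x y} → x ≈ y → InUnit x → InUnit y
    InUnit-cong h (p , q) = Pos-cong h p , Pos-cong (+-congˡ (-‿cong h)) q

    RunInUnit : Carrier → List ℕ → Set
    RunInUnit x []      = InUnit x
    RunInUnit x (d ∷ w) = InUnit x × RunInUnit (step β x d) w

    RunInUnit-head : ∀ {x} w → RunInUnit x w → InUnit x
    RunInUnit-head []      u       = u
    RunInUnit-head (d ∷ w) (u , _) = u

    RunInUnit-take : ∀ {x} w i → RunInUnit x w → InUnit (run β x (take i w))
    RunInUnit-take w       zero    us       = RunInUnit-head w us
    RunInUnit-take []      (suc i) us       = us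
    RunInUnit-take (d ∷ w) (suc i) (u , us) = RunInUnit-take w i us

    Pos-step⁻¹ : ∀ {x} d → Pos (step β x d) → Pos x
    Pos-step⁻¹ {x} d p = Pos-cancel Pos-β (Pos-cong
      (solve 3 (λ d β x → d :+ (β :* x :- d) := x :* β) ≡.refl ⌞ d ⌟ β x) (Pos-⌞⌟+ d p))

    Pos-run⁻¹ : ∀ {x} w → Pos (run β x w) → Pos x
    Pos-run⁻¹ []      p = p
    Pos-run⁻¹ (d ∷ w) p = Pos-step⁻¹ d (Pos-run⁻¹ w p)

    Pos-r₁ : Pos r₁
    Pos-r₁ = Pos-cong (sym r₁≈β-6κ) Pos-β-6κ

    InUnit-r₁ : InUnit r₁
    InUnit-r₁ = Pos-r₁ , Pos-cong (+-congˡ (-‿cong (sym r₁≈β-6κ))) Pos-6κ+1-β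

    -- With x' for the next remainder, (1 - x) β = (6k - 1 - d) + r₁ + (1 - x'), where the first
    -- term is a natural number.
    InUnit-step⁻¹ : ∀ {x d} → d ℕ.≤ 11 ℕ.+ 6 ℕ.* m → InUnit (step β x d) → InUnit x
    InUnit-step⁻¹ {x} {d} d≤ (p , q) = Pos-step⁻¹ d p , Pos-cancel Pos-β (Pos-cong (begin
      ⌞ e ⌟ + (r₁ + (ι (+ 1) - step β x d))
        ≈⟨ +-congʳ (trans (solve 2 (λ d e → e := (d :+ e) :- d) ≡.refl ⌞ d ⌟ ⌞ e ⌟) (+-congʳ d+e)) ⟩
      ⌞ 11 ℕ.+ 6 ℕ.* m ⌟ - ⌞ d ⌟ + (r₁ + (ι (+ 1) - step β x d))
        ≈⟨ +-congˡ (+-congʳ (+-congˡ (-‿cong (ι-+ (+ 1) (+ (11 ℕ.+ 6 ℕ.* m)))))) ⟩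
      ⌞ 11 ℕ.+ 6 ℕ.* m ⌟ - ⌞ d ⌟ + (β - (ι (+ 1) + ⌞ 11 ℕ.+ 6 ℕ.* m ⌟) + (ι (+ 1) - step β x d))
        ≈⟨ solve 4 (λ n d β x → n :- d :+ (β :- (con (+ 1) :+ n) :+ (con (+ 1) :- (β :* x :- d)))
             := (con (+ 1) :- x) :* β) ≡.refl ⌞ 11 ℕ.+ 6 ℕ.* m ⌟ ⌞ d ⌟ β x ⟩
      (ι (+ 1) - x) * β ∎)
      (Pos-⌞⌟+ e (Pos-+ Pos-r₁ q)))
      where
      e : ℕ
      e = 11 ℕ.+ 6 ℕ.* m ℕ.∸ d
      d+e : ⌞ d ⌟ + ⌞ e ⌟ ≈ ⌞ 11 ℕ.+ 6 ℕ.* m ⌟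
      d+e = trans (sym (ι-+ (+ d) (+ e))) (reflexive (≡.cong ⌞_⌟ (ℕₚ.m+[n∸m]≡n d≤)))

    RunInUnit-++ : ∀ {x} v w → All (ℕ._≤ 11 ℕ.+ 6 ℕ.* m) v →
      RunInUnit (run β x v) w → RunInUnit x (v ++ w)
    RunInUnit-++ []      w []       us = us
    RunInUnit-++ (d ∷ v) w (p ∷ ps) us =
      let vs = RunInUnit-++ v w ps us in InUnit-step⁻¹ p (RunInUnit-head (v ++ w) vs) , vs

    -- All digits other than 6k propagate 0 < r < 1 backwards for free; each of
    -- the two digits 6k compares the following remainder with r₁.
    RunInUnit-word : RunInUnit r₁ (word m)
    RunInUnit-word = InUnit-r₁ , (Pos-r₂ , below₂) , rest
      where
      d₁₀ d₁₁ d₁₂ : ℕ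
      d₁₀ = 10 ℕ.+ 6 ℕ.* m
      d₁₁ = 11 ℕ.+ 6 ℕ.* m
      d₁₂ = 12 ℕ.+ 6 ℕ.* m
      r₂ r₃ x u₁ u₂ u₃ : Carrier
      r₂ = step β r₁ d₁₀
      r₃ = step β r₂ d₁₂
      x  = run β r₃ (middle m)
      u₁ = step β x d₁₂
      u₂ = step β u₁ d₁₀
      u₃ = step β u₂ d₁₁
      ⌞d₁₁⌟ : ⌞ d₁₁ ⌟ ≈ ι (+ 1) + ⌞ d₁₀ ⌟
      ⌞d₁₁⌟ = ι-+ (+ 1) (+ d₁₀)
      ⌞d₁₂⌟ : ⌞ d₁₂ ⌟ ≈ ι (+ 2) + ⌞ d₁₀ ⌟
      ⌞d₁₂⌟ = ι-+ (+ 2) (+ d₁₀)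
      last≈r₁ : step β u₃ d₁₁ ≈ r₁
      last≈r₁ = trans (sym (reflexive (run-++ (middle m) (ending m)))) run-word
      U₄ : InUnit (step β u₃ d₁₁)
      U₄ = InUnit-cong (sym last≈r₁) InUnit-r₁
      U₃ : InUnit u₃
      U₃ = InUnit-step⁻¹ ℕₚ.≤-refl U₄
      U₂ : InUnit u₂
      U₂ = InUnit-step⁻¹ ℕₚ.≤-refl U₃
      U₁ : InUnit u₁
      U₁ = InUnit-step⁻¹ (ℕₚ.n≤1+n _) U₂
      Pos-x : Pos x
      Pos-x = Pos-step⁻¹ d₁₂ (proj₁ U₁)
      Pos-r₃ : Pos r₃
      Pos-r₃ = Pos-run⁻¹ (middle m) Pos-x
      Pos-r₂ : Pos r₂
      Pos-r₂ = Pos-step⁻¹ d₁₂ Pos-r₃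
      -- The digit 6k after `r₂` exceeds the digit 6k - 1 after `u₂` by one, so `r₃` > 0 and `u₃` <
      -- 1 decide. Both are known by now, unlike `r₂` < 1.
      r₂>u₂ : Pos (r₂ - u₂)
      r₂>u₂ = Pos-cancel Pos-β (Pos-cong (trans
        (+-cong (+-congˡ (-‿cong ⌞d₁₂⌟)) (+-congˡ (-‿cong (+-congˡ (-‿cong ⌞d₁₁⌟)))))
        (solve 4 (λ β r u d → β :* r :- (con (+ 2) :+ d) :+ (con (+ 1) :- (β :* u :- (con (+ 1) :+ d)))
          := (r :- u) :* β) ≡.refl β r₂ u₂ ⌞ d₁₀ ⌟))
        (Pos-+ Pos-r₃ (proj₂ U₃)))
      r₁>u₁ : Pos (r₁ - u₁)
      r₁>u₁ = Pos-cancel Pos-β (Pos-cong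
        (solve 4 (λ β r u d → (β :* r :- d) :- (β :* u :- d) := (r :- u) :* β) ≡.refl β r₁ u₁ ⌞ d₁₀ ⌟) r₂>u₂)
      -- At the digit 6k, v = (6k + v')/β, and v' < r₁ = β - 6k makes the numerator less than β.
      above⇒below : ∀ {v} → Pos (r₁ - step β v d₁₂) → Pos (ι (+ 1) - v)
      above⇒below {v} p = Pos-cancel Pos-β (Pos-cong
        (solve 3 (λ β v d → (β :- d) :- (β :* v :- d) := (con (+ 1) :- v) :* β) ≡.refl β v ⌞ d₁₂ ⌟) p)
      rest : RunInUnit r₃ (middle m ++ ending m)
      rest = RunInUnit-++ (middle m) (ending m) (All.map ℕₚ.<⇒≤ (middle-bound m))
        ((Pos-x , above⇒below r₁>u₁) , U₁ , U₂ , U₃ , U₄)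
      U₅ : InUnit (step β r₃ 2)
      U₅ = RunInUnit-head _ (proj₂ rest)
      -- The first digits are 6k - 2 and 2, and β (`r₁` - `r₃`) = (6k - 5) + `r₂` + (1 - r₄), where
      -- r₄ < 1 comes from the part of the word that is already settled.
      r₁>r₃ : Pos (r₁ - r₃)
      r₁>r₃ = Pos-cancel Pos-β (Pos-cong (trans
        (+-congʳ (+-congʳ (trans (sym (affine 7 6 m)) (trans
          (solve 1 (λ d → d := (con (+ 3) :+ d) :- con (+ 3)) ≡.refl ⌞ 7 ℕ.+ 6 ℕ.* m ⌟)
          (+-congʳ (sym (ι-+ (+ 3) (+ (7 ℕ.+ 6 ℕ.* m)))))))))
        (solve 4 (λ β r s d → (d :- con (+ 3)) :+ (β :* r :- d) :+ (con (+ 1) :- (β :* s :- con (+ 2)))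
          := (r :- s) :* β) ≡.refl β r₁ r₃ ⌞ d₁₀ ⌟))
        (Pos-+ (Pos-+ (Pos-cong (affine 7 6 m) (Pos-ι-suc _)) Pos-r₂) (proj₂ U₅)))
      below₂ : Pos (ι (+ 1) - r₂)
      below₂ = above⇒below r₁>r₃

-- Linear independence of 1, β, …, β⁵

module _ where
  open Data.Integer.Solver.+-*-Solver

  residue₃ : ∀ n → ∃₂ λ q r → r ℕ.< 3 × n ≡ + 3 ℤ.* q ℤ.+ + r
  residue₃ n = n ℤ./ℕ 3 , n ℤ.%ℕ 3 , ℤ.n%ℕd<d n 3 , ≡.trans (ℤ.a≡a%ℕn+[a/ℕn]*n n 3)
    (solve 2 (λ q r → r :+ q :* con (+ 3) := con (+ 3) :* q :+ r) ≡.refl (n ℤ./ℕ 3) (+ (n ℤ.%ℕ 3)))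

  private
    3*z+n≡c⇒3∣c : ∀ z {n c} → n ≡ 0ℤ → + 3 ℤ.* z ℤ.+ n ≡ + c → 3 ∣ c
    3*z+n≡c⇒3∣c z {n} {c} n≡0 eq = divides ℤ.∣ z ∣ (≡.trans (≡.cong ℤ.∣_∣ (≡.sym 3z≡c))
      (≡.trans (ℤₚ.abs-* (+ 3) z) (ℕₚ.*-comm 3 ℤ.∣ z ∣)))
      where
      3z≡c : + 3 ℤ.* z ≡ + c
      3z≡c = ≡.trans (≡.sym (ℤₚ.+-identityʳ (+ 3 ℤ.* z))) (≡.trans (≡.cong (λ n → + 3 ℤ.* z ℤ.+ n) (≡.sym n≡0)) eq)

    3∣r³⇒r≡0 : ∀ r → r ℕ.< 3 → 3 ∣ r ℕ.* r ℕ.* r → r ≡ 0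
    3∣r³⇒r≡0 0 _ _ = ≡.refl
    3∣r³⇒r≡0 1 _ d = ⊥-elim (from-no (3 ∣? 1) d)
    3∣r³⇒r≡0 2 _ d = ⊥-elim (from-no (3 ∣? 8) d)
    3∣r³⇒r≡0 (suc (suc (suc _))) (s≤s (s≤s (s≤s ()))) _

    3∣r²+s²⇒r,s≡0 : ∀ r s → r ℕ.< 3 → s ℕ.< 3 → 3 ∣ r ℕ.* r ℕ.+ s ℕ.* s → r ≡ 0 × s ≡ 0
    3∣r²+s²⇒r,s≡0 0 0 _ _ _ = ≡.refl , ≡.refl
    3∣r²+s²⇒r,s≡0 0 1 _ _ d = ⊥-elim (from-no (3 ∣? 1) d)
    3∣r²+s²⇒r,s≡0 0 2 _ _ d = ⊥-elim (from-no (3 ∣? 4) d)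
    3∣r²+s²⇒r,s≡0 1 0 _ _ d = ⊥-elim (from-no (3 ∣? 1) d)
    3∣r²+s²⇒r,s≡0 1 1 _ _ d = ⊥-elim (from-no (3 ∣? 2) d)
    3∣r²+s²⇒r,s≡0 1 2 _ _ d = ⊥-elim (from-no (3 ∣? 5) d)
    3∣r²+s²⇒r,s≡0 2 0 _ _ d = ⊥-elim (from-no (3 ∣? 4) d)
    3∣r²+s²⇒r,s≡0 2 1 _ _ d = ⊥-elim (from-no (3 ∣? 5) d)
    3∣r²+s²⇒r,s≡0 2 2 _ _ d = ⊥-elim (from-no (3 ∣? 8) d)
    3∣r²+s²⇒r,s≡0 (suc (suc (suc _))) _ (s≤s (s≤s (s≤s ()))) _ _
    3∣r²+s²⇒r,s≡0 _ (suc (suc (suc _))) _ (s≤s (s≤s (s≤s ()))) _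

    3∣3q+r : ∀ {n q r} → n ≡ + 3 ℤ.* q ℤ.+ + r → r ≡ 0 → ∃ λ q → n ≡ + 3 ℤ.* q
    3∣3q+r {q = q} eq ≡.refl = q , ≡.trans eq (ℤₚ.+-identityʳ (+ 3 ℤ.* q))

  3∣n³⇒3∣n : ∀ n t → n ℤ.* n ℤ.* n ℤ.+ + 3 ℤ.* t ≡ 0ℤ → ∃ λ q → n ≡ + 3 ℤ.* q
  3∣n³⇒3∣n n t eq with residue₃ n
  ... | q , r , r<3 , n≡ = 3∣3q+r {q = q} n≡ (3∣r³⇒r≡0 r r<3 (3*z+n≡c⇒3∣c
    (ℤ.- (+ 9 ℤ.* q ℤ.* q ℤ.* q ℤ.+ + 9 ℤ.* q ℤ.* q ℤ.* + r ℤ.+ + 3 ℤ.* q ℤ.* + r ℤ.* + r ℤ.+ t))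
    (≡.trans (≡.cong (λ n → n ℤ.* n ℤ.* n ℤ.+ + 3 ℤ.* t) (≡.sym n≡)) eq)
    (≡.trans
      (solve 3 (λ q r t → con (+ 3) :* (:- (con (+ 9) :* q :* q :* q :+ con (+ 9) :* q :* q :* r :+ con (+ 3) :* q :* r :* r :+ t))
        :+ ((con (+ 3) :* q :+ r) :* (con (+ 3) :* q :+ r) :* (con (+ 3) :* q :+ r) :+ con (+ 3) :* t)
        := r :* r :* r) ≡.refl q (+ r) t)
      (≡.sym (≡.trans (ℤₚ.pos-* (r ℕ.* r) r) (≡.cong (ℤ._* + r) (ℤₚ.pos-* r r)))))))

  3∣m²+n²⇒3∣m,n : ∀ m n t → m ℤ.* m ℤ.+ n ℤ.* n ℤ.+ + 3 ℤ.* t ≡ 0ℤ →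
    (∃ λ q → m ≡ + 3 ℤ.* q) × (∃ λ q → n ≡ + 3 ℤ.* q)
  3∣m²+n²⇒3∣m,n m n t eq with residue₃ m | residue₃ n
  ... | p , r , r<3 , m≡ | q , s , s<3 , n≡ =
    let r≡0 , s≡0 = 3∣r²+s²⇒r,s≡0 r s r<3 s<3 (3*z+n≡c⇒3∣c
          (ℤ.- (+ 3 ℤ.* p ℤ.* p ℤ.+ + 2 ℤ.* p ℤ.* + r ℤ.+ + 3 ℤ.* q ℤ.* q ℤ.+ + 2 ℤ.* q ℤ.* + s ℤ.+ t))
          (≡.trans (≡.cong₂ (λ m n → m ℤ.* m ℤ.+ n ℤ.* n ℤ.+ + 3 ℤ.* t) (≡.sym m≡) (≡.sym n≡)) eq)
          (≡.trans
            (solve 5 (λ p r q s t → con (+ 3) :* (:- (con (+ 3) :* p :* p :+ con (+ 2) :* p :* r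
                :+ con (+ 3) :* q :* q :+ con (+ 2) :* q :* s :+ t))
              :+ ((con (+ 3) :* p :+ r) :* (con (+ 3) :* p :+ r)
                :+ (con (+ 3) :* q :+ s) :* (con (+ 3) :* q :+ s) :+ con (+ 3) :* t)
              := r :* r :+ s :* s) ≡.refl p (+ r) q (+ s) t)
            (≡.sym (≡.cong₂ ℤ._+_ (ℤₚ.pos-* r r) (ℤₚ.pos-* s s)))))
    in 3∣3q+r {q = p} m≡ r≡0 , 3∣3q+r {q = q} n≡ s≡0

  3*n≡0⇒n≡0 : ∀ n → + 3 ℤ.* n ≡ 0ℤ → n ≡ 0ℤ
  3*n≡0⇒n≡0 n eq with ℤₚ.i*j≡0⇒i≡0∨j≡0 (+ 3) {n} eq
  ... | inj₂ n≡0 = n≡0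

  -- Recursion on a bound b for the absolute values of the entries: after division by 3 a bound b +
  -- 1 becomes at most b, and the bound 0 leaves only zeros.
  infinite-descent : ∀ {n} (Z : Vec ℤ n → Set) →
    (∀ v → Z v → ∃ λ u → v ≡ Vec.map (+ 3 ℤ.*_) u × Z u) →
    ∀ v → Z v → Allᵛ (_≡ 0ℤ) v
  infinite-descent Z step v z = descend (proj₁ (bound v)) v (proj₂ (bound v)) z
    where
    bound : ∀ {n} (v : Vec ℤ n) → ∃ λ b → Allᵛ (λ a → ℤ.∣ a ∣ ℕ.≤ b) v
    bound []      = 0 , []
    bound (a ∷ v) = let b , bs = bound v in ℤ.∣ a ∣ ℕ.+ b ,
      ℕₚ.m≤m+n _ b ∷ VecAll.map (λ p → ℕₚ.≤-trans p (ℕₚ.m≤n+m b _)) bs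

    shrink : ∀ b a → 3 ℕ.* a ℕ.≤ suc b → a ℕ.≤ b
    shrink b zero    _ = z≤n
    shrink b (suc a) (s≤s p) = ℕₚ.≤-trans (ℕₚ.m≤m+n (suc a) _) (ℕₚ.≤-trans (ℕₚ.m≤n+m _ a) p)

    unscale : ∀ {n} b (u : Vec ℤ n) → Allᵛ (λ a → ℤ.∣ a ∣ ℕ.≤ suc b) (Vec.map (+ 3 ℤ.*_) u) →
      Allᵛ (λ a → ℤ.∣ a ∣ ℕ.≤ b) u
    unscale b []      []       = []
    unscale b (a ∷ u) (p ∷ ps) =
      shrink b ℤ.∣ a ∣ (ℕₚ.≤-trans (ℕₚ.≤-reflexive (≡.sym (ℤₚ.abs-* (+ 3) a))) p) ∷ unscale b u ps

    rescale : ∀ {n} (u : Vec ℤ n) → Allᵛ (_≡ 0ℤ) u → Allᵛ (_≡ 0ℤ) (Vec.map (+ 3 ℤ.*_) u)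
    rescale []      []       = []
    rescale (a ∷ u) (p ∷ ps) = ≡.cong (+ 3 ℤ.*_) p ∷ rescale u ps

    descend : ∀ b v → Allᵛ (λ a → ℤ.∣ a ∣ ℕ.≤ b) v → Z v → Allᵛ (_≡ 0ℤ) v
    descend zero    v bs z = VecAll.map (λ p → ℤₚ.∣i∣≡0⇒i≡0 (ℕₚ.n≤0⇒n≡0 p)) bs
    descend (suc b) v bs z with step v z
    ... | u , ≡.refl , z′ = rescale u (descend b u (unscale b u bs) z′)

infixl 6 _⊖_

_⊖_ : ∀ {n} → Expr n → Expr n → Expr n
e ⊖ f = e ⊕ ⊝ f

private
  three : ∀ {n} → Expr n → Expr n
  three e = con (+ 3) ⊗ e

-- The norm of n₀ + n₁ y + n₂ y² modulo y³ - 3 (p y² - q y + 1) is n₀³ + 3 normTail.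
normTail : ∀ {n} → (p q n₀ n₁ n₂ : Expr n) → Expr n
normTail p q n₀ n₁ n₂ =
  n₀ ⊗ (n₀ ⊗ n₁ ⊗ p ⊕ n₀ ⊗ n₂ ⊗ (con (+ 3) ⊗ p ⊗ p ⊖ con (+ 2) ⊗ q)
    ⊕ n₁ ⊗ n₁ ⊗ q ⊕ n₁ ⊗ n₂ ⊗ (con (+ 3) ⊗ p ⊗ q ⊖ con (+ 3))
    ⊕ n₂ ⊗ n₂ ⊗ (con (+ 3) ⊗ q ⊗ q ⊖ con (+ 6) ⊗ p))
  ⊕ (n₁ ⊗ n₁ ⊗ n₁ ⊕ con (+ 3) ⊗ (n₁ ⊗ n₁ ⊗ n₂ ⊗ p ⊕ n₁ ⊗ n₂ ⊗ n₂ ⊗ q ⊕ n₂ ⊗ n₂ ⊗ n₂))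

-- The norm for n₀ = 3a is 3 (n₁³ + 3 normTail′), which for n₁ = 3b is 9 (n₂³ + 3 normTail″).
private
  normTail′ : ∀ {n} → (p q a n₁ n₂ : Expr n) → Expr n
  normTail′ p q a n₁ n₂ =
    con (+ 3) ⊗ a ⊗ a ⊗ a ⊕ con (+ 3) ⊗ a ⊗ a ⊗ n₁ ⊗ p
    ⊕ a ⊗ a ⊗ n₂ ⊗ (con (+ 9) ⊗ p ⊗ p ⊖ con (+ 6) ⊗ q) ⊕ a ⊗ n₁ ⊗ n₁ ⊗ q
    ⊕ a ⊗ n₁ ⊗ n₂ ⊗ (con (+ 3) ⊗ p ⊗ q ⊖ con (+ 3)) ⊕ a ⊗ n₂ ⊗ n₂ ⊗ (con (+ 3) ⊗ q ⊗ q ⊖ con (+ 6) ⊗ p)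
    ⊕ n₁ ⊗ n₁ ⊗ n₂ ⊗ p ⊕ n₁ ⊗ n₂ ⊗ n₂ ⊗ q ⊕ n₂ ⊗ n₂ ⊗ n₂

  normTail″ : ∀ {n} → (p q a b n₂ : Expr n) → Expr n
  normTail″ p q a b n₂ =
    con (+ 3) ⊗ b ⊗ b ⊗ b ⊕ a ⊗ a ⊗ a ⊕ con (+ 3) ⊗ a ⊗ a ⊗ b ⊗ p
    ⊕ a ⊗ a ⊗ n₂ ⊗ (con (+ 3) ⊗ p ⊗ p ⊖ con (+ 2) ⊗ q) ⊕ con (+ 3) ⊗ a ⊗ b ⊗ b ⊗ q
    ⊕ a ⊗ b ⊗ n₂ ⊗ (con (+ 3) ⊗ p ⊗ q ⊖ con (+ 3)) ⊕ a ⊗ n₂ ⊗ n₂ ⊗ (q ⊗ q ⊖ con (+ 2) ⊗ p)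
    ⊕ con (+ 3) ⊗ b ⊗ b ⊗ n₂ ⊗ p ⊕ b ⊗ n₂ ⊗ n₂ ⊗ q

-- The coefficients of A² + AB y + B² for A = a₀ + a₁ y + a₂ y² and B = b₀ + b₁ y + b₂ y² …
module _ {n} (a₀ a₁ a₂ b₀ b₁ b₂ : Expr n) where
  t₀ t₁ t₂ t₃ t₄ t₅ : Expr n
  t₀ = a₀ ⊗ a₀ ⊕ b₀ ⊗ b₀
  t₁ = con (+ 2) ⊗ (a₀ ⊗ a₁ ⊕ b₀ ⊗ b₁) ⊕ a₀ ⊗ b₀
  t₂ = a₁ ⊗ a₁ ⊕ b₁ ⊗ b₁ ⊕ (con (+ 2) ⊗ (a₀ ⊗ a₂ ⊕ b₀ ⊗ b₂) ⊕ (a₀ ⊗ b₁ ⊕ a₁ ⊗ b₀))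
  t₃ = con (+ 2) ⊗ (a₁ ⊗ a₂ ⊕ b₁ ⊗ b₂) ⊕ (a₀ ⊗ b₂ ⊕ a₁ ⊗ b₁ ⊕ a₂ ⊗ b₀)
  t₄ = a₂ ⊗ a₂ ⊕ b₂ ⊗ b₂ ⊕ (a₁ ⊗ b₂ ⊕ a₂ ⊗ b₁)
  t₅ = a₂ ⊗ b₂

-- … and of its remainder modulo y³ - 3 (p y² - q y + 1), which are tᵢ + 3 cᵢ.
module _ {n} (p q t₃ t₄ t₅ : Expr n) where
  c₀ c₁ c₂ : Expr n
  c₀ = t₃ ⊕ con (+ 3) ⊗ (p ⊗ t₄ ⊕ (con (+ 3) ⊗ p ⊗ p ⊖ q) ⊗ t₅)
  c₁ = t₄ ⊖ q ⊗ t₃ ⊕ con (+ 3) ⊗ ((p ⊕ q ⊗ q ⊖ con (+ 3) ⊗ p ⊗ p ⊗ q) ⊗ t₅ ⊖ p ⊗ q ⊗ t₄)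
  c₂ = p ⊗ t₃ ⊕ (con (+ 3) ⊗ p ⊗ p ⊖ q) ⊗ t₄ ⊕ (con (+ 9) ⊗ p ⊗ p ⊗ p ⊖ con (+ 6) ⊗ p ⊗ q ⊕ con (+ 1)) ⊗ t₅

-- For aᵢ = 3αᵢ and bᵢ = 3βᵢ (i = 0, 1), t₁ + 3 c₁ is 3 (a₂² + b₂² + 3 restExpr).
private
  restExpr : ∀ {n} (p q α₀ α₁ a₂ β₀ β₁ b₂ : Expr n) → Expr n
  restExpr p q α₀ α₁ a₂ β₀ β₁ b₂ =
    con (+ 2) ⊗ (α₀ ⊗ α₁ ⊕ β₀ ⊗ β₁) ⊕ α₀ ⊗ β₀ ⊕ (α₁ ⊗ b₂ ⊕ a₂ ⊗ β₁)
    ⊖ q ⊗ (con (+ 2) ⊗ (α₁ ⊗ a₂ ⊕ β₁ ⊗ b₂) ⊕ α₀ ⊗ b₂ ⊕ con (+ 3) ⊗ α₁ ⊗ β₁ ⊕ a₂ ⊗ β₀)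
    ⊖ p ⊗ q ⊗ (a₂ ⊗ a₂ ⊕ b₂ ⊗ b₂ ⊕ con (+ 3) ⊗ (α₁ ⊗ b₂ ⊕ a₂ ⊗ β₁))
    ⊕ (p ⊕ q ⊗ q ⊖ con (+ 3) ⊗ p ⊗ p ⊗ q) ⊗ (a₂ ⊗ b₂)

-- Modulo 3 the trace polynomial is y³, so y reduces to 0 and the norm forms reduce to a cube and to
-- a sum of two squares. `3∣squares` holds because -1 is not a square modulo 3.
record Is3Prime (A : IntegerAlgebra) : Set where
  open IntegerAlgebra A

  field
    3-cancel  : ∀ x → ι (+ 3) * x ≈ 0# → x ≈ 0#
    3∣cube    : ∀ x t → x * x * x + ι (+ 3) * t ≈ 0# → ∃ λ q → x ≈ ι (+ 3) * q
    3∣squares : ∀ x y t → x * x + y * y + ι (+ 3) * t ≈ 0# →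
      (∃ λ q → x ≈ ι (+ 3) * q) × (∃ λ q → y ≈ ι (+ 3) * q)

ℤ-is3Prime : Is3Prime ℤ-algebra
ℤ-is3Prime = record
  { 3-cancel  = 3*n≡0⇒n≡0
  ; 3∣cube    = 3∣n³⇒3∣n
  ; 3∣squares = 3∣m²+n²⇒3∣m,n
  }

cubicNorm : Expr 5
cubicNorm = n₀ ⊗ n₀ ⊗ n₀ ⊕ con (+ 3) ⊗ normTail (var (# 0)) (var (# 1)) n₀ (var (# 3)) (var (# 4))
  where n₀ = var (# 2)

module _ {n} (p q a₀ a₁ a₂ b₀ b₁ b₂ : Expr n) where
  private
    reduce : (Expr n → Expr n → Expr n → Expr n → Expr n → Expr n) → Expr n
    reduce c = c p q (t₃ a₀ a₁ a₂ b₀ b₁ b₂) (t₄ a₀ a₁ a₂ b₀ b₁ b₂) (t₅ a₀ a₁ a₂ b₀ b₁ b₂)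

  sexticTail₀ sexticTail₁ sexticTail₂ sexticExpr₀ sexticExpr₁ sexticExpr₂ : Expr n
  sexticTail₀ = reduce c₀
  sexticTail₁ = reduce c₁
  sexticTail₂ = reduce c₂
  sexticExpr₀ = t₀ a₀ a₁ a₂ b₀ b₁ b₂ ⊕ con (+ 3) ⊗ sexticTail₀
  sexticExpr₁ = t₁ a₀ a₁ a₂ b₀ b₁ b₂ ⊕ con (+ 3) ⊗ sexticTail₁
  sexticExpr₂ = t₂ a₀ a₁ a₂ b₀ b₁ b₂ ⊕ con (+ 3) ⊗ sexticTail₂

private
  w₀ w₁ w₂ w₃ w₄ w₅ w₆ w₇ : Expr 8
  w₀ = var (# 0)
  w₁ = var (# 1)
  w₂ = var (# 2)
  w₃ = var (# 3)
  w₄ = var (# 4)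
  w₅ = var (# 5)
  w₆ = var (# 6)
  w₇ = var (# 7)

sexticNorm₀ sexticNorm₁ sexticNorm₂ : Expr 8
sexticNorm₀ = sexticExpr₀ w₀ w₁ w₂ w₃ w₄ w₅ w₆ w₇
sexticNorm₁ = sexticExpr₁ w₀ w₁ w₂ w₃ w₄ w₅ w₆ w₇
sexticNorm₂ = sexticExpr₂ w₀ w₁ w₂ w₃ w₄ w₅ w₆ w₇

-- Stated for an abstract ring in place of ℤ, whose operations would unfold.
module Descent (A : IntegerAlgebra) (is3Prime : Is3Prime A) where
  open IntegerAlgebra A
  open Is3Prime is3Prime
  open Solver using (prove)

  -- Eisenstein's argument: y has a third of the valuation of 3, so n₀, n₁ and n₂ are reached one
  -- after the other, with one factor 3 of the norm cancelled in between.
  cubic-descent : ∀ p q n₀ n₁ n₂ → eval cubicNorm (p ∷ q ∷ n₀ ∷ n₁ ∷ n₂ ∷ []) ≈ 0# →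
    ∃ λ m₀ → ∃ λ m₁ → ∃ λ m₂ → n₀ ≈ ι (+ 3) * m₀ × n₁ ≈ ι (+ 3) * m₁ × n₂ ≈ ι (+ 3) * m₂
  cubic-descent p q n₀ n₁ n₂ eq₀ =
    after₀ (3∣cube n₀ (eval (normTail v₀ v₁ v₂ v₃ v₄) (p ∷ q ∷ n₀ ∷ n₁ ∷ n₂ ∷ [])) eq₀)
    where
    v₀ v₁ v₂ v₃ v₄ : Expr 5
    v₀ = var (# 0)
    v₁ = var (# 1)
    v₂ = var (# 2)
    v₃ = var (# 3)
    v₄ = var (# 4)
    norm₁ norm₂ : Expr 5
    norm₁ = v₃ ⊗ v₃ ⊗ v₃ ⊕ con (+ 3) ⊗ normTail′ v₀ v₁ v₂ v₃ v₄
    norm₂ = v₄ ⊗ v₄ ⊗ v₄ ⊕ con (+ 3) ⊗ normTail″ v₀ v₁ v₂ v₃ v₄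
    step₁ : ∀ a → ι (+ 3) * eval norm₁ (p ∷ q ∷ a ∷ n₁ ∷ n₂ ∷ []) ≈ eval cubicNorm (p ∷ q ∷ ι (+ 3) * a ∷ n₁ ∷ n₂ ∷ [])
    step₁ a = prove (p ∷ q ∷ a ∷ n₁ ∷ n₂ ∷ []) (toPolynomial (con (+ 3) ⊗ norm₁))
      (toPolynomial (three v₂ ⊗ three v₂ ⊗ three v₂ ⊕ con (+ 3) ⊗ normTail v₀ v₁ (three v₂) v₃ v₄)) ≡.refl
    step₂ : ∀ a b → ι (+ 3) * eval norm₂ (p ∷ q ∷ a ∷ b ∷ n₂ ∷ []) ≈ eval norm₁ (p ∷ q ∷ a ∷ ι (+ 3) * b ∷ n₂ ∷ [])
    step₂ a b = prove (p ∷ q ∷ a ∷ b ∷ n₂ ∷ []) (toPolynomial (con (+ 3) ⊗ norm₂))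
      (toPolynomial (three v₃ ⊗ three v₃ ⊗ three v₃ ⊕ con (+ 3) ⊗ normTail′ v₀ v₁ v₂ (three v₃) v₄)) ≡.refl
    Goal : Set
    Goal = ∃ λ m₀ → ∃ λ m₁ → ∃ λ m₂ → n₀ ≈ ι (+ 3) * m₀ × n₁ ≈ ι (+ 3) * m₁ × n₂ ≈ ι (+ 3) * m₂
    after₁ : ∀ {a} → n₀ ≈ ι (+ 3) * a → eval norm₁ (p ∷ q ∷ a ∷ n₁ ∷ n₂ ∷ []) ≈ 0# → (∃ λ b → n₁ ≈ ι (+ 3) * b) → Goal
    after₁ {a} n₀≈3a eq₁ (b , n₁≈3b) =
      let
        eq₂ = 3-cancel (eval norm₂ (p ∷ q ∷ a ∷ b ∷ n₂ ∷ [])) (trans (step₂ a b)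
                (trans (sym (eval-cong norm₁ (refl ∷ refl ∷ refl ∷ n₁≈3b ∷ refl ∷ []))) eq₁))
        c , n₂≈3c = 3∣cube n₂ (eval (normTail″ v₀ v₁ v₂ v₃ v₄) (p ∷ q ∷ a ∷ b ∷ n₂ ∷ [])) eq₂
      in a , b , c , n₀≈3a , n₁≈3b , n₂≈3c
    after₀ : (∃ λ a → n₀ ≈ ι (+ 3) * a) → Goal
    after₀ (a , n₀≈3a) = after₁ n₀≈3a eq₁ (3∣cube n₁ (eval (normTail′ v₀ v₁ v₂ v₃ v₄) (p ∷ q ∷ a ∷ n₁ ∷ n₂ ∷ [])) eq₁)
      where
      eq₁ : eval norm₁ (p ∷ q ∷ a ∷ n₁ ∷ n₂ ∷ []) ≈ 0#
      eq₁ = 3-cancel (eval norm₁ (p ∷ q ∷ a ∷ n₁ ∷ n₂ ∷ [])) (trans (step₁ a)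
              (trans (sym (eval-cong cubicNorm (refl ∷ refl ∷ n₀≈3a ∷ refl ∷ refl ∷ []))) eq₀))

  -- The squares of a₀, a₁ y and a₂ y² contribute to 1, y² and y⁴, and y⁴ contains 3y after
  -- reduction. Hence the constant coefficient comes first, then that of y², and last that of y,
  -- after a factor 3 is cancelled.
  sextic-descent : ∀ p q a₀ a₁ a₂ b₀ b₁ b₂ → let ρ = p ∷ q ∷ a₀ ∷ a₁ ∷ a₂ ∷ b₀ ∷ b₁ ∷ b₂ ∷ [] in
    eval sexticNorm₀ ρ ≈ 0# → eval sexticNorm₁ ρ ≈ 0# → eval sexticNorm₂ ρ ≈ 0# →
    ∃ λ α₀ → ∃ λ α₁ → ∃ λ α₂ → ∃ λ β₀ → ∃ λ β₁ → ∃ λ β₂ →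
      (a₀ ≈ ι (+ 3) * α₀ × a₁ ≈ ι (+ 3) * α₁ × a₂ ≈ ι (+ 3) * α₂) ×
      (b₀ ≈ ι (+ 3) * β₀ × b₁ ≈ ι (+ 3) * β₁ × b₂ ≈ ι (+ 3) * β₂)
  sextic-descent p q a₀ a₁ a₂ b₀ b₁ b₂ eq₀ eq₁ eq₂ =
    after₀ (3∣squares a₀ b₀ (eval (sexticTail₀ w₀ w₁ w₂ w₃ w₄ w₅ w₆ w₇) (p ∷ q ∷ a₀ ∷ a₁ ∷ a₂ ∷ b₀ ∷ b₁ ∷ b₂ ∷ [])) eq₀)
    where
    u₀ u₁ u₂ u₃ u₄ u₅ u₆ rest₂ : Expr 7
    u₀ = var (# 0)
    u₁ = var (# 1)
    u₂ = var (# 2)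
    u₃ = var (# 3)
    u₄ = var (# 4)
    u₅ = var (# 5)
    u₆ = var (# 6)
    -- The variable `u₆` stands for the whole tail c₂, which occurs with the factor 3 and need not
    -- be expanded.
    rest₂ = con (+ 2) ⊗ (u₀ ⊗ u₂ ⊕ u₃ ⊗ u₅) ⊕ (u₀ ⊗ u₄ ⊕ u₁ ⊗ u₃) ⊕ u₆
    norm₁ : Expr 8
    norm₁ = w₄ ⊗ w₄ ⊕ w₇ ⊗ w₇ ⊕ con (+ 3) ⊗ restExpr w₀ w₁ w₂ w₃ w₄ w₅ w₆ w₇
    C₂ : Carrier → Carrier → Carrier
    C₂ α₀ β₀ = eval (sexticTail₂ w₀ w₁ w₂ w₃ w₄ w₅ w₆ w₇) (p ∷ q ∷ ι (+ 3) * α₀ ∷ a₁ ∷ a₂ ∷ ι (+ 3) * β₀ ∷ b₁ ∷ b₂ ∷ [])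
    step₂ : ∀ α₀ β₀ → a₁ * a₁ + b₁ * b₁ + ι (+ 3) * eval rest₂ (α₀ ∷ a₁ ∷ a₂ ∷ β₀ ∷ b₁ ∷ b₂ ∷ C₂ α₀ β₀ ∷ [])
      ≈ eval sexticNorm₂ (p ∷ q ∷ ι (+ 3) * α₀ ∷ a₁ ∷ a₂ ∷ ι (+ 3) * β₀ ∷ b₁ ∷ b₂ ∷ [])
    step₂ α₀ β₀ = prove (α₀ ∷ a₁ ∷ a₂ ∷ β₀ ∷ b₁ ∷ b₂ ∷ C₂ α₀ β₀ ∷ [])
      (toPolynomial (u₁ ⊗ u₁ ⊕ u₄ ⊗ u₄ ⊕ con (+ 3) ⊗ rest₂))
      (toPolynomial (t₂ (three u₀) u₁ u₂ (three u₃) u₄ u₅ ⊕ con (+ 3) ⊗ u₆)) ≡.refl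
    step₁ : ∀ α₀ α₁ β₀ β₁ → ι (+ 3) * eval norm₁ (p ∷ q ∷ α₀ ∷ α₁ ∷ a₂ ∷ β₀ ∷ β₁ ∷ b₂ ∷ [])
      ≈ eval sexticNorm₁ (p ∷ q ∷ ι (+ 3) * α₀ ∷ ι (+ 3) * α₁ ∷ a₂ ∷ ι (+ 3) * β₀ ∷ ι (+ 3) * β₁ ∷ b₂ ∷ [])
    step₁ α₀ α₁ β₀ β₁ = prove (p ∷ q ∷ α₀ ∷ α₁ ∷ a₂ ∷ β₀ ∷ β₁ ∷ b₂ ∷ [])
      (toPolynomial (con (+ 3) ⊗ norm₁))
      (toPolynomial (sexticExpr₁ w₀ w₁ (three w₂) (three w₃) w₄ (three w₅) (three w₆) w₇)) ≡.refl
    Divisible : Carrier → Set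
    Divisible x = ∃ λ y → x ≈ ι (+ 3) * y
    Goal : Set
    Goal = ∃ λ α₀ → ∃ λ α₁ → ∃ λ α₂ → ∃ λ β₀ → ∃ λ β₁ → ∃ λ β₂ →
      (a₀ ≈ ι (+ 3) * α₀ × a₁ ≈ ι (+ 3) * α₁ × a₂ ≈ ι (+ 3) * α₂) ×
      (b₀ ≈ ι (+ 3) * β₀ × b₁ ≈ ι (+ 3) * β₁ × b₂ ≈ ι (+ 3) * β₂)
    after₁ : ∀ {α₀ β₀} → a₀ ≈ ι (+ 3) * α₀ → b₀ ≈ ι (+ 3) * β₀ → Divisible a₁ × Divisible b₁ → Goal
    after₁ {α₀} {β₀} a₀≈ b₀≈ ((α₁ , a₁≈) , (β₁ , b₁≈)) =
      let (α₂ , a₂≈) , (β₂ , b₂≈) = 3∣squares a₂ b₂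
            (eval (restExpr w₀ w₁ w₂ w₃ w₄ w₅ w₆ w₇) (p ∷ q ∷ α₀ ∷ α₁ ∷ a₂ ∷ β₀ ∷ β₁ ∷ b₂ ∷ [])) eq₁′
      in α₀ , α₁ , α₂ , β₀ , β₁ , β₂ , (a₀≈ , a₁≈ , a₂≈) , (b₀≈ , b₁≈ , b₂≈)
      where
      eq₁′ : eval norm₁ (p ∷ q ∷ α₀ ∷ α₁ ∷ a₂ ∷ β₀ ∷ β₁ ∷ b₂ ∷ []) ≈ 0#
      eq₁′ = 3-cancel (eval norm₁ (p ∷ q ∷ α₀ ∷ α₁ ∷ a₂ ∷ β₀ ∷ β₁ ∷ b₂ ∷ [])) (trans (step₁ α₀ α₁ β₀ β₁)
        (trans (sym (eval-cong sexticNorm₁ (refl ∷ refl ∷ a₀≈ ∷ a₁≈ ∷ refl ∷ b₀≈ ∷ b₁≈ ∷ refl ∷ []))) eq₁))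
    after₀ : Divisible a₀ × Divisible b₀ → Goal
    after₀ ((α₀ , a₀≈) , (β₀ , b₀≈)) = after₁ a₀≈ b₀≈
      (3∣squares a₁ b₁ (eval rest₂ (α₀ ∷ a₁ ∷ a₂ ∷ β₀ ∷ b₁ ∷ b₂ ∷ C₂ α₀ β₀ ∷ [])) (trans (step₂ α₀ β₀)
        (trans (sym (eval-cong sexticNorm₂ (refl ∷ refl ∷ a₀≈ ∷ refl ∷ refl ∷ b₀≈ ∷ refl ∷ refl ∷ []))) eq₂)))

module LinearIndependence (O : OrderedRing) (m : ℕ) where
  open OrderedRing O
  open SalemPolynomial integerAlgebra
  open SalemRoot O m
  open Solver
  open import Relation.Binary.Reasoning.Setoid setoid

  -- Chosen so that 3 p′ = 6k + 3 and 3 q′ = 12k + 3 are the first two elementary symmetric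
  -- functions of the roots of the trace polynomial.
  p′ q′ : ℤ
  p′ = + (1 ℕ.+ 2 ℕ.* (2 ℕ.+ m))
  q′ = + (1 ℕ.+ 4 ℕ.* (2 ℕ.+ m))

  private
    p q : Carrier
    p = ι p′
    q = ι q′

  3-cancel : ∀ {x} → ι (+ 3) * x ≈ 0# → x ≈ 0#
  3-cancel {x} h = zero-cancel (Pos-ι-suc 2) (trans (*-comm x (ι (+ 3))) h)

  eisenstein : Carrier → Carrier
  eisenstein y = y * y * y - ι (+ 3) * (p * (y * y) - q * y + ι (+ 1))

  :eisenstein : ∀ {n} → Polynomial n → Polynomial n → Polynomial n → Polynomial n
  :eisenstein p q y = y :* y :* y :- con (+ 3) :* (p :* (y :* y) :- q :* y :+ con (+ 1))

  eisenstein≈trace : ∀ y → eisenstein y ≈ trace κ y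
  eisenstein≈trace y = begin
    eisenstein y
      ≈⟨ +-congˡ (-‿cong (*-congˡ (+-congʳ (+-cong (*-congʳ (affine 1 2 _)) (-‿cong (*-congʳ (affine 1 4 _))))))) ⟩
    y * y * y - ι (+ 3) * ((ι (+ 1) + ι (+ 2) * κ) * (y * y) - (ι (+ 1) + ι (+ 4) * κ) * y + ι (+ 1))
      ≈⟨ solve 2 (λ κ y → :eisenstein (con (+ 1) :+ con (+ 2) :* κ) (con (+ 1) :+ con (+ 4) :* κ) y := :trace κ y) ≡.refl κ y ⟩
    trace κ y ∎

  ι-3* : ∀ {n m} → n ≡ + 3 ℤ.* m → ι n ≈ ι (+ 3) * ι m
  ι-3* {m = m} n≡3m = trans (reflexive (≡.cong ι n≡3m)) (ι-* (+ 3) m)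

  ι-zero : ∀ {n} (e : Expr n) ρ → eval e (Vec.map ι ρ) ≈ 0# → evalℤ e ρ ≡ 0ℤ
  ι-zero e ρ h = ι-injective (trans (ι-eval integerAlgebra e ρ) h)

  module _ {y : Carrier} (trace≈0 : trace κ y ≈ 0#) where

    private
      eisenstein≈0 : eisenstein y ≈ 0#
      eisenstein≈0 = trans (eisenstein≈trace y) trace≈0

    quadratic : ℤ → ℤ → ℤ → Carrier
    quadratic n₀ n₁ n₂ = ι n₀ + ι n₁ * y + ι n₂ * (y * y)

    Vanishes₃ : Vec ℤ 3 → Set
    Vanishes₃ (n₀ ∷ n₁ ∷ n₂ ∷ []) = quadratic n₀ n₁ n₂ ≈ 0#

    private
      -- The norm is `quadratic n₀ n₁ n₂` times its two conjugates. The product of the latter is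
      -- symmetric in the other two roots, whose sum `s` and product `m` are polynomials in y; so
      -- these roots need not be at hand.
      norm₃ : ∀ n₀ n₁ n₂ → quadratic n₀ n₁ n₂ ≈ 0# →
        eval cubicNorm (Vec.map ι (p′ ∷ q′ ∷ n₀ ∷ n₁ ∷ n₂ ∷ [])) ≈ 0#
      norm₃ n₀ n₁ n₂ h = modulo h (trans
        (modulo eisenstein≈0 (solve 6 (λ p q y n₀ n₁ n₂ →
          let
            e₁ = con (+ 3) :* p
            e₂ = con (+ 3) :* q
            s  = e₁ :- y
            m  = e₂ :- y :* s
          in
            n₀ :* n₀ :* n₀ :+ con (+ 3) :*
              (n₀ :* (n₀ :* n₁ :* p :+ n₀ :* n₂ :* (con (+ 3) :* p :* p :- con (+ 2) :* q)
                :+ n₁ :* n₁ :* q :+ n₁ :* n₂ :* (con (+ 3) :* p :* q :- con (+ 3))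
                :+ n₂ :* n₂ :* (con (+ 3) :* q :* q :- con (+ 6) :* p))
              :+ (n₁ :* n₁ :* n₁ :+ con (+ 3) :* (n₁ :* n₁ :* n₂ :* p :+ n₁ :* n₂ :* n₂ :* q :+ n₂ :* n₂ :* n₂)))
            := (con (+ 0) :+ (n₀ :* n₀ :+ n₀ :* n₁ :* s :+ n₀ :* n₂ :* (s :* s :- con (+ 2) :* m)
                 :+ n₁ :* n₁ :* m :+ n₁ :* n₂ :* (m :* s) :+ n₂ :* n₂ :* (m :* m))
                :* (n₀ :+ n₁ :* y :+ n₂ :* (y :* y)))
               :+ (:- (n₁ :* n₁ :* n₁ :+ e₁ :* n₁ :* n₁ :* n₂ :+ e₂ :* n₁ :* n₂ :* n₂ :+ (con (+ 3) :+ y :* m) :* n₂ :* n₂ :* n₂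
                 :- con (+ 3) :* n₀ :* n₁ :* n₂ :- con (+ 2) :* e₁ :* n₀ :* n₂ :* n₂)) :* :eisenstein p q y)
          ≡.refl p q y (ι n₀) (ι n₁) (ι n₂)))
        (+-congʳ ι-0))

      descend₃ : ∀ v → Vanishes₃ v → ∃ λ u → v ≡ Vec.map (+ 3 ℤ.*_) u × Vanishes₃ u
      descend₃ (n₀ ∷ n₁ ∷ n₂ ∷ []) h = conclude (Descent.cubic-descent ℤ-algebra ℤ-is3Prime p′ q′ n₀ n₁ n₂
          (ι-zero cubicNorm (p′ ∷ q′ ∷ n₀ ∷ n₁ ∷ n₂ ∷ []) (norm₃ n₀ n₁ n₂ h)))
        where
        conclude : (∃ λ m₀ → ∃ λ m₁ → ∃ λ m₂ → n₀ ≡ + 3 ℤ.* m₀ × n₁ ≡ + 3 ℤ.* m₁ × n₂ ≡ + 3 ℤ.* m₂) →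
          ∃ λ u → n₀ ∷ n₁ ∷ n₂ ∷ [] ≡ Vec.map (+ 3 ℤ.*_) u × Vanishes₃ u
        conclude (m₀ , m₁ , m₂ , n₀≡ , n₁≡ , n₂≡) =
          m₀ ∷ m₁ ∷ m₂ ∷ [] , ≡.cong₂ _∷_ n₀≡ (≡.cong₂ _∷_ n₁≡ (≡.cong (_∷ []) n₂≡)) ,
          3-cancel (trans (solve 4 (λ y a b c → con (+ 3) :* (a :+ b :* y :+ c :* (y :* y))
               := con (+ 3) :* a :+ con (+ 3) :* b :* y :+ con (+ 3) :* c :* (y :* y)) ≡.refl y (ι m₀) (ι m₁) (ι m₂))
            (trans (sym (+-cong (+-cong (ι-3* n₀≡) (*-congʳ (ι-3* n₁≡))) (*-congʳ (ι-3* n₂≡)))) h))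

    quadratic≈0⇒≡0 : ∀ {n₀ n₁ n₂} → quadratic n₀ n₁ n₂ ≈ 0# → n₀ ≡ 0ℤ × n₁ ≡ 0ℤ × n₂ ≡ 0ℤ
    quadratic≈0⇒≡0 {n₀} {n₁} {n₂} h with infinite-descent Vanishes₃ descend₃ (n₀ ∷ n₁ ∷ n₂ ∷ []) h
    ... | p ∷ q ∷ r ∷ [] = p , q , r

  module _ {β : Carrier} (isRoot : IsSalemRoot β) where
    open IsSalemRoot isRoot

    private
      A+Bβ : (a₀ a₁ a₂ b₀ b₁ b₂ : ℤ) → Carrier
      A+Bβ a₀ a₁ a₂ b₀ b₁ b₂ = quadratic trace≈0 a₀ a₁ a₂ + quadratic trace≈0 b₀ b₁ b₂ * β

      Vanishes₆ : Vec ℤ 6 → Set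
      Vanishes₆ (a₀ ∷ a₁ ∷ a₂ ∷ b₀ ∷ b₁ ∷ b₂ ∷ []) = A+Bβ a₀ a₁ a₂ b₀ b₁ b₂ ≈ 0#

      -- The norm (A + Bβ)(A + B/β) from ℚ(β) to ℚ(y).
      norm₂ : ∀ {A B} → A + B * β ≈ 0# → A * A + A * B * y + B * B ≈ 0#
      norm₂ {A} {B} h = begin
        A * A + A * B * y + B * B
          ≈⟨ modulo {c = - (B * B)} (x≈y⇒x-y≈0 (trans β*z≈1 (sym ι-1)))
               (solve 4 (λ A B β z → A :* A :+ A :* B :* (β :+ z) :+ B :* B :=
                 (A :+ B :* z) :* (A :+ B :* β) :+ (:- (B :* B)) :* (β :* z :- con (+ 1))) ≡.refl A B β z) ⟩
        (A + B * z) * (A + B * β) ≈⟨ *-zero-cong _ h ⟩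
        0# ∎

      norm₆ : ∀ {a₀ a₁ a₂ b₀ b₁ b₂} → A+Bβ a₀ a₁ a₂ b₀ b₁ b₂ ≈ 0# →
        let v = p′ ∷ q′ ∷ a₀ ∷ a₁ ∷ a₂ ∷ b₀ ∷ b₁ ∷ b₂ ∷ [] in
        quadratic trace≈0 (evalℤ sexticNorm₀ v) (evalℤ sexticNorm₁ v) (evalℤ sexticNorm₂ v) ≈ 0#
      norm₆ {a₀} {a₁} {a₂} {b₀} {b₁} {b₂} h = begin
        quadratic trace≈0 (evalℤ sexticNorm₀ v) (evalℤ sexticNorm₁ v) (evalℤ sexticNorm₂ v)
          ≈⟨ +-cong (+-cong (ι-eval integerAlgebra sexticNorm₀ v) (*-congʳ (ι-eval integerAlgebra sexticNorm₁ v)))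
               (*-congʳ (ι-eval integerAlgebra sexticNorm₂ v)) ⟩
        eval sexticNorm₀ (Vec.map ι v) + eval sexticNorm₁ (Vec.map ι v) * y + eval sexticNorm₂ (Vec.map ι v) * (y * y)
          ≈⟨ modulo (trans (eisenstein≈trace y) trace≈0)
               (prove (ι p′ ∷ ι q′ ∷ ι a₀ ∷ ι a₁ ∷ ι a₂ ∷ ι b₀ ∷ ι b₁ ∷ ι b₂ ∷ y ∷ [])
                 (toPolynomial (sexticExpr₀ v₀ v₁ v₂ v₃ v₄ v₅ v₆ v₇ ⊕ sexticExpr₁ v₀ v₁ v₂ v₃ v₄ v₅ v₆ v₇ ⊗ Y
                    ⊕ sexticExpr₂ v₀ v₁ v₂ v₃ v₄ v₅ v₆ v₇ ⊗ (Y ⊗ Y)))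
                 (toPolynomial (A ⊗ A ⊕ A ⊗ B ⊗ Y ⊕ B ⊗ B ⊕
                   -- The quotient of T₃ Y³ + T₄ Y⁴ + T₅ Y⁵ by the cubic in the next line.
                   (⊝ (T₃ ⊕ T₄ ⊗ (Y ⊕ con (+ 3) ⊗ v₀) ⊕ T₅ ⊗ (Y ⊗ Y ⊕ con (+ 3) ⊗ v₀ ⊗ Y ⊕ (con (+ 9) ⊗ v₀ ⊗ v₀ ⊖ con (+ 3) ⊗ v₁)))
                   ⊗ (Y ⊗ Y ⊗ Y ⊖ con (+ 3) ⊗ (v₀ ⊗ (Y ⊗ Y) ⊖ v₁ ⊗ Y ⊕ con (+ 1))))))
                 ≡.refl) ⟩
        Aᵥ * Aᵥ + Aᵥ * Bᵥ * y + Bᵥ * Bᵥ ≈⟨ norm₂ h ⟩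
        0# ∎
        where
        v : Vec ℤ 8
        v = p′ ∷ q′ ∷ a₀ ∷ a₁ ∷ a₂ ∷ b₀ ∷ b₁ ∷ b₂ ∷ []
        Aᵥ Bᵥ : Carrier
        Aᵥ = quadratic trace≈0 a₀ a₁ a₂
        Bᵥ = quadratic trace≈0 b₀ b₁ b₂
        v₀ v₁ v₂ v₃ v₄ v₅ v₆ v₇ Y A B T₃ T₄ T₅ : Expr 9
        v₀ = var (# 0)
        v₁ = var (# 1)
        v₂ = var (# 2)
        v₃ = var (# 3)
        v₄ = var (# 4)
        v₅ = var (# 5)
        v₆ = var (# 6)
        v₇ = var (# 7)
        Y  = var (# 8)
        A  = v₂ ⊕ v₃ ⊗ Y ⊕ v₄ ⊗ (Y ⊗ Y)
        B  = v₅ ⊕ v₆ ⊗ Y ⊕ v₇ ⊗ (Y ⊗ Y)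
        T₃ = t₃ v₂ v₃ v₄ v₅ v₆ v₇
        T₄ = t₄ v₂ v₃ v₄ v₅ v₆ v₇
        T₅ = t₅ v₂ v₃ v₄ v₅ v₆ v₇

      descend₆ : ∀ v → Vanishes₆ v → ∃ λ u → v ≡ Vec.map (+ 3 ℤ.*_) u × Vanishes₆ u
      descend₆ (a₀ ∷ a₁ ∷ a₂ ∷ b₀ ∷ b₁ ∷ b₂ ∷ []) h =
        let n₀≡0 , n₁≡0 , n₂≡0 = quadratic≈0⇒≡0 trace≈0 (norm₆ {a₀} {a₁} {a₂} {b₀} {b₁} {b₂} h)
        in conclude (Descent.sextic-descent ℤ-algebra ℤ-is3Prime p′ q′ a₀ a₁ a₂ b₀ b₁ b₂ n₀≡0 n₁≡0 n₂≡0)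
        where
        conclude : (∃ λ α₀ → ∃ λ α₁ → ∃ λ α₂ → ∃ λ β₀ → ∃ λ β₁ → ∃ λ β₂ →
            (a₀ ≡ + 3 ℤ.* α₀ × a₁ ≡ + 3 ℤ.* α₁ × a₂ ≡ + 3 ℤ.* α₂) ×
            (b₀ ≡ + 3 ℤ.* β₀ × b₁ ≡ + 3 ℤ.* β₁ × b₂ ≡ + 3 ℤ.* β₂)) →
          ∃ λ u → a₀ ∷ a₁ ∷ a₂ ∷ b₀ ∷ b₁ ∷ b₂ ∷ [] ≡ Vec.map (+ 3 ℤ.*_) u × Vanishes₆ u
        conclude (α₀ , α₁ , α₂ , β₀ , β₁ , β₂ , (a₀≡ , a₁≡ , a₂≡) , (b₀≡ , b₁≡ , b₂≡)) =
          α₀ ∷ α₁ ∷ α₂ ∷ β₀ ∷ β₁ ∷ β₂ ∷ [] ,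
          ≡.cong₂ _∷_ a₀≡ (≡.cong₂ _∷_ a₁≡ (≡.cong₂ _∷_ a₂≡
            (≡.cong₂ _∷_ b₀≡ (≡.cong₂ _∷_ b₁≡ (≡.cong (_∷ []) b₂≡))))) ,
          3-cancel (trans
            (solve 8 (λ y β a₀ a₁ a₂ b₀ b₁ b₂ →
              con (+ 3) :* (a₀ :+ a₁ :* y :+ a₂ :* (y :* y) :+ (b₀ :+ b₁ :* y :+ b₂ :* (y :* y)) :* β)
              := con (+ 3) :* a₀ :+ con (+ 3) :* a₁ :* y :+ con (+ 3) :* a₂ :* (y :* y)
                :+ (con (+ 3) :* b₀ :+ con (+ 3) :* b₁ :* y :+ con (+ 3) :* b₂ :* (y :* y)) :* β)
              ≡.refl y β (ι α₀) (ι α₁) (ι α₂) (ι β₀) (ι β₁) (ι β₂))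
            (trans (sym (+-cong (+-cong (+-cong (ι-3* a₀≡) (*-congʳ (ι-3* a₁≡))) (*-congʳ (ι-3* a₂≡)))
              (*-congʳ (+-cong (+-cong (ι-3* b₀≡) (*-congʳ (ι-3* b₁≡))) (*-congʳ (ι-3* b₂≡)))))) h))

    polynomial : (c₀ c₁ c₂ c₃ c₄ c₅ : Carrier) → Carrier
    polynomial c₀ c₁ c₂ c₃ c₄ c₅ = c₀ + β * (c₁ + β * (c₂ + β * (c₃ + β * (c₄ + β * c₅))))

    -- β⁻², …, β³ and 1, y, y², β, βy, βy² generate the same ℤ-module, as y = β + β⁻¹.
    linear-independence : ∀ c₀ c₁ c₂ c₃ c₄ c₅ → polynomial (ι c₀) (ι c₁) (ι c₂) (ι c₃) (ι c₄) (ι c₅) ≈ 0# →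
      Allᵛ (_≡ 0ℤ) (c₀ ∷ c₁ ∷ c₂ ∷ c₃ ∷ c₄ ∷ c₅ ∷ [])
    linear-independence c₀ c₁ c₂ c₃ c₄ c₅ h = conclude (infinite-descent Vanishes₆ descend₆ _ vanishes)
      where
      ι-minus : ∀ a b → ι (a ℤ.- b) ≈ ι a - ι b
      ι-minus a b = trans (ι-+ a (ℤ.- b)) (+-congˡ (ι-neg b))

      -- The coefficients come from z = y - β, z² = y² - yβ - 1, β² = yβ - 1 and β³ = y²β - y - β.
      vanishes : A+Bβ (c₂ ℤ.- c₄ ℤ.- c₀) (c₁ ℤ.- c₅) c₀ (c₃ ℤ.- c₁ ℤ.- c₅) (c₄ ℤ.- c₀) c₅ ≈ 0#
      vanishes = begin
        A+Bβ (c₂ ℤ.- c₄ ℤ.- c₀) (c₁ ℤ.- c₅) c₀ (c₃ ℤ.- c₁ ℤ.- c₅) (c₄ ℤ.- c₀) c₅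
          ≈⟨ +-cong (+-congʳ (+-cong (trans (ι-minus (c₂ ℤ.- c₄) c₀) (+-congʳ (ι-minus c₂ c₄))) (*-congʳ (ι-minus c₁ c₅))))
               (*-congʳ (+-congʳ (+-cong (trans (ι-minus (c₃ ℤ.- c₁) c₅) (+-congʳ (ι-minus c₃ c₁))) (*-congʳ (ι-minus c₄ c₀))))) ⟩
        ι c₂ - ι c₄ - ι c₀ + (ι c₁ - ι c₅) * y + ι c₀ * (y * y)
          + (ι c₃ - ι c₁ - ι c₅ + (ι c₄ - ι c₀) * y + ι c₅ * (y * y)) * β
          ≈⟨ modulo (x≈y⇒x-y≈0 (trans β*z≈1 (sym ι-1))) (solve 8 (λ β z c₀ c₁ c₂ c₃ c₄ c₅ →
               let y = β :+ z in
               c₂ :- c₄ :- c₀ :+ (c₁ :- c₅) :* y :+ c₀ :* (y :* y)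
                 :+ (c₃ :- c₁ :- c₅ :+ (c₄ :- c₀) :* y :+ c₅ :* (y :* y)) :* β
               := z :* z :* (c₀ :+ β :* (c₁ :+ β :* (c₂ :+ β :* (c₃ :+ β :* (c₄ :+ β :* c₅)))))
                 :+ (c₀ :- c₂ :+ c₄ :+ z :* (c₅ :- c₁) :+ β :* (con (+ 2) :* c₅ :- c₃ :- z :* c₂)
                    :- β :* β :* (c₄ :+ z :* c₃) :- β :* β :* β :* (c₅ :+ z :* c₄) :- β :* β :* β :* β :* z :* c₅)
                   :* (β :* z :- con (+ 1))) ≡.refl β z (ι c₀) (ι c₁) (ι c₂) (ι c₃) (ι c₄) (ι c₅)) ⟩
        z * z * polynomial (ι c₀) (ι c₁) (ι c₂) (ι c₃) (ι c₄) (ι c₅) ≈⟨ *-zero-cong _ h ⟩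
        0# ∎

      difference≡0 : ∀ a b → a ℤ.- b ≡ 0ℤ → b ≡ 0ℤ → a ≡ 0ℤ
      difference≡0 a b a-b≡0 b≡0 = ≡.trans (ℤₚ.i-j≡0⇒i≡j a b a-b≡0) b≡0

      conclude : Allᵛ (_≡ 0ℤ) ((c₂ ℤ.- c₄ ℤ.- c₀) ∷ (c₁ ℤ.- c₅) ∷ c₀ ∷ (c₃ ℤ.- c₁ ℤ.- c₅) ∷ (c₄ ℤ.- c₀) ∷ c₅ ∷ []) →
        Allᵛ (_≡ 0ℤ) (c₀ ∷ c₁ ∷ c₂ ∷ c₃ ∷ c₄ ∷ c₅ ∷ [])
      conclude (a₀≡0 ∷ a₁≡0 ∷ c₀≡0 ∷ b₀≡0 ∷ b₁≡0 ∷ c₅≡0 ∷ []) =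
        c₀≡0 ∷ c₁≡0 ∷ difference≡0 c₂ c₄ (difference≡0 (c₂ ℤ.- c₄) c₀ a₀≡0 c₀≡0) c₄≡0 ∷
        difference≡0 c₃ c₁ (difference≡0 (c₃ ℤ.- c₁) c₅ b₀≡0 c₅≡0) c₁≡0 ∷ c₄≡0 ∷ c₅≡0 ∷ []
        where
        c₁≡0 : c₁ ≡ 0ℤ
        c₁≡0 = difference≡0 c₁ c₅ a₁≡0 c₅≡0
        c₄≡0 : c₄ ≡ 0ℤ
        c₄≡0 = difference≡0 c₄ c₀ b₁≡0 c₀≡0

-- Conjugates

module Complexification (A : IntegerAlgebra) where
  open IntegerAlgebra A
  open Solver using (solve; _:+_; _:*_; _:-_; :-_; _:=_)
  open import Algebra.Properties.Ring (CommutativeRing.ring commutativeRing) using (-0#≈0#)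

  infix 4 _≈ᵢ_
  infixl 6 _+ᵢ_
  infixl 7 _*ᵢ_

  -- The operations below agree with those of `ℂ-rawRing` component by component, so a complex
  -- number of the statement enters through its two projections.
  Complex : Set
  Complex = Carrier × Carrier

  _≈ᵢ_ : Complex → Complex → Set
  (a , b) ≈ᵢ (c , d) = a ≈ c × b ≈ d

  _+ᵢ_ _*ᵢ_ : Complex → Complex → Complex
  (a , b) +ᵢ (c , d) = a + c , b + d
  (a , b) *ᵢ (c , d) = a * c - b * d , a * d + b * c

  -ᵢ_ : Complex → Complex
  -ᵢ (a , b) = - a , - b

  embed : Carrier → Complex
  embed a = a , 0#

  private
    a-0*b≈a : ∀ {a} b → a - 0# * b ≈ a
    a-0*b≈a {a} b = trans (+-congˡ (trans (-‿cong (zeroˡ b)) -0#≈0#)) (+-identityʳ a)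

    a-b*0≈a : ∀ {a} b → a - b * 0# ≈ a
    a-b*0≈a {a} b = trans (+-congˡ (trans (-‿cong (zeroʳ b)) -0#≈0#)) (+-identityʳ a)

  embed-* : ∀ a c → embed (a * c) ≈ᵢ embed a *ᵢ embed c
  embed-* a c = sym (a-0*b≈a 0#) , sym (trans (+-cong (zeroʳ a) (zeroˡ c)) (+-identityˡ 0#))

  complexRing : CommutativeRing 0ℓ 0ℓ
  complexRing = record
    { Carrier = Complex ; _≈_ = _≈ᵢ_ ; _+_ = _+ᵢ_ ; _*_ = _*ᵢ_ ; -_ = -ᵢ_ ; 0# = embed 0# ; 1# = embed 1#
    ; isCommutativeRing = record
      { isRing = record
        { +-isAbelianGroup = record
          { isGroup = record
            { isMonoid = record
              { isSemigroup = record
                { isMagma = record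
                  { isEquivalence = record
                    { refl  = refl , refl
                    ; sym   = λ (p , q) → sym p , sym q
                    ; trans = λ (p , q) (r , s) → trans p r , trans q s
                    }
                  ; ∙-cong = λ (p , q) (r , s) → +-cong p r , +-cong q s
                  }
                ; assoc = λ (a , b) (c , d) (e , f) → +-assoc a c e , +-assoc b d f
                }
              ; identity = (λ (a , b) → +-identityˡ a , +-identityˡ b) , (λ (a , b) → +-identityʳ a , +-identityʳ b)
              }
            ; inverse = (λ (a , b) → -‿inverseˡ a , -‿inverseˡ b) , (λ (a , b) → -‿inverseʳ a , -‿inverseʳ b)
            ; ⁻¹-cong = λ (p , q) → -‿cong p , -‿cong q
            }
          ; comm = λ (a , b) (c , d) → +-comm a c , +-comm b d
          }
        ; *-cong = λ (p , q) (r , s) →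
            +-cong (*-cong p r) (-‿cong (*-cong q s)) , +-cong (*-cong p s) (*-cong q r)
        ; *-assoc = λ (a , b) (c , d) (e , f) →
            solve 6 (λ a b c d e f → (a :* c :- b :* d) :* e :- (a :* d :+ b :* c) :* f
              := a :* (c :* e :- d :* f) :- b :* (c :* f :+ d :* e)) ≡.refl a b c d e f ,
            solve 6 (λ a b c d e f → (a :* c :- b :* d) :* f :+ (a :* d :+ b :* c) :* e
              := a :* (c :* f :+ d :* e) :+ b :* (c :* e :- d :* f)) ≡.refl a b c d e f
        ; *-identity =
            (λ (a , b) → trans (a-0*b≈a b) (*-identityˡ a) ,
              trans (+-cong (*-identityˡ b) (zeroˡ a)) (+-identityʳ b)) ,
            (λ (a , b) → trans (a-b*0≈a b) (*-identityʳ a) ,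
              trans (+-cong (zeroʳ a) (*-identityʳ b)) (+-identityˡ b))
        ; distrib =
            (λ (a , b) (c , d) (e , f) →
              solve 6 (λ a b c d e f → a :* (c :+ e) :- b :* (d :+ f)
                := (a :* c :- b :* d) :+ (a :* e :- b :* f)) ≡.refl a b c d e f ,
              solve 6 (λ a b c d e f → a :* (d :+ f) :+ b :* (c :+ e)
                := (a :* d :+ b :* c) :+ (a :* f :+ b :* e)) ≡.refl a b c d e f) ,
            (λ (a , b) (c , d) (e , f) →
              solve 6 (λ a b c d e f → (c :+ e) :* a :- (d :+ f) :* b
                := (c :* a :- d :* b) :+ (e :* a :- f :* b)) ≡.refl a b c d e f ,
              solve 6 (λ a b c d e f → (c :+ e) :* b :+ (d :+ f) :* a
                := (c :* b :+ d :* a) :+ (e :* b :+ f :* a)) ≡.refl a b c d e f)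
        }
      ; *-comm = λ (a , b) (c , d) →
          solve 4 (λ a b c d → a :* c :- b :* d := c :* a :- d :* b) ≡.refl a b c d ,
          solve 4 (λ a b c d → a :* d :+ b :* c := c :* b :+ d :* a) ≡.refl a b c d
      }
    }

  complexAlgebra : IntegerAlgebra
  complexAlgebra = record
    { commutativeRing = complexRing
    ; ι     = λ n → embed (ι n)
    ; ι-+   = λ m n → ι-+ m n , sym (+-identityˡ 0#)
    ; ι-*   = λ m n → let p , q = embed-* (ι m) (ι n) in trans (ι-* m n) p , q
    ; ι-neg = λ n → ι-neg n , sym -0#≈0#
    ; ι-0   = ι-0 , refl
    ; ι-1   = ι-1 , refl
    }

  norm : Complex → Carrier
  norm (a , b) = a * a + b * b

  norm-* : ∀ z w → norm (z *ᵢ w) ≈ norm z * norm w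
  norm-* (a , b) (c , d) = solve 4 (λ a b c d →
    (a :* c :- b :* d) :* (a :* c :- b :* d) :+ (a :* d :+ b :* c) :* (a :* d :+ b :* c)
    := (a :* a :+ b :* b) :* (c :* c :+ d :* d)) ≡.refl a b c d

  norm-≈0 : ∀ {z} → z ≈ᵢ embed 0# → norm z ≈ 0#
  norm-≈0 (p , q) = trans (+-cong (trans (*-congʳ p) (zeroˡ _)) (trans (*-congʳ q) (zeroˡ _))) (+-identityˡ 0#)

module Conjugates (O : OrderedRing) (m : ℕ) where
  open OrderedRing O
  open SalemPolynomial integerAlgebra
  open SalemRoot O m
  open Solver
  open Complexification integerAlgebra
  module ℂ = IntegerAlgebra complexAlgebra
  module ℂ-Salem = SalemPolynomial complexAlgebra

  -- A positive y or -y could be cancelled from the product, which would make x zero; `tight`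
  -- concludes.
  zero-product : ∀ {x y} → x * y ≈ 0# → ¬ x ≈ 0# → y ≈ 0#
  zero-product {x} {y} h x≉0 = tight
    (λ p → x≉0 (zero-cancel p h))
    (λ p → x≉0 (zero-cancel p (trans (solve 2 (λ x y → x :* (:- y) := (:- con (+ 1)) :* (x :* y)) ≡.refl x y) (*-zero-cong _ h))))

  -- This admits classical case distinctions in the proof of an equation.
  stable : ∀ {x} → ¬ ¬ x ≈ 0# → x ≈ 0#
  stable ¬¬h = tight (λ p → ¬¬h λ h → ¬Pos-0 (Pos-cong h p))
    (λ p → ¬¬h λ h → ¬Pos-0 (Pos-cong (trans (solve 1 (λ x → :- x := (:- con (+ 1)) :* x) ≡.refl _) (*-zero-cong _ h)) p))

  sum-of-squares≈0⇒≈0 : ∀ {x y} → x * x + y * y ≈ 0# → x ≈ 0#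
  sum-of-squares≈0⇒≈0 {x} {y} h = tight
    (λ p → ¬Pos-0 (Pos-cong h (Pos-+-*-self y (Pos-* p p))))
    (λ p → ¬Pos-0 (Pos-cong (trans (solve 2 (λ x y → (:- x) :* (:- x) :+ y :* y := x :* x :+ y :* y) ≡.refl x y) h)
      (Pos-+-*-self y (Pos-* p p))))

  private
    chord : Carrier → Carrier → Carrier
    chord y₁ y₂ = y₁ * y₁ + y₁ * y₂ + y₂ * y₂ - (ι (+ 6) * κ + ι (+ 3)) * (y₁ + y₂) + (ι (+ 12) * κ + ι (+ 3))

    :chord : ∀ {n} → (κ y₁ y₂ : Polynomial n) → Polynomial n
    :chord κ y₁ y₂ = y₁ :* y₁ :+ y₁ :* y₂ :+ y₂ :* y₂ :- (con (+ 6) :* κ :+ con (+ 3)) :* (y₁ :+ y₂) :+ (con (+ 12) :* κ :+ con (+ 3))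

    -- The difference quotient of the trace polynomial.
    chord≈0 : ∀ {y₁ y₂} → trace κ y₁ ≈ 0# → trace κ y₂ ≈ 0# → Pos (y₁ - y₂) → chord y₁ y₂ ≈ 0#
    chord≈0 {y₁} {y₂} h₁ h₂ y₁>y₂ = zero-cancel y₁>y₂ (trans
      (solve 3 (λ κ y₁ y₂ → :chord κ y₁ y₂ :* (y₁ :- y₂) := :trace κ y₁ :- :trace κ y₂) ≡.refl κ y₁ y₂)
      (x≈y⇒x-y≈0 (trans h₁ (sym h₂))))

  -- Vieta's relations by divided differences: the second one gives the sum of the roots, then a
  -- first one the sum of the products of pairs, then the equation itself the product.
  traceRoots : ∀ {y₁ y₂ y₃} → trace κ y₁ ≈ 0# → trace κ y₂ ≈ 0# → trace κ y₃ ≈ 0# →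
    Pos (y₃ - y₂) → Pos (y₃ - y₁) → Pos (y₂ - y₁) → TraceRoots κ y₁ y₂ y₃
  traceRoots {y₁} {y₂} {y₃} h₁ h₂ h₃ y₃>y₂ y₃>y₁ y₂>y₁ = record { e₁ = e₁ ; e₂ = e₂ ; e₃ = e₃ }
    where
    p q : Carrier
    p = ι (+ 6) * κ + ι (+ 3)
    q = ι (+ 12) * κ + ι (+ 3)
    e₁ : y₁ + y₂ + y₃ ≈ p
    e₁ = x-y≈0⇒x≈y (zero-cancel y₂>y₁ (trans
      (solve 4 (λ κ y₁ y₂ y₃ → (y₁ :+ y₂ :+ y₃ :- (con (+ 6) :* κ :+ con (+ 3))) :* (y₂ :- y₁)
        := :chord κ y₃ y₂ :- :chord κ y₃ y₁) ≡.refl κ y₁ y₂ y₃)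
      (x≈y⇒x-y≈0 (trans (chord≈0 h₃ h₂ y₃>y₂) (sym (chord≈0 h₃ h₁ y₃>y₁))))))
    e₂ : y₁ * y₂ + y₁ * y₃ + y₂ * y₃ ≈ q
    e₂ = modulo {c = - (y₁ + y₂)} (x≈y⇒x-y≈0 (sym e₁)) (modulo {c = - ι (+ 1)} (chord≈0 h₂ h₁ y₂>y₁)
      (solve 4 (λ κ y₁ y₂ y₃ → y₁ :* y₂ :+ y₁ :* y₃ :+ y₂ :* y₃ :=
        (con (+ 12) :* κ :+ con (+ 3)) :+ (:- (y₁ :+ y₂)) :* ((con (+ 6) :* κ :+ con (+ 3)) :- (y₁ :+ y₂ :+ y₃))
        :+ (:- con (+ 1)) :* :chord κ y₂ y₁) ≡.refl κ y₁ y₂ y₃))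
    e₃ : y₁ * y₂ * y₃ ≈ ι (+ 3)
    e₃ = modulo {c = y₁} (x≈y⇒x-y≈0 e₂) (modulo {c = - (y₁ * y₁)} (x≈y⇒x-y≈0 e₁) (modulo {c = ι (+ 1)} h₁
      (solve 4 (λ κ y₁ y₂ y₃ → y₁ :* y₂ :* y₃ := con (+ 3)
        :+ y₁ :* (y₁ :* y₂ :+ y₁ :* y₃ :+ y₂ :* y₃ :- (con (+ 12) :* κ :+ con (+ 3)))
        :+ (:- (y₁ :* y₁)) :* (y₁ :+ y₂ :+ y₃ :- (con (+ 6) :* κ :+ con (+ 3)))
        :+ con (+ 1) :* :trace κ y₁) ≡.refl κ y₁ y₂ y₃)))

  -- The trace polynomial at y = 4/T - 2, multiplied by T³.  For T = 1 + t²
  -- this y is twice the real part of ((1 - t²) + 2ti)/(1 + t²).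
  circlePolynomial : Carrier → Carrier → Carrier
  circlePolynomial κ T = (ι (+ 4) - ι (+ 2) * T) * (ι (+ 4) - ι (+ 4) * T) * (ι (+ 4) - (ι (+ 6) * κ + ι (+ 3)) * T)
    + (ι (+ 4) - ι (+ 5) * T) * (T * T)

  circlePolynomial-cong : ∀ {S T} → S ≈ T → circlePolynomial κ S ≈ circlePolynomial κ T
  circlePolynomial-cong h = +-cong (*-cong (*-cong (+-congˡ (-‿cong (*-congˡ h))) (+-congˡ (-‿cong (*-congˡ h))))
    (+-congˡ (-‿cong (*-congˡ h)))) (*-cong (+-congˡ (-‿cong (*-congˡ h))) (*-cong h h))

  :circlePolynomial : ∀ {n} → (κ T : Polynomial n) → Polynomial n
  :circlePolynomial κ T = (con (+ 4) :- con (+ 2) :* T) :* (con (+ 4) :- con (+ 4) :* T) :* (con (+ 4) :- (con (+ 6) :* κ :+ con (+ 3)) :* T)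
    :+ (con (+ 4) :- con (+ 5) :* T) :* (T :* T)

  module CircleRoot {h : Carrier} (64*h≈1 : ι (+ 64) * h ≈ ι (+ 1))
                    (t : Carrier) (root : circlePolynomial κ (ι (+ 1) + t * t) ≈ 0#) where
    -- Here `g` = 1/`T`, and (`c`, `w`) = ((1 - t²)/T, 2t/T) is the point of the circle with
    -- parameter t. The circle polynomial has constant term 64 in T, so at a root 1/T is 1/64 of a
    -- polynomial in T; `h` is this 1/64.
    T g y c w : Carrier
    T = ι (+ 1) + t * t
    g = h * (ι (+ 96) * κ + ι (+ 144) - (ι (+ 144) * κ + ι (+ 108)) * T + (ι (+ 48) * κ + ι (+ 29)) * (T * T))
    y = ι (+ 4) * g - ι (+ 2)
    c = ι (+ 2) * g - ι (+ 1)
    w = ι (+ 2) * t * g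

    Pos-T : Pos T
    Pos-T = Pos-+-*-self t (Pos-ι-suc 0)

    g*T≈1 : g * T ≈ ι (+ 1)
    g*T≈1 = modulo {c = ι (+ 1)} (x≈y⇒x-y≈0 64*h≈1) (modulo {c = - h} root
      (solve 3 (λ κ h T → h :* (con (+ 96) :* κ :+ con (+ 144) :- (con (+ 144) :* κ :+ con (+ 108)) :* T
          :+ (con (+ 48) :* κ :+ con (+ 29)) :* (T :* T)) :* T
        := con (+ 1) :+ con (+ 1) :* (con (+ 64) :* h :- con (+ 1)) :+ (:- h) :* :circlePolynomial κ T) ≡.refl κ h T))

    private
      g*T-1≈0 : g * T - ι (+ 1) ≈ 0#
      g*T-1≈0 = x≈y⇒x-y≈0 g*T≈1

      homogenised : Carrier → Carrier
      homogenised e = (ι (+ 4) * g - ι (+ 2) * e) * (ι (+ 4) * g - ι (+ 4) * e) * (ι (+ 4) * g - (ι (+ 6) * κ + ι (+ 3)) * e)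
        + (ι (+ 4) * g - ι (+ 5) * e) * (e * e)

      :homogenised : ∀ {n} → (κ g e : Polynomial n) → Polynomial n
      :homogenised κ g e = (con (+ 4) :* g :- con (+ 2) :* e) :* (con (+ 4) :* g :- con (+ 4) :* e) :* (con (+ 4) :* g :- (con (+ 6) :* κ :+ con (+ 3)) :* e)
        :+ (con (+ 4) :* g :- con (+ 5) :* e) :* (e :* e)

      homogenised-cong : ∀ {e f} → e ≈ f → homogenised e ≈ homogenised f
      homogenised-cong p = +-cong (*-cong (*-cong (+-congˡ (-‿cong (*-congˡ p))) (+-congˡ (-‿cong (*-congˡ p))))
        (+-congˡ (-‿cong (*-congˡ p)))) (*-cong (+-congˡ (-‿cong (*-congˡ p))) (*-cong p p))

    trace≈0 : trace κ y ≈ 0#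
    trace≈0 = trans (solve 2 (λ κ g → :trace κ (con (+ 4) :* g :- con (+ 2)) := :homogenised κ g (con (+ 1))) ≡.refl κ g)
      (trans (homogenised-cong (sym g*T≈1))
      (trans (solve 3 (λ κ g T → :homogenised κ g (g :* T) := g :* g :* g :* :circlePolynomial κ T) ≡.refl κ g T)
        (*-zero-cong _ root)))

    c²+w²≈1 : c * c + w * w ≈ ι (+ 1)
    c²+w²≈1 = modulo {c = ι (+ 4) * g} g*T-1≈0
      (solve 2 (λ t g → (con (+ 2) :* g :- con (+ 1)) :* (con (+ 2) :* g :- con (+ 1)) :+ con (+ 2) :* t :* g :* (con (+ 2) :* t :* g)
        := con (+ 1) :+ con (+ 4) :* g :* (g :* (con (+ 1) :+ t :* t) :- con (+ 1))) ≡.refl t g)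

    y≈2c : y ≈ ι (+ 2) * c
    y≈2c = solve 1 (λ g → con (+ 4) :* g :- con (+ 2) := con (+ 2) :* (con (+ 2) :* g :- con (+ 1))) ≡.refl g

    -- If `w` vanishes, so does t, but at T = 1 the circle polynomial has the value -1.
    w≉0 : ¬ w ≈ 0#
    w≉0 w≈0 = ¬Pos-0 (Pos-cong (trans (modulo t≈0 (modulo {c = - ι (+ 1)} root
        (solve 2 (λ κ t → let p = con (+ 6) :* κ :+ con (+ 3) ; s = t :* t in
          con (+ 1) := con (+ 0) :+ t :* (:- con (+ 8) :* (con (+ 1) :- s) :* (con (+ 4) :- p :- p :* s)
              :- con (+ 7) :- con (+ 11) :* s :- con (+ 5) :* s :* s) :* t
            :+ (:- con (+ 1)) :* :circlePolynomial κ (con (+ 1) :+ s)) ≡.refl κ t))) ι-0)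
      (Pos-ι-suc 0))
      where
      t≈0 : t ≈ 0#
      t≈0 = zero-cancel (Pos-ι-suc 1) (trans (modulo {c = - (ι (+ 2) * t)} g*T-1≈0
        (solve 2 (λ t g → let T = con (+ 1) :+ t :* t in t :* con (+ 2)
          := T :* (con (+ 2) :* t :* g) :+ (:- (con (+ 2) :* t)) :* (g :* T :- con (+ 1))) ≡.refl t g)) (*-zero-cong T w≈0))

    -- (v - y) T = (v - 3) T + (5T - 4), and 5T - 4 = 1 + 5t².
    below : ∀ {v} → Pos (v - ι (+ 3)) → Pos (v - y)
    below {v} p = Pos-cancel Pos-T (Pos-cong (modulo {c = ι (+ 4)} g*T-1≈0
      (solve 3 (λ t g v → let s = t :* t ; T = con (+ 1) :+ s in
        (v :- con (+ 3)) :* T :+ (con (+ 1) :+ s :+ s :+ s :+ s :+ s)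
        := (v :- (con (+ 4) :* g :- con (+ 2))) :* T :+ con (+ 4) :* (g :* T :- con (+ 1))) ≡.refl t g v))
      (Pos-+ (Pos-* p Pos-T) (Pos-+-*-self t (Pos-+-*-self t (Pos-+-*-self t (Pos-+-*-self t Pos-T))))))

  module _ {h : Carrier} (64*h≈1 : ι (+ 64) * h ≈ ι (+ 1)) {t₁ t₂ : Carrier}
           (root₁ : circlePolynomial κ (ι (+ 1) + t₁ * t₁) ≈ 0#)
           (root₂ : circlePolynomial κ (ι (+ 1) + t₂ * t₂) ≈ 0#) where
    private
      module C₁ = CircleRoot 64*h≈1 t₁ root₁
      module C₂ = CircleRoot 64*h≈1 t₂ root₂

    circleRoot-antitone : Pos (t₁ * t₁ - t₂ * t₂) → Pos (C₂.y - C₁.y)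
    circleRoot-antitone p = Pos-cancel (Pos-* C₁.Pos-T C₂.Pos-T) (Pos-cong
      (modulo {c = ι (+ 4) * C₂.T} (x≈y⇒x-y≈0 C₁.g*T≈1) (modulo {c = - (ι (+ 4) * C₁.T)} (x≈y⇒x-y≈0 C₂.g*T≈1)
        (solve 4 (λ t₁ t₂ g₁ g₂ → let T₁ = con (+ 1) :+ t₁ :* t₁ ; T₂ = con (+ 1) :+ t₂ :* t₂ in
          con (+ 4) :* (t₁ :* t₁ :- t₂ :* t₂)
          := ((con (+ 4) :* g₂ :- con (+ 2)) :- (con (+ 4) :* g₁ :- con (+ 2))) :* (T₁ :* T₂)
            :+ con (+ 4) :* T₂ :* (g₁ :* T₁ :- con (+ 1))
            :+ (:- (con (+ 4) :* T₁)) :* (g₂ :* T₂ :- con (+ 1))) ≡.refl t₁ t₂ C₁.g C₂.g)))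
      (Pos-* (Pos-ι-suc 3) p))

  -- The roots of x² - y x + 1 are then c ± w i, on the unit circle and not real. With `w` as data,
  -- no square root of 1 - c² is needed.
  record UnitRoot (y : Carrier) : Set where
    field
      c w      : Carrier
      y≈2c     : y ≈ ι (+ 2) * c
      c²+w²≈1  : c * c + w * w ≈ ι (+ 1)
      w≉0      : ¬ w ≈ 0#

  private
    embed-+ : ∀ a b → embed a ℂ.+ embed b ℂ.≈ embed (a + b)
    embed-+ a b = refl , +-identityˡ 0#

    embed-minus : ∀ a b → embed a ℂ.- embed b ℂ.≈ embed (a - b)
    embed-minus a b = refl , -‿inverseʳ 0#

    embed-cong : ∀ {a b} → a ≈ b → embed a ℂ.≈ embed b
    embed-cong h = h , refl

    embed-trace : ∀ y → ℂ-Salem.trace (embed κ) (embed y) ℂ.≈ embed (trace κ y)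
    embed-trace y = ℂ.trans (ℂ.+-cong
      (ℂ.trans (ℂ.*-cong
        (ℂ.trans (ℂ.*-congˡ (embed-minus y (ι (+ 2)))) (ℂ.sym (embed-* y (y - ι (+ 2)))))
        (ℂ.trans (ℂ.+-congʳ (ℂ.trans (ℂ.+-congˡ (ℂ.-‿cong (ℂ.sym (embed-* (ι (+ 6)) κ)))) (embed-minus y (ι (+ 6) * κ))))
          (embed-minus (y - ι (+ 6) * κ) (ι (+ 1)))))
        (ℂ.sym (embed-* (y * (y - ι (+ 2))) (y - ι (+ 6) * κ - ι (+ 1)))))
      (embed-minus y (ι (+ 3))))
      (embed-+ (y * (y - ι (+ 2)) * (y - ι (+ 6) * κ - ι (+ 1))) (y - ι (+ 3)))

    factor : Carrier → Complex → Complex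
    factor y x = x ℂ.* x ℂ.- embed y ℂ.* x ℂ.+ ℂ.ι (+ 1)

    factor-re : ∀ {y u v} → factor y (u , v) ℂ.≈ ℂ.0# → u * u - v * v - y * u + ι (+ 1) ≈ 0#
    factor-re {y} {u} {v} (p , _) = trans (solve 3 (λ y u v → u :* u :- v :* v :- y :* u :+ con (+ 1)
        := u :* u :- v :* v :- (y :* u :- con (+ 0) :* v) :+ con (+ 1)) ≡.refl y u v)
      (trans (+-congʳ (+-congˡ (-‿cong (+-congˡ (-‿cong (*-congʳ ι-0)))))) p)

    factor-im : ∀ {y u v} → factor y (u , v) ℂ.≈ ℂ.0# → v * (ι (+ 2) * u - y) ≈ 0#
    factor-im {y} {u} {v} (_ , q) = trans (solve 3 (λ y u v → v :* (con (+ 2) :* u :- y)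
        := u :* v :+ v :* u :- (y :* v :+ con (+ 0) :* u) :+ con (+ 0)) ≡.refl y u v)
      (trans (+-cong (+-congˡ (-‿cong (+-congˡ (*-congʳ ι-0)))) ι-0) q)

    -- The imaginary part v (2u - y) gives y = 2u, and then the real part is 1 - u² - v².
    factor-nonreal : ∀ {y u v} → factor y (u , v) ℂ.≈ ℂ.0# → ¬ v ≈ 0# → norm (u , v) ≈ ι (+ 1)
    factor-nonreal {y} {u} {v} f v≉0 = modulo {c = - ι (+ 1)} (factor-re f)
      (modulo {c = u} (zero-product (factor-im f) v≉0)
        (solve 3 (λ y u v → u :* u :+ v :* v := con (+ 1)
          :+ (:- con (+ 1)) :* (u :* u :- v :* v :- y :* u :+ con (+ 1)) :+ u :* (con (+ 2) :* u :- y)) ≡.refl y u v))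

    factor-real : ∀ {y u v} → factor y (u , v) ℂ.≈ ℂ.0# → v ≈ 0# → u * u - y * u + ι (+ 1) ≈ 0#
    factor-real {y} {u} {v} f v≈0 = trans (modulo {c = v} v≈0
        (solve 3 (λ y u v → u :* u :- y :* u :+ con (+ 1)
          := u :* u :- v :* v :- y :* u :+ con (+ 1) :+ v :* v) ≡.refl y u v)) (factor-re f)

    -- At a real u the factor equals (u - c)² + w².
    unit-nonreal : ∀ {y u v} → UnitRoot y → factor y (u , v) ℂ.≈ ℂ.0# → ¬ v ≈ 0#
    unit-nonreal {y} {u} {v} unit f v≈0 = w≉0 (sum-of-squares≈0⇒≈0 {w} {u - c}
      (trans (modulo {c = ι (+ 1)} (x≈y⇒x-y≈0 c²+w²≈1) (modulo {c = u} (x≈y⇒x-y≈0 y≈2c)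
        (solve 4 (λ y u c w → w :* w :+ (u :- c) :* (u :- c) := u :* u :- y :* u :+ con (+ 1)
          :+ con (+ 1) :* (c :* c :+ w :* w :- con (+ 1)) :+ u :* (y :- con (+ 2) :* c)) ≡.refl y u c w)))
        (factor-real f v≈0)))
      where open UnitRoot unit

  module _ {β y₁ y₂ : Carrier} (isRoot : IsSalemRoot β)
           (roots : TraceRoots κ y₁ y₂ (IsSalemRoot.y isRoot)) (unit₁ : UnitRoot y₁) (unit₂ : UnitRoot y₂) where
    open IsSalemRoot isRoot using (z; y; β*z≈1)

    private
      embed-affine : ∀ m n → ℂ.ι m ℂ.* embed κ ℂ.+ ℂ.ι n ℂ.≈ embed (ι m * κ + ι n)
      embed-affine m n = ℂ.trans (ℂ.+-congʳ (ℂ.sym (embed-* (ι m) κ))) (embed-+ (ι m * κ) (ι n))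

      complexTraceRoots : ℂ-Salem.TraceRoots (embed κ) (embed y₁) (embed y₂) (embed y)
      complexTraceRoots = record
        { e₁ = ℂ.trans (ℂ.trans (ℂ.+-congʳ (embed-+ y₁ y₂)) (embed-+ (y₁ + y₂) y))
            (ℂ.trans (embed-cong e₁) (ℂ.sym (embed-affine (+ 6) (+ 3))))
        ; e₂ = ℂ.trans (ℂ.+-cong (ℂ.+-cong (ℂ.sym (embed-* y₁ y₂)) (ℂ.sym (embed-* y₁ y))) (ℂ.sym (embed-* y₂ y)))
            (ℂ.trans (ℂ.+-congʳ (embed-+ (y₁ * y₂) (y₁ * y))) (ℂ.trans (embed-+ (y₁ * y₂ + y₁ * y) (y₂ * y))
            (ℂ.trans (embed-cong e₂) (ℂ.sym (embed-affine (+ 12) (+ 3))))))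
        ; e₃ = ℂ.trans (ℂ.*-congʳ (ℂ.sym (embed-* y₁ y₂))) (ℂ.trans (ℂ.sym (embed-* (y₁ * y₂) y)) (embed-cong e₃))
        }
        where open TraceRoots roots

      norm≈0⇒≈0 : ∀ {x} → norm x ≈ 0# → x ℂ.≈ ℂ.0#
      norm≈0⇒≈0 h = sum-of-squares≈0⇒≈0 h , sum-of-squares≈0⇒≈0 (trans (+-comm _ _) h)

    -- Which of the three quadratic factors vanishes cannot be decided, hence the doubly negated
    -- alternative. The norms of the factors replace the factors themselves, because `zero-product`
    -- speaks of the ordered ring. A root of the third factor is nonreal, β or z.
    complex-roots : ∀ {u v} → ℂ-Salem.salem (embed κ) (u , v) ℂ.≈ ℂ.0# → ¬ (u ≈ β × v ≈ 0#) →
      ¬ (¬ norm (u , v) ≈ ι (+ 1) × ¬ norm (u , v) ≈ z * z)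
    complex-roots {u} {v} root ≉β (≉1 , ≉z²) =
      ¬N₃ (zero-product product≈0 λ h → ¬N₂ (zero-product h ¬N₁))
      where
      N : Carrier → Carrier
      N y = norm (factor y (u , v))
      product≈0 : N y₁ * N y₂ * N y ≈ 0#
      product≈0 = trans (*-congʳ (sym (norm-* (factor y₁ (u , v)) (factor y₂ (u , v)))))
        (trans (sym (norm-* (factor y₁ (u , v) ℂ.* factor y₂ (u , v)) (factor y (u , v))))
          (norm-≈0 (ℂ.trans (ℂ.sym (ℂ-Salem.salem-factors complexTraceRoots (u , v))) root)))
      ¬N₁ : ¬ N y₁ ≈ 0#
      ¬N₁ h = ≉1 (factor-nonreal (norm≈0⇒≈0 h) (unit-nonreal unit₁ (norm≈0⇒≈0 h)))
      ¬N₂ : ¬ N y₂ ≈ 0#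
      ¬N₂ h = ≉1 (factor-nonreal (norm≈0⇒≈0 h) (unit-nonreal unit₂ (norm≈0⇒≈0 h)))
      ¬N₃ : ¬ N y ≈ 0#
      ¬N₃ h = ≉z² (trans (+-cong (*-cong u≈z u≈z) (trans (*-congˡ v≈0) (zeroʳ v))) (+-identityʳ (z * z)))
        where
        v≈0 : v ≈ 0#
        v≈0 = stable λ v≉0 → ≉1 (factor-nonreal (norm≈0⇒≈0 h) v≉0)
        u≈z : u ≈ z
        u≈z = x-y≈0⇒x≈y (zero-product
          (trans (modulo {c = ι (+ 1)} (x≈y⇒x-y≈0 (trans β*z≈1 (sym ι-1)))
            (solve 3 (λ u β z → (u :- β) :* (u :- z)
              := u :* u :- (β :+ z) :* u :+ con (+ 1) :+ con (+ 1) :* (β :* z :- con (+ 1))) ≡.refl u β z))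
            (factor-real (norm≈0⇒≈0 h) v≈0))
          (λ u-β≈0 → ≉β (x-y≈0⇒x≈y u-β≈0 , v≈0)))

  -- (c + wi)⁻¹ = c - wi, and the sum of the two is y.
  unitRoot⇒complexRoot : ∀ {y} (unit : UnitRoot y) → trace κ y ≈ 0# →
    ℂ-Salem.salem (embed κ) (UnitRoot.c unit , UnitRoot.w unit) ℂ.≈ ℂ.0#
  unitRoot⇒complexRoot {y} unit trace≈0 = ℂ-Salem.trace≈0⇒salem≈0 {z = c , - w}
      (trans (trans (solve 2 (λ c w → c :* c :- w :* (:- w) := c :* c :+ w :* w) ≡.refl c w) c²+w²≈1) ι-1 ,
       trans (solve 2 (λ c w → c :* (:- w) :+ w :* c := con (+ 0)) ≡.refl c w) ι-0)
      (ℂ.trans (ℂ-Salem.trace-cong (embed κ) sum≈y) (ℂ.trans (embed-trace y) (embed-cong trace≈0)))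
    where
    open UnitRoot unit
    sum≈y : (c , w) ℂ.+ (c , - w) ℂ.≈ embed y
    sum≈y = trans (solve 1 (λ c → c :+ c := con (+ 2) :* c) ≡.refl c) (sym y≈2c) , -‿inverseʳ w

-- Sign changes that isolate β and two parameters on the circle

module Signs (O : OrderedRing) (m : ℕ) where
  open OrderedRing O
  open SalemPolynomial integerAlgebra
  open SalemRoot O m
  open Conjugates O m
  open Solver

  Pos-+-multiple : ∀ {x} b n → Pos x → Pos (x + ⌞ b ⌟ * ⌞ n ⌟)
  Pos-+-multiple {x} b n p = Pos-cong
    (trans (+-comm ⌞ b ℕ.* n ⌟ x) (+-congˡ (trans (affine 0 b n) (trans (+-congʳ ι-0) (+-identityˡ _)))))
    (Pos-⌞⌟+ (b ℕ.* n) p)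

  Pos-6κ-1 : Pos (ι (+ 6) * κ - ι (+ 1))
  Pos-6κ-1 = Pos-cong (solve 1 (λ κ → con (+ 6) :* κ :- con (+ 2) :+ con (+ 1) := con (+ 6) :* κ :- con (+ 1)) ≡.refl κ)
    (Pos-+ Pos-6κ-2 (Pos-ι-suc 0))

  -- In terms of n = 6κ - 1 > 0 all coefficients are positive.
  salem-neg-at-6κ : Pos (- salem κ (ι (+ 6) * κ))
  salem-neg-at-6κ = Pos-cong
    (solve 1 (λ κ → let n = con (+ 6) :* κ :- con (+ 1) in
        n :* n :* n :* n :* n :+ n :* n :* n :* n :+ n :* n :* n :+ n :* n :+ n :* n :+ n :+ n :+ n :+ con (+ 1)
        := :- :salem κ (con (+ 6) :* κ)) ≡.refl κ)
    (Pos-+ (Pos-+ (Pos-+ (Pos-+ (Pos-+ (Pos-+ (Pos-+ (Pos-+ (Pos-* (Pos-* n³ n) n) (Pos-* n³ n)) n³) n²) n²) n) n) n) (Pos-ι-suc 0))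
    where
    n  = Pos-6κ-1
    n² = Pos-* n n
    n³ = Pos-* n² n

  salem-pos-at-6κ+1 : Pos (salem κ (ι (+ 6) * κ + ι (+ 1)))
  salem-pos-at-6κ+1 = Pos-cong
    (solve 1 (λ κ → let n = con (+ 6) :* κ :- con (+ 2) ; x = n :+ con (+ 3) in
        (x :* x :+ con (+ 1)) :* ((n :+ con (+ 2)) :* (n :+ con (+ 2))) :+ x :* x :* (x :* n :+ con (+ 1))
        := :salem κ (con (+ 6) :* κ :+ con (+ 1))) ≡.refl κ)
    (Pos-+ (Pos-* (Pos-+ (Pos-* x x) (Pos-ι-suc 0)) (Pos-* n+2 n+2)) (Pos-* (Pos-* x x) (Pos-+ (Pos-* x Pos-6κ-2) (Pos-ι-suc 0))))
    where
    x   = Pos-+ Pos-6κ-2 (Pos-ι-suc 2)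
    n+2 = Pos-+ Pos-6κ-2 (Pos-ι-suc 1)

  private
    -- At t = e/4, T = (16 + e²)/16, so the factor 4096 = 16³ makes the cubic in T integral.
    scaled : Carrier → Carrier
    scaled e = (ι (+ 64) - ι (+ 2) * S) * (ι (+ 64) - ι (+ 4) * S) * (ι (+ 64) - (ι (+ 6) * κ + ι (+ 3)) * S) + (ι (+ 64) - ι (+ 5) * S) * (S * S)
      where S = ι (+ 16) + e * e

    :scaled : ∀ {n} → Polynomial n → Polynomial n → Polynomial n
    :scaled κ e = (con (+ 64) :- con (+ 2) :* S) :* (con (+ 64) :- con (+ 4) :* S) :* (con (+ 64) :- (con (+ 6) :* κ :+ con (+ 3)) :* S) :+ (con (+ 64) :- con (+ 5) :* S) :* (S :* S)
      where S = con (+ 16) :+ e :* e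

    scaled-cong : ∀ {e f} → e ≈ f → scaled e ≈ scaled f
    scaled-cong p = +-cong (*-cong (*-cong (+-congˡ (-‿cong (*-congˡ S))) (+-congˡ (-‿cong (*-congˡ S)))) (+-congˡ (-‿cong (*-congˡ S))))
        (*-cong (+-congˡ (-‿cong (*-congˡ S))) (*-cong S S))
      where S = +-congˡ (*-cong p p)

    circle≈scaled : ∀ {r} e → ι (+ 4) * r ≈ ι e → circlePolynomial κ (ι (+ 1) + r * r) * ι (+ 4096) ≈ scaled (ι e)
    circle≈scaled {r} e 4r≈e = trans
      (solve 2 (λ κ r → :circlePolynomial κ (con (+ 1) :+ r :* r) :* con (+ 4096) := :scaled κ (con (+ 4) :* r)) ≡.refl κ r)
      (scaled-cong 4r≈e)

  -- The signs -, +, +, - at 0, ¼, ½, 1 put the two parameters into disjoint intervals, which also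
  -- tells which is larger.
  circle-pos-at-¼ : ∀ {r} → ι (+ 4) * r ≈ ι (+ 1) → Pos (circlePolynomial κ (ι (+ 1) + r * r))
  circle-pos-at-¼ {r} 4r≈1 = Pos-cancel (Pos-ι-suc 4095) (Pos-cong
      (trans (solve 1 (λ μ → con (+ 16851) :+ con (+ 12240) :* μ := con (+ 12240) :* (con (+ 2) :+ μ) :- con (+ 7629)) ≡.refl ⌞ m ⌟)
      (trans (+-congʳ (*-congˡ (sym κ≈2+m)))
      (trans (solve 1 (λ κ → con (+ 12240) :* κ :- con (+ 7629) := :scaled κ (con (+ 1))) ≡.refl κ)
        (sym (circle≈scaled (+ 1) 4r≈1)))))
    (Pos-+-multiple 12240 m (Pos-ι-suc 16850)))

  circle-pos-at-½ : ∀ {r} → ι (+ 4) * r ≈ ι (+ 2) → Pos (circlePolynomial κ (ι (+ 1) + r * r))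
  circle-pos-at-½ {r} 4r≈2 = Pos-cancel (Pos-ι-suc 4095) (Pos-cong
      (trans (solve 1 (λ μ → con (+ 76224) :+ con (+ 46080) :* μ := con (+ 46080) :* (con (+ 2) :+ μ) :- con (+ 15936)) ≡.refl ⌞ m ⌟)
      (trans (+-congʳ (*-congˡ (sym κ≈2+m)))
      (trans (solve 1 (λ κ → con (+ 46080) :* κ :- con (+ 15936) := :scaled κ (con (+ 2))) ≡.refl κ)
        (sym (circle≈scaled (+ 2) 4r≈2)))))
    (Pos-+-multiple 46080 m (Pos-ι-suc 76223)))

  circle-neg-at-0 : ∀ {r} → ι (+ 4) * r ≈ ι (+ 0) → Pos (- circlePolynomial κ (ι (+ 1) + r * r))
  circle-neg-at-0 {r} 4r≈0 = Pos-cancel (Pos-ι-suc 4095) (Pos-cong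
    (trans (solve 1 (λ κ → con (+ 4096) := :- :scaled κ (con (+ 0))) ≡.refl κ) (trans (-‿cong (sym (circle≈scaled (+ 0) 4r≈0)))
      (solve 2 (λ x c → :- (x :* c) := (:- x) :* c) ≡.refl _ (ι (+ 4096)))))
    (Pos-ι-suc 4095))

  circle-neg-at-1 : ∀ {r} → ι (+ 4) * r ≈ ι (+ 4) → Pos (- circlePolynomial κ (ι (+ 1) + r * r))
  circle-neg-at-1 {r} 4r≈4 = Pos-cancel (Pos-ι-suc 4095) (Pos-cong
    (trans (solve 1 (λ κ → con (+ 98304) := :- :scaled κ (con (+ 4))) ≡.refl κ) (trans (-‿cong (sym (circle≈scaled (+ 4) 4r≈4)))
      (solve 2 (λ x c → :- (x :* c) := (:- x) :* c) ≡.refl _ (ι (+ 4096)))))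
    (Pos-ι-suc 98303))

-- Period and preperiod

nth : List ℕ → ℕ → ℕ
nth []      _       = 0
nth (d ∷ w) zero    = d
nth (d ∷ w) (suc i) = nth w i

nth-++ : ∀ v w i → nth (v ++ w) (length v ℕ.+ i) ≡ nth w i
nth-++ []      w i = ≡.refl
nth-++ (d ∷ v) w i = nth-++ v w i

nth-avoids : ∀ {x} v w i → All (_≢ x) v → nth (v ++ w) i ≡ x → length v ℕ.≤ i
nth-avoids []      w i       []        _  = z≤n
nth-avoids (d ∷ v) w zero    (d≢x ∷ _) eq = ⊥-elim (d≢x eq)
nth-avoids (d ∷ v) w (suc i) (_ ∷ ≢x)  eq = s≤s (nth-avoids v w i ≢x eq)

suc-% : ∀ n l → suc n % suc l ≡ suc (n % suc l) % suc l
suc-% n l = ≡.trans (≡.cong (λ n → suc n % suc l) (ℕ.m≡m%n+[m/n]*n n (suc l)))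
  (ℕ.[m+kn]%n≡m%n (suc (n % suc l)) (n / suc l) (suc l))

-- The sequence c₁ = first, followed by the repeated word y v x x, where x
-- does not occur in the rest.  The double digit x x marks the end of a period.
module EventuallyPeriodic (first y : ℕ) (v : List ℕ) (x : ℕ)
                          (first≢x : first ≢ x) (y≢x : y ≢ x) (v≢x : All (_≢ x) v) where

  period : List ℕ
  period = y ∷ v ++ x ∷ x ∷ []

  -- The index of the first of the two digits x.
  q L : ℕ
  q = suc (length v)
  L = length period

  L≡2+q : L ≡ suc (suc q)
  L≡2+q = ≡.cong suc (≡.trans (Listₚ.length-++ v) (ℕₚ.+-comm (length v) 2))

  -- `L` equals q + 2 only by a proof; the second version has the modulus in this explicit form.
  periodic periodic′ : ℕ → ℕ
  periodic n  = nth period (n % L)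
  periodic′ n = nth period (n % suc (suc q))

  digit : ℕ → ℤ
  digit zero          = + 0
  digit (suc zero)    = + first
  digit (suc (suc n)) = + periodic n

  L-periodic : ∀ n → periodic n ≡ periodic (n ℕ.+ L)
  L-periodic n = ≡.cong (nth period) (≡.sym (ℕ.[m+n]%n≡m%n n L))

  periodicFrom-1 : PeriodicFrom digit 1 L
  periodicFrom-1 = s≤s z≤n , λ where
    (suc n) _ → ≡.subst (λ i → digit (suc i) ≡ digit (suc i ℕ.+ L)) (ℕₚ.+-comm 1 n) (≡.cong +_ (L-periodic n))

  private
    periodic≡′ : ∀ n → periodic n ≡ periodic′ n
    periodic≡′ n = ≡.cong (λ l → nth period (n % suc l)) (ℕₚ.suc-injective L≡2+q)

    nth-q : nth period q ≡ x
    nth-q = ≡.trans (≡.cong (nth (v ++ x ∷ x ∷ [])) (≡.sym (ℕₚ.+-identityʳ (length v)))) (nth-++ v (x ∷ x ∷ []) 0)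

    nth-1+q : nth period (suc q) ≡ x
    nth-1+q = ≡.trans (≡.cong (nth (v ++ x ∷ x ∷ [])) (ℕₚ.+-comm 1 (length v))) (nth-++ v (x ∷ x ∷ []) 1)

    -- The digit x stands only at q and q + 1, and after q + 1 the period starts again with y ≢ x.
    double⇒q : ∀ n → periodic′ n ≡ x → periodic′ (suc n) ≡ x → n % suc (suc q) ≡ q
    double⇒q n eq eq′ with ℕₚ.m≤n⇒m<n∨m≡n (nth-avoids (y ∷ v) (x ∷ x ∷ []) (n % suc (suc q)) (y≢x ∷ v≢x) eq)
    ... | inj₂ q≡i = ≡.sym q≡i
    ... | inj₁ q<i = ⊥-elim (y≢x (≡.trans (≡.sym (≡.cong (nth period) wrap)) eq′))
      where
      i≡1+q : n % suc (suc q) ≡ suc q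
      i≡1+q = ℕₚ.≤-antisym (ℕₚ.≤-pred (ℕ.m%n<n n (suc (suc q)))) q<i
      wrap : suc n % suc (suc q) ≡ 0
      wrap = ≡.trans (suc-% n (suc q)) (≡.trans (≡.cong (λ i → suc i % suc (suc q)) i≡1+q) (ℕ.n%n≡0 (suc (suc q))))

  module _ {m p} (1≤p : 1 ℕ.≤ p) (per : ∀ n → 1 ℕ.≤ n → digit (n ℕ.+ m) ≡ digit (n ℕ.+ m ℕ.+ p)) where
    private
      l t : ℕ
      l = suc (suc q)
      -- An index of the double digit that is not below m, so that the assumed periodicity applies
      -- to it.
      t = q ℕ.+ m ℕ.* l

      m≤t : m ℕ.≤ t
      m≤t = ℕₚ.≤-trans (ℕₚ.m≤m*n m l) (ℕₚ.m≤n+m (m ℕ.* l) q)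

      shifted : ∀ n → m ℕ.≤ suc n → periodic′ n ≡ periodic′ (n ℕ.+ p)
      shifted n m≤1+n = ≡.trans (≡.sym (periodic≡′ n)) (≡.trans (ℤₚ.+-injective
        (≡.subst (λ i → digit i ≡ digit (i ℕ.+ p)) (ℕₚ.m∸n+n≡m (ℕₚ.m≤n⇒m≤1+n m≤1+n))
          (per (suc (suc n) ℕ.∸ m) (ℕₚ.m<n⇒0<n∸m (s≤s m≤1+n))))) (periodic≡′ (n ℕ.+ p)))

      t%l≡q : t % l ≡ q
      t%l≡q = ≡.trans (ℕ.[m+kn]%n≡m%n q m l) (ℕ.m<n⇒m%n≡m (ℕₚ.m≤n+m (suc q) 1))

      1+q+a*l%l≡1+q : ∀ a → (suc q ℕ.+ a ℕ.* l) % l ≡ suc q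
      1+q+a*l%l≡1+q a = ≡.trans (ℕ.[m+kn]%n≡m%n (suc q) a l) (ℕ.m<n⇒m%n≡m ℕₚ.≤-refl)

      t+p%l≡q : (t ℕ.+ p) % l ≡ q
      t+p%l≡q = double⇒q (t ℕ.+ p)
        (≡.trans (≡.sym (shifted t (ℕₚ.m≤n⇒m≤1+n m≤t))) (≡.trans (≡.cong (nth period) t%l≡q) nth-q))
        (≡.trans (≡.sym (shifted (suc t) (ℕₚ.m≤n⇒m≤1+n (ℕₚ.m≤n⇒m≤1+n m≤t))))
          (≡.trans (≡.cong (nth period) (1+q+a*l%l≡1+q m)) nth-1+q))

      l∣p : l ∣ p
      l∣p = ∣m+n∣m⇒∣n (divides ((t ℕ.+ p) / l) (ℕₚ.+-cancelˡ-≡ q (m ℕ.* l ℕ.+ p) ((t ℕ.+ p) / l ℕ.* l) (begin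
          q ℕ.+ (m ℕ.* l ℕ.+ p)                        ≡⟨ ℕₚ.+-assoc q (m ℕ.* l) p ⟨
          t ℕ.+ p                                      ≡⟨ ℕ.m≡m%n+[m/n]*n (t ℕ.+ p) l ⟩
          (t ℕ.+ p) % l ℕ.+ (t ℕ.+ p) / l ℕ.* l        ≡⟨ ≡.cong (ℕ._+ (t ℕ.+ p) / l ℕ.* l) t+p%l≡q ⟩
          q ℕ.+ (t ℕ.+ p) / l ℕ.* l                    ∎))) (n∣m*n m)
        where open ≡.≡-Reasoning

    period-minimal : L ℕ.≤ p
    period-minimal = ℕₚ.≤-trans (ℕₚ.≤-reflexive L≡2+q) (∣⇒≤ {{ℕ.>-nonZero 1≤p}} l∣p)

    -- For m = 0, c₁ would equal c₁₊ₚ. As p is a positive multiple of the period, the latter is the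
    -- final digit x of a period.
    preperiod-positive : 1 ℕ.≤ m
    preperiod-positive = ℕₚ.n≢0⇒n>0 λ m≡0 → contradict m≡0 l∣p
      where
      contradict : m ≡ 0 → l ∣ p → ⊥
      contradict _ (divides zero p≡0) = ℕₚ.<-irrefl ≡.refl (ℕₚ.<-≤-trans (s≤s z≤n) (ℕₚ.≤-trans 1≤p (ℕₚ.≤-reflexive p≡0)))
      contradict m≡0 (divides (suc a) p≡) = first≢x (ℤₚ.+-injective (≡.trans
        (≡.subst₂ (λ m p → digit (1 ℕ.+ m) ≡ digit (1 ℕ.+ m ℕ.+ p)) m≡0 p≡ (per 1 ℕₚ.≤-refl))
        (≡.cong +_ (≡.trans (periodic≡′ (suc q ℕ.+ a ℕ.* l)) (≡.trans (≡.cong (nth period) (1+q+a*l%l≡1+q a)) nth-1+q)))))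

module Digits (m : ℕ) where
  private
    d₁₀ d₁₁ d₁₂ : ℕ
    d₁₀ = 10 ℕ.+ 6 ℕ.* m
    d₁₁ = 11 ℕ.+ 6 ℕ.* m
    d₁₂ = 12 ℕ.+ 6 ℕ.* m

    v : List ℕ
    v = d₁₂ ∷ middle m ++ d₁₂ ∷ d₁₀ ∷ []

    d₁₂≢d₁₁ : d₁₂ ≢ d₁₁
    d₁₂≢d₁₁ = ℕₚ.1+n≢n

    d₁₀≢d₁₁ : d₁₀ ≢ d₁₁
    d₁₀≢d₁₁ eq = ℕₚ.1+n≢n (≡.sym eq)

    v≢d₁₁ : All (_≢ d₁₁) v
    v≢d₁₁ = d₁₂≢d₁₁ ∷ Allₚ.++⁺ (All.map ℕₚ.<⇒≢ (middle-bound m)) (d₁₂≢d₁₁ ∷ d₁₀≢d₁₁ ∷ [])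

  open EventuallyPeriodic d₁₂ d₁₀ v d₁₁ d₁₂≢d₁₁ d₁₀≢d₁₁ v≢d₁₁ public

  period≡word : period ≡ word m
  period≡word = ≡.cong (λ w → d₁₀ ∷ d₁₂ ∷ w) (Listₚ.++-assoc (middle m) (d₁₂ ∷ d₁₀ ∷ []) (d₁₁ ∷ d₁₁ ∷ []))

  L≡8k+6 : L ≡ 8 ℕ.* (2 ℕ.+ m) ℕ.+ 6
  L≡8k+6 = ≡.trans (≡.cong length period≡word) (length-word m)


module Remainders (O : OrderedRing) (m : ℕ) {β : OrderedRing.Carrier O} (isRoot : SalemRoot.IsSalemRoot O m β) where
  open OrderedRing O
  open Expansion O m
  open Digits m

  remainder : ℕ → Carrier
  remainder zero    = 1#
  remainder (suc n) = β * remainder n - ι (digit (suc n))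

  private
    run-take-suc : ∀ w i x → i ℕ.< length w → run β x (take (suc i) w) ≡ step β (run β x (take i w)) (nth w i)
    run-take-suc (d ∷ w) zero    x _         = ≡.refl
    run-take-suc (d ∷ w) (suc i) x (s≤s i<l) = run-take-suc w i (step β x d) i<l

    x₀ : Carrier
    x₀ = r₁ isRoot

    run-period : run β x₀ period ≈ x₀
    run-period = ≡.subst (λ w → run β x₀ w ≈ x₀) (≡.sym period≡word) (run-word isRoot)

    state : ℕ → Carrier
    state i = run β x₀ (take i period)

    state-wraps : ∀ i → i ℕ.< L → state (suc i) ≈ state (suc i % L)
    state-wraps i i<L with ℕₚ.m≤n⇒m<n∨m≡n i<L
    ... | inj₁ 1+i<L = reflexive (≡.cong state (≡.sym (ℕ.m<n⇒m%n≡m 1+i<L)))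
    ... | inj₂ 1+i≡L = trans (reflexive (≡.cong (run β x₀) (Listₚ.take-all (suc i) period (ℕₚ.≤-reflexive (≡.sym 1+i≡L)))))
      (trans run-period (reflexive (≡.cong state (≡.sym (≡.trans (≡.cong (_% L) 1+i≡L) (ℕ.n%n≡0 L))))))

    -- By `run-word` the state after a whole period is r₁ again, so the walk may wrap around. The
    -- index is shifted because r₀ = 1 precedes the period.
    remainder≈state : ∀ n → remainder (suc n) ≈ state (n % L)
    remainder≈state zero    = +-congʳ (*-identityʳ β)
    remainder≈state (suc n) = begin
      step β (remainder (suc n)) (periodic n)   ≈⟨ +-congʳ (*-congˡ (remainder≈state n)) ⟩
      step β (state (n % L)) (periodic n)       ≡⟨ run-take-suc period (n % L) x₀ (ℕ.m%n<n n L) ⟨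
      state (suc (n % L))                       ≈⟨ state-wraps (n % L) (ℕ.m%n<n n L) ⟩
      state (suc (n % L) % L)                   ≡⟨ ≡.cong state (suc-% n (ℕ.pred L)) ⟨
      state (suc n % L)                         ∎
      where open import Relation.Binary.Reasoning.Setoid setoid

  remainder∈[0,1] : ∀ n → InUnit isRoot (remainder (suc n))
  remainder∈[0,1] n = InUnit-cong isRoot (sym (remainder≈state n))
    (RunInUnit-take isRoot period (n % L) (≡.subst (RunInUnit isRoot x₀) (≡.sym period≡word) (RunInUnit-word isRoot)))

open import Defs hiding (PeriodicFrom)

-- Rational arithmetic

½-pos : ∀ {ε} → 0ℚ ℚ.< ε → 0ℚ ℚ.< ½ ℚ.* ε
½-pos {ε} p = ≡.subst (ℚ._< ½ ℚ.* ε) (ℚₚ.*-zeroʳ ½) (ℚₚ.*-monoʳ-<-pos ½ p)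

½+½ : ∀ ε → ½ ℚ.* ε ℚ.+ ½ ℚ.* ε ≡ ε
½+½ ε = ≡.trans (≡.sym (ℚₚ.*-distribʳ-+ ε ½ ½)) (ℚₚ.*-identityˡ ε)

*-pos : ∀ {p q} → 0ℚ ℚ.< p → 0ℚ ℚ.< q → 0ℚ ℚ.< p ℚ.* q
*-pos {p} {q} 0<p 0<q = ≡.subst (ℚ._< p ℚ.* q) (ℚₚ.*-zeroʳ p) (ℚₚ.*-monoʳ-<-pos p {{ℚ.positive 0<p}} 0<q)

p≤q⇒0≤q-p : ∀ {p q} → p ℚ.≤ q → 0ℚ ℚ.≤ q ℚ.- p
p≤q⇒0≤q-p {p} {q} h = ≡.subst (ℚ._≤ q ℚ.- p) (ℚₚ.+-inverseʳ p) (ℚₚ.+-monoˡ-≤ (ℚ.- p) h)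

0≤p*p : ∀ p → 0ℚ ℚ.≤ p ℚ.* p
0≤p*p p with ℚₚ.≤-total 0ℚ p
... | inj₁ 0≤p = ≡.subst (ℚ._≤ p ℚ.* p) (ℚₚ.*-zeroˡ p) (ℚₚ.*-monoʳ-≤-nonNeg p {{ℚ.nonNegative 0≤p}} 0≤p)
... | inj₂ p≤0 = ≡.subst (ℚ._≤ p ℚ.* p) (ℚₚ.*-zeroˡ p) (ℚₚ.*-monoʳ-≤-nonPos p {{ℚ.nonPositive p≤0}} p≤0)

p≤∣p∣ : ∀ p → p ℚ.≤ ℚ.∣ p ∣
p≤∣p∣ p with ℚₚ.≤-total 0ℚ p
... | inj₁ 0≤p = ℚₚ.≤-reflexive (≡.sym (ℚₚ.0≤p⇒∣p∣≡p 0≤p))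
... | inj₂ p≤0 = ℚₚ.≤-trans p≤0 (ℚₚ.0≤∣p∣ p)

-p≤∣p∣ : ∀ p → ℚ.- p ℚ.≤ ℚ.∣ p ∣
-p≤∣p∣ p = ≡.subst (ℚ.- p ℚ.≤_) (ℚₚ.∣-p∣≡∣p∣ p) (p≤∣p∣ (ℚ.- p))

∣p∣<ε : ∀ {p ε} → p ℚ.< ε → ℚ.- p ℚ.< ε → ℚ.∣ p ∣ ℚ.< ε
∣p∣<ε {p} {ε} p<ε -p<ε with ℚₚ.∣p∣≡p∨∣p∣≡-p p
... | inj₁ eq = ≡.subst (ℚ._< ε) (≡.sym eq) p<ε
... | inj₂ eq = ≡.subst (ℚ._< ε) (≡.sym eq) -p<ε

p≡[p-q]+q : ∀ p q → p ≡ (p ℚ.- q) ℚ.+ q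
p≡[p-q]+q = solve 2 (λ p q → p := (p :- q) :+ q) ≡.refl
  where open Data.Rational.Solver.+-*-Solver

quotient : ∀ {p q} → 0ℚ ℚ.< p → 0ℚ ℚ.< q → ∃[ r ] (0ℚ ℚ.< r × p ℚ.* r ≡ q)
quotient {p} {q} 0<p 0<q = p⁻¹ ℚ.* q , *-pos (ℚₚ.positive⁻¹ p⁻¹) 0<q ,
  ≡.trans (≡.sym (ℚₚ.*-assoc p p⁻¹ q)) (≡.trans (≡.cong (ℚ._* q) (ℚₚ.*-inverseʳ p)) (ℚₚ.*-identityˡ q))
  where
  instance
    p-positive : ℚ.Positive p
    p-positive = ℚ.positive 0<p
    p-nonZero : ℚ.NonZero p
    p-nonZero = ℚₚ.pos⇒nonZero p
  p⁻¹ : ℚ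
  p⁻¹ = ℚ.1/ p
  instance
    p⁻¹-positive : ℚ.Positive p⁻¹
    p⁻¹-positive = ℚₚ.1/pos⇒pos p

quarter-≤ : ∀ ε p q → ½ ℚ.* ε ℚ.≤ p → ℚ.∣ p ℚ.- q ∣ ℚ.< ½ ℚ.* (½ ℚ.* ε) → ½ ℚ.* (½ ℚ.* ε) ℚ.≤ q
quarter-≤ ε p q ½ε≤p ∣p-q∣<¼ε = ℚₚ.≮⇒≥ λ q<¼ε → ℚₚ.<-irrefl ≡.refl (begin-strict
  ½ ℚ.* ε                                       ≤⟨ ½ε≤p ⟩
  p                                             ≡⟨ p≡[p-q]+q p q ⟩
  (p ℚ.- q) ℚ.+ q                               ≤⟨ ℚₚ.+-monoˡ-≤ q (p≤∣p∣ (p ℚ.- q)) ⟩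
  ℚ.∣ p ℚ.- q ∣ ℚ.+ q                           <⟨ ℚₚ.+-mono-< ∣p-q∣<¼ε q<¼ε ⟩
  ½ ℚ.* (½ ℚ.* ε) ℚ.+ ½ ℚ.* (½ ℚ.* ε)           ≡⟨ ½+½ (½ ℚ.* ε) ⟩
  ½ ℚ.* ε                                       ∎)
  where open ℚₚ.≤-Reasoning

toℚᵘ-ℤ→ℚ : ∀ z → ℚ.toℚᵘ (ℤ→ℚ z) ℚᵘ.≃ ℚᵘ.mkℚᵘ z 0
toℚᵘ-ℤ→ℚ z = ℚₚ.toℚᵘ-fromℚᵘ (ℚᵘ.mkℚᵘ z 0)

ℤ→ℚ-+ : ∀ m n → ℤ→ℚ (m ℤ.+ n) ≡ ℤ→ℚ m ℚ.+ ℤ→ℚ n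
ℤ→ℚ-+ m n = ℚₚ.toℚᵘ-injective (ℚᵘₚ.≃-trans (toℚᵘ-ℤ→ℚ (m ℤ.+ n)) (ℚᵘₚ.≃-sym (ℚᵘₚ.≃-trans
  (ℚₚ.toℚᵘ-homo-+ (ℤ→ℚ m) (ℤ→ℚ n)) (ℚᵘₚ.≃-trans (ℚᵘₚ.+-cong (toℚᵘ-ℤ→ℚ m) (toℚᵘ-ℤ→ℚ n))
  (ℚᵘ.*≡* (≡.cong (ℤ._* + 1) (≡.cong₂ ℤ._+_ (ℤₚ.*-identityʳ m) (ℤₚ.*-identityʳ n))))))))

ℤ→ℚ-* : ∀ m n → ℤ→ℚ (m ℤ.* n) ≡ ℤ→ℚ m ℚ.* ℤ→ℚ n
ℤ→ℚ-* m n = ℚₚ.toℚᵘ-injective (ℚᵘₚ.≃-trans (toℚᵘ-ℤ→ℚ (m ℤ.* n)) (ℚᵘₚ.≃-sym (ℚᵘₚ.≃-trans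
  (ℚₚ.toℚᵘ-homo-* (ℤ→ℚ m) (ℤ→ℚ n)) (ℚᵘₚ.*-cong (toℚᵘ-ℤ→ℚ m) (toℚᵘ-ℤ→ℚ n)))))

ℤ→ℚ-neg : ∀ m → ℤ→ℚ (ℤ.- m) ≡ ℚ.- ℤ→ℚ m
ℤ→ℚ-neg m = ℚₚ.toℚᵘ-injective (ℚᵘₚ.≃-trans (toℚᵘ-ℤ→ℚ (ℤ.- m)) (ℚᵘₚ.≃-sym (ℚᵘₚ.≃-trans
  (ℚₚ.toℚᵘ-homo‿- (ℤ→ℚ m)) (ℚᵘₚ.-‿cong (toℚᵘ-ℤ→ℚ m)))))

-- The ordered ring of real numbers

Null : (ℕ → ℚ) → Set
Null a = ∀ ε → 0ℚ ℚ.< ε → Eventually λ n → ℚ.∣ a n ∣ ℚ.< ε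

Bounded : (ℕ → ℚ) → Set
Bounded a = ∃[ B ] (0ℚ ℚ.< B × Eventually λ n → ℚ.∣ a n ∣ ℚ.≤ B)

both : ∀ {A B C : ℕ → Set} → (∀ {n} → A n → B n → C n) → Eventually A → Eventually B → Eventually C
both f (M , a) (N , b) = M ℕ.⊔ N , λ n h →
  f (a n (ℕₚ.m⊔n≤o⇒m≤o M N h)) (b n (ℕₚ.m⊔n≤o⇒n≤o M N h))

Null-cong : ∀ {a b} → (∀ n → a n ≡ b n) → Null a → Null b
Null-cong h na ε 0<ε = let N , f = na ε 0<ε in
  N , λ n N≤n → ≡.subst (λ q → ℚ.∣ q ∣ ℚ.< ε) (h n) (f n N≤n)

Null-0 : ∀ {a} → (∀ n → a n ≡ 0ℚ) → Null a
Null-0 h ε 0<ε = 0 , λ n _ → ≡.subst (λ q → ℚ.∣ q ∣ ℚ.< ε) (≡.sym (h n)) 0<ε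

Null-+ : ∀ {a b} → Null a → Null b → Null (λ n → a n ℚ.+ b n)
Null-+ {a} {b} na nb ε 0<ε = both
  (λ {n} p q → ℚₚ.≤-<-trans (ℚₚ.∣p+q∣≤∣p∣+∣q∣ (a n) (b n)) (≡.subst (_ ℚ.<_) (½+½ ε) (ℚₚ.+-mono-< p q)))
  (na (½ ℚ.* ε) (½-pos 0<ε)) (nb (½ ℚ.* ε) (½-pos 0<ε))

Null-neg : ∀ {a} → Null a → Null (λ n → ℚ.- a n)
Null-neg {a} na ε 0<ε = let N , f = na ε 0<ε in
  N , λ n N≤n → ≡.subst (ℚ._< ε) (≡.sym (ℚₚ.∣-p∣≡∣p∣ (a n))) (f n N≤n)

Null-* : ∀ {a b} → Bounded a → Null b → Null (λ n → a n ℚ.* b n)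
Null-* {a} {b} (B , 0<B , ba) nb ε 0<ε with quotient 0<B 0<ε
... | δ , 0<δ , Bδ≡ε = both
  (λ {n} p q → begin-strict
    ℚ.∣ a n ℚ.* b n ∣       ≡⟨ ℚₚ.∣p*q∣≡∣p∣*∣q∣ (a n) (b n) ⟩
    ℚ.∣ a n ∣ ℚ.* ℚ.∣ b n ∣ ≤⟨ ℚₚ.*-monoʳ-≤-nonNeg ℚ.∣ b n ∣ {{ℚ.nonNegative (ℚₚ.0≤∣p∣ (b n))}} p ⟩
    B ℚ.* ℚ.∣ b n ∣         <⟨ ℚₚ.*-monoʳ-<-pos B {{ℚ.positive 0<B}} q ⟩
    B ℚ.* δ                 ≡⟨ Bδ≡ε ⟩
    ε                       ∎)
  ba (nb δ 0<δ)
  where open ℚₚ.≤-Reasoning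

bounded : ∀ x → Bounded (seq x)
bounded x with cauchy x 1ℚ (ℚₚ.positive⁻¹ 1ℚ)
... | N , h = 1ℚ ℚ.+ ℚ.∣ seq x N ∣ , ℚₚ.+-mono-<-≤ (ℚₚ.positive⁻¹ 1ℚ) (ℚₚ.0≤∣p∣ (seq x N)) , N , λ n p → begin
  ℚ.∣ seq x n ∣                               ≡⟨ ≡.cong ℚ.∣_∣ (p≡[p-q]+q (seq x n) (seq x N)) ⟩
  ℚ.∣ (seq x n ℚ.- seq x N) ℚ.+ seq x N ∣     ≤⟨ ℚₚ.∣p+q∣≤∣p∣+∣q∣ (seq x n ℚ.- seq x N) (seq x N) ⟩
  ℚ.∣ seq x n ℚ.- seq x N ∣ ℚ.+ ℚ.∣ seq x N ∣ ≤⟨ ℚₚ.+-monoˡ-≤ ℚ.∣ seq x N ∣ (ℚₚ.<⇒≤ (h n N p ℕₚ.≤-refl)) ⟩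
  1ℚ ℚ.+ ℚ.∣ seq x N ∣                        ∎
  where open ℚₚ.≤-Reasoning

pointwise : ∀ {x y} → (∀ n → seq x n ≡ seq y n) → x ≈ y
pointwise {x} {y} h = Null-0 λ n → ≡.trans (≡.cong (ℚ._- seq y n) (h n)) (ℚₚ.+-inverseʳ (seq y n))

module _ where
  open Data.Rational.Solver.+-*-Solver

  ≈-sym : ∀ {x y} → x ≈ y → y ≈ x
  ≈-sym {x} {y} h = Null-cong
    (λ n → solve 2 (λ a b → :- (a :- b) := b :- a) ≡.refl (seq x n) (seq y n)) (Null-neg h)

  ≈-trans : ∀ {x y z} → x ≈ y → y ≈ z → x ≈ z
  ≈-trans {x} {y} {z} h k = Null-cong
    (λ n → solve 3 (λ a b c → (a :- b) :+ (b :- c) := a :- c) ≡.refl (seq x n) (seq y n) (seq z n)) (Null-+ h k)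

  +-cong : ∀ {x y u v} → x ≈ y → u ≈ v → x + u ≈ y + v
  +-cong {x} {y} {u} {v} h k = Null-cong
    (λ n → solve 4 (λ a b c d → (a :- b) :+ (c :- d) := (a :+ c) :- (b :+ d)) ≡.refl (seq x n) (seq y n) (seq u n) (seq v n))
    (Null-+ h k)

  -‿cong : ∀ {x y} → x ≈ y → - x ≈ - y
  -‿cong {x} {y} h = Null-cong
    (λ n → solve 2 (λ a b → :- (a :- b) := (:- a) :- (:- b)) ≡.refl (seq x n) (seq y n)) (Null-neg h)

  *-cong : ∀ {x y u v} → x ≈ y → u ≈ v → x * u ≈ y * v
  *-cong {x} {y} {u} {v} h k = Null-cong
    (λ n → solve 4 (λ a b c d → a :* (c :- d) :+ d :* (a :- b) := a :* c :- b :* d) ≡.refl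
      (seq x n) (seq y n) (seq u n) (seq v n))
    (Null-+ (Null-* (bounded x) k) (Null-* (bounded v) h))

ℝ-commutativeRing : CommutativeRing 0ℓ 0ℓ
ℝ-commutativeRing = record
  { Carrier = ℝ ; _≈_ = _≈_ ; _+_ = _+_ ; _*_ = _*_ ; -_ = -_ ; 0# = 0ℝ ; 1# = 1ℝ
  ; isCommutativeRing = record
    { isRing = record
      { +-isAbelianGroup = record
        { isGroup = record
          { isMonoid = record
            { isSemigroup = record
              { isMagma = record
                { isEquivalence = record
                  { refl  = λ {x} → pointwise {x} {x} λ _ → ≡.refl
                  ; sym   = λ {x} {y} → ≈-sym {x} {y}
                  ; trans = λ {x} {y} {z} → ≈-trans {x} {y} {z}
                  }
                ; ∙-cong = λ {x} {y} {u} {v} → +-cong {x} {y} {u} {v}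
                }
              ; assoc = λ x y z → pointwise {(x + y) + z} {x + (y + z)} λ n → ℚₚ.+-assoc (seq x n) (seq y n) (seq z n)
              }
            ; identity = (λ x → pointwise {0ℝ + x} {x} λ n → ℚₚ.+-identityˡ (seq x n))
                       , (λ x → pointwise {x + 0ℝ} {x} λ n → ℚₚ.+-identityʳ (seq x n))
            }
          ; inverse = (λ x → pointwise { (- x) + x} {0ℝ} λ n → ℚₚ.+-inverseˡ (seq x n))
                    , (λ x → pointwise {x + (- x)} {0ℝ} λ n → ℚₚ.+-inverseʳ (seq x n))
          ; ⁻¹-cong = λ {x} {y} → -‿cong {x} {y}
          }
        ; comm = λ x y → pointwise {x + y} {y + x} λ n → ℚₚ.+-comm (seq x n) (seq y n)
        }
      ; *-cong = λ {x} {y} {u} {v} → *-cong {x} {y} {u} {v}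
      ; *-assoc = λ x y z → pointwise {(x * y) * z} {x * (y * z)} λ n → ℚₚ.*-assoc (seq x n) (seq y n) (seq z n)
      ; *-identity = (λ x → pointwise {1ℝ * x} {x} λ n → ℚₚ.*-identityˡ (seq x n))
                   , (λ x → pointwise {x * 1ℝ} {x} λ n → ℚₚ.*-identityʳ (seq x n))
      ; distrib = (λ x y z → pointwise {x * (y + z)} {x * y + x * z} λ n → ℚₚ.*-distribˡ-+ (seq x n) (seq y n) (seq z n))
                , (λ x y z → pointwise {(y + z) * x} {y * x + z * x} λ n → ℚₚ.*-distribʳ-+ (seq x n) (seq y n) (seq z n))
      }
    ; *-comm = λ x y → pointwise {x * y} {y * x} λ n → ℚₚ.*-comm (seq x n) (seq y n)
    }
  }

ℝ-algebra : IntegerAlgebra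
ℝ-algebra = record
  { commutativeRing = ℝ-commutativeRing
  ; ι     = fromℤ
  ; ι-+   = λ m n → pointwise {fromℤ (m ℤ.+ n)} {fromℤ m + fromℤ n} λ _ → ℤ→ℚ-+ m n
  ; ι-*   = λ m n → pointwise {fromℤ (m ℤ.* n)} {fromℤ m * fromℤ n} λ _ → ℤ→ℚ-* m n
  ; ι-neg = λ m → pointwise {fromℤ (ℤ.- m)} { - fromℤ m} λ _ → ℤ→ℚ-neg m
  ; ι-0   = pointwise {fromℤ 0ℤ} {0ℝ} λ _ → ≡.refl
  ; ι-1   = pointwise {fromℤ 1ℤ} {1ℝ} λ _ → ≡.refl
  }

Positive : ℝ → Set
Positive x = ∃[ ε ] (0ℚ ℚ.< ε × Eventually λ n → ε ℚ.≤ seq x n)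

module _ where
  open Data.Rational.Solver.+-*-Solver
  open ℚₚ.≤-Reasoning

  Positive-cong : ∀ {x y} → x ≈ y → Positive x → Positive y
  Positive-cong {x} {y} h (ε , 0<ε , p) = ½ ℚ.* ε , ½-pos 0<ε , both
    (λ {n} ε≤x ∣x-y∣<½ε → ℚₚ.≮⇒≥ λ y<½ε → ℚₚ.<-irrefl ≡.refl (begin-strict
      ε                                  ≤⟨ ε≤x ⟩
      seq x n                            ≡⟨ p≡[p-q]+q (seq x n) (seq y n) ⟩
      (seq x n ℚ.- seq y n) ℚ.+ seq y n  ≤⟨ ℚₚ.+-monoˡ-≤ (seq y n) (p≤∣p∣ (seq x n ℚ.- seq y n)) ⟩
      ℚ.∣ seq x n ℚ.- seq y n ∣ ℚ.+ seq y n <⟨ ℚₚ.+-mono-< ∣x-y∣<½ε y<½ε ⟩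
      ½ ℚ.* ε ℚ.+ ½ ℚ.* ε                ≡⟨ ½+½ ε ⟩
      ε ∎))
    p (h (½ ℚ.* ε) (½-pos 0<ε))

  Positive-+ : ∀ {x y} → Positive x → Positive y → Positive (x + y)
  Positive-+ (ε , 0<ε , p) (δ , 0<δ , q) = ε ℚ.+ δ , ℚₚ.+-mono-< 0<ε 0<δ , both ℚₚ.+-mono-≤ p q

  Positive-* : ∀ {x y} → Positive x → Positive y → Positive (x * y)
  Positive-* {x} {y} (ε , 0<ε , p) (δ , 0<δ , q) = ε ℚ.* δ , *-pos 0<ε 0<δ , both
    (λ {n} ε≤x δ≤y → begin
      ε ℚ.* δ             ≤⟨ ℚₚ.*-monoˡ-≤-nonNeg ε {{ℚ.nonNegative (ℚₚ.<⇒≤ 0<ε)}} δ≤y ⟩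
      ε ℚ.* seq y n       ≤⟨ ℚₚ.*-monoʳ-≤-nonNeg (seq y n) {{ℚ.nonNegative (ℚₚ.≤-trans (ℚₚ.<⇒≤ 0<δ) δ≤y)}} ε≤x ⟩
      seq x n ℚ.* seq y n ∎)
    p q

  Positive-1 : Positive 1ℝ
  Positive-1 = 1ℚ , ℚₚ.positive⁻¹ 1ℚ , 0 , λ _ _ → ℚₚ.≤-refl

  ¬Positive-0 : ¬ Positive 0ℝ
  ¬Positive-0 (ε , 0<ε , N , p) = ℚₚ.<-irrefl ≡.refl (ℚₚ.<-≤-trans 0<ε (p N ℕₚ.≤-refl))

  -- If w ≤ B and x w ≥ η, then x ≥ η/B: the bound on the Cauchy sequence of w supplies the witness.
  Positive-cancel : ∀ {x w} → Positive w → Positive (x * w) → Positive x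
  Positive-cancel {x} {w} (ε , 0<ε , p) (η , 0<η , q) =
    let
      B , 0<B , b = bounded w
      δ , 0<δ , Bδ≡η = quotient 0<B 0<η
    in δ , 0<δ , both
      (λ {n} (ε≤w , w≤B) η≤xw → ℚₚ.≮⇒≥ λ x<δ → ℚₚ.<-irrefl ≡.refl (begin-strict
        η                   ≤⟨ η≤xw ⟩
        seq x n ℚ.* seq w n <⟨ ℚₚ.*-monoˡ-<-pos (seq w n) {{ℚ.positive (ℚₚ.<-≤-trans 0<ε ε≤w)}} x<δ ⟩
        δ ℚ.* seq w n       ≤⟨ ℚₚ.*-monoˡ-≤-nonNeg δ {{ℚ.nonNegative (ℚₚ.<⇒≤ 0<δ)}} (ℚₚ.≤-trans (p≤∣p∣ (seq w n)) w≤B) ⟩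
        δ ℚ.* B             ≡⟨ ℚₚ.*-comm δ B ⟩
        B ℚ.* δ             ≡⟨ Bδ≡η ⟩
        η                   ∎))
      (both _,_ p b) q

  ≈0-cancel : ∀ {x w} → Positive w → x * w ≈ 0ℝ → x ≈ 0ℝ
  ≈0-cancel {x} {w} (ε , 0<ε , p) h δ 0<δ = both
    (λ {n} ε≤w xw<δε → ≡.subst (λ q → ℚ.∣ q ∣ ℚ.< δ) (≡.sym (ℚₚ.+-identityʳ (seq x n)))
      (ℚₚ.*-cancelʳ-<-nonNeg ε {{ℚ.nonNegative (ℚₚ.<⇒≤ 0<ε)}} (begin-strict
        ℚ.∣ seq x n ∣ ℚ.* ε             ≤⟨ ℚₚ.*-monoˡ-≤-nonNeg ℚ.∣ seq x n ∣ {{ℚ.nonNegative (ℚₚ.0≤∣p∣ (seq x n))}}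
                                             (ℚₚ.≤-trans ε≤w (p≤∣p∣ (seq w n))) ⟩
        ℚ.∣ seq x n ∣ ℚ.* ℚ.∣ seq w n ∣ ≡⟨ ℚₚ.∣p*q∣≡∣p∣*∣q∣ (seq x n) (seq w n) ⟨
        ℚ.∣ seq x n ℚ.* seq w n ∣       ≡⟨ ≡.cong ℚ.∣_∣ (ℚₚ.+-identityʳ _) ⟨
        ℚ.∣ seq x n ℚ.* seq w n ℚ.- 0ℚ ∣ <⟨ xw<δε ⟩
        δ ℚ.* ε                         ∎)))
    p (h (δ ℚ.* ε) (*-pos 0<δ 0<ε))

  Positive-+-*-self : ∀ {x} y → Positive x → Positive (x + y * y)
  Positive-+-*-self {x} y (ε , 0<ε , N , p) = ε , 0<ε , N , λ n N≤n → begin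
    ε                                      ≡⟨ ℚₚ.+-identityʳ ε ⟨
    ε ℚ.+ 0ℚ                               ≤⟨ ℚₚ.+-mono-≤ (p n N≤n) (0≤p*p (seq y n)) ⟩
    seq x n ℚ.+ seq y n ℚ.* seq y n        ∎

  -- If x is not eventually bounded away from 0, then |x N| < ½ε for large N.
  ≈0-tight : ∀ {x} → ¬ Positive x → ¬ Positive (- x) → x ≈ 0ℝ
  ≈0-tight {x} ¬pos ¬neg ε 0<ε = N , λ n N≤n → ≡.subst (λ q → ℚ.∣ q ∣ ℚ.< ε) (≡.sym (ℚₚ.+-identityʳ (seq x n))) (begin-strict
    ℚ.∣ seq x n ∣                               ≡⟨ ≡.cong ℚ.∣_∣ (p≡[p-q]+q (seq x n) (seq x N)) ⟩
    ℚ.∣ (seq x n ℚ.- seq x N) ℚ.+ seq x N ∣     ≤⟨ ℚₚ.∣p+q∣≤∣p∣+∣q∣ (seq x n ℚ.- seq x N) (seq x N) ⟩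
    ℚ.∣ seq x n ℚ.- seq x N ∣ ℚ.+ ℚ.∣ seq x N ∣ <⟨ ℚₚ.+-mono-< (ℚₚ.<-trans (close n N N≤n ℕₚ.≤-refl) ¼ε<½ε) small ⟩
    ½ ℚ.* ε ℚ.+ ½ ℚ.* ε                         ≡⟨ ½+½ ε ⟩
    ε ∎)
    where
    ¼ε : ℚ
    ¼ε = ½ ℚ.* (½ ℚ.* ε)
    0<¼ε : 0ℚ ℚ.< ¼ε
    0<¼ε = ½-pos (½-pos 0<ε)
    ¼ε<½ε : ¼ε ℚ.< ½ ℚ.* ε
    ¼ε<½ε = ≡.subst₂ ℚ._<_ (ℚₚ.+-identityʳ ¼ε) (½+½ (½ ℚ.* ε)) (ℚₚ.+-monoʳ-< ¼ε 0<¼ε)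
    N : ℕ
    N = proj₁ (cauchy x ¼ε 0<¼ε)
    close : ∀ m n → N ℕ.≤ m → N ℕ.≤ n → ℚ.∣ seq x m ℚ.- seq x n ∣ ℚ.< ¼ε
    close = proj₂ (cauchy x ¼ε 0<¼ε)
    below : seq x N ℚ.< ½ ℚ.* ε
    below = ℚₚ.≰⇒> λ h → ¬pos (¼ε , 0<¼ε , N , λ n N≤n → quarter-≤ ε (seq x N) (seq x n) h (close N n ℕₚ.≤-refl N≤n))
    above : ℚ.- seq x N ℚ.< ½ ℚ.* ε
    above = ℚₚ.≰⇒> λ h → ¬neg (¼ε , 0<¼ε , N , λ n N≤n → quarter-≤ ε (ℚ.- seq x N) (ℚ.- seq x n) h
      (≡.subst (ℚ._< ¼ε) (≡.trans (≡.sym (ℚₚ.∣-p∣≡∣p∣ (seq x N ℚ.- seq x n)))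
        (≡.cong ℚ.∣_∣ (solve 2 (λ a b → :- (a :- b) := (:- a) :- (:- b)) ≡.refl (seq x N) (seq x n))))
        (close N n ℕₚ.≤-refl N≤n)))
    small : ℚ.∣ seq x N ∣ ℚ.< ½ ℚ.* ε
    small = ∣p∣<ε below above

ℝ-orderedRing : OrderedRing
ℝ-orderedRing = record
  { integerAlgebra = ℝ-algebra
  ; Pos          = Positive
  ; Pos-cong     = λ {x} {y} → Positive-cong {x} {y}
  ; Pos-+        = λ {x} {y} → Positive-+ {x} {y}
  ; Pos-*        = λ {x} {y} → Positive-* {x} {y}
  ; Pos-1        = Positive-1
  ; ¬Pos-0       = ¬Positive-0
  ; Pos-cancel   = λ {x} {w} → Positive-cancel {x} {w}
  ; zero-cancel  = λ {x} {w} → ≈0-cancel {x} {w}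
  ; Pos-+-*-self = λ {x} → Positive-+-*-self {x}
  ; tight        = λ {x} → ≈0-tight {x}
  }

-- Roots of real functions

ℤ→ℚ-mono-≤ : ∀ m n → m ℤ.≤ n → ℤ→ℚ m ℚ.≤ ℤ→ℚ n
ℤ→ℚ-mono-≤ m n h = ℚₚ.toℚᵘ-cancel-≤ (ℚᵘₚ.≤-respˡ-≃ (ℚᵘₚ.≃-sym (toℚᵘ-ℤ→ℚ m))
  (ℚᵘₚ.≤-respʳ-≃ (ℚᵘₚ.≃-sym (toℚᵘ-ℤ→ℚ n)) (ℚᵘ.*≤* (ℤₚ.*-monoʳ-≤-nonNeg (+ 1) h))))

archimedean : ∀ q → ∃[ n ] q ℚ.≤ ℤ→ℚ (+ n)
archimedean q@record{} = ℤ.∣ ℚ.numerator q ∣ , ℚₚ.toℚᵘ-cancel-≤ (ℚᵘₚ.≤-respʳ-≃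
  (ℚᵘₚ.≃-sym (toℚᵘ-ℤ→ℚ (+ ℤ.∣ ℚ.numerator q ∣))) (ℚᵘ.*≤* (begin
    ℚ.numerator q ℤ.* + 1              ≡⟨ ℤₚ.*-identityʳ (ℚ.numerator q) ⟩
    ℚ.numerator q                      ≤⟨ i≤∣i∣ (ℚ.numerator q) ⟩
    + ℤ.∣ ℚ.numerator q ∣               ≤⟨ ℤ.+≤+ (ℕₚ.m≤m*n ℤ.∣ ℚ.numerator q ∣ (ℚ.denominatorℕ q)) ⟩
    + (ℤ.∣ ℚ.numerator q ∣ ℕ.* ℚ.denominatorℕ q) ≡⟨ ℤₚ.pos-* ℤ.∣ ℚ.numerator q ∣ (ℚ.denominatorℕ q) ⟩
    + ℤ.∣ ℚ.numerator q ∣ ℤ.* ℚ.denominator q ∎)))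
  where
  open ℤₚ.≤-Reasoning
  i≤∣i∣ : ∀ i → i ℤ.≤ + ℤ.∣ i ∣
  i≤∣i∣ (+ n)    = ℤₚ.≤-refl
  i≤∣i∣ -[1+ n ] = ℤ.-≤+

module Bisection (f : ℚ → ℚ) where
  open Data.Rational.Solver.+-*-Solver

  -- The end points are rational because the sign of a rational value can be decided.
  record Bracket : Set where
    field
      lo hi : ℚ
      lo≤hi : lo ℚ.≤ hi
      f-lo  : f lo ℚ.≤ 0ℚ
      f-hi  : 0ℚ ℚ.≤ f hi

    mid width : ℚ
    mid   = ½ ℚ.* (lo ℚ.+ hi)
    width = hi ℚ.- lo

    lo≤mid : lo ℚ.≤ mid
    lo≤mid = ≡.subst (ℚ._≤ mid) (½+½′ lo) (ℚₚ.*-monoˡ-≤-nonNeg ½ (ℚₚ.+-monoʳ-≤ lo lo≤hi))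
      where
      ½+½′ : ∀ q → ½ ℚ.* (q ℚ.+ q) ≡ q
      ½+½′ q = ≡.trans (ℚₚ.*-distribˡ-+ ½ q q) (½+½ q)

    mid≤hi : mid ℚ.≤ hi
    mid≤hi = ≡.subst (mid ℚ.≤_) (½+½′ hi) (ℚₚ.*-monoˡ-≤-nonNeg ½ (ℚₚ.+-monoˡ-≤ hi lo≤hi))
      where
      ½+½′ : ∀ q → ½ ℚ.* (q ℚ.+ q) ≡ q
      ½+½′ q = ≡.trans (ℚₚ.*-distribˡ-+ ½ q q) (½+½ q)

    0≤width : 0ℚ ℚ.≤ width
    0≤width = p≤q⇒0≤q-p lo≤hi

  open Bracket

  record Halves (B C : Bracket) : Set where
    field
      lo-mono : lo B ℚ.≤ lo C
      hi-mono : hi C ℚ.≤ hi B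
      halved  : width C ≡ ½ ℚ.* width B

  halve : (B : Bracket) → ∃ (Halves B)
  halve B with ℚₚ.≤-total (f (mid B)) 0ℚ
  ... | inj₁ f≤0 = record { lo = mid B ; hi = hi B ; lo≤hi = mid≤hi B ; f-lo = f≤0 ; f-hi = f-hi B } ,
    record { lo-mono = lo≤mid B ; hi-mono = ℚₚ.≤-refl
           ; halved  = solve 2 (λ a b → b :- con ½ :* (a :+ b) := con ½ :* (b :- a)) ≡.refl (lo B) (hi B) }
  ... | inj₂ 0≤f = record { lo = lo B ; hi = mid B ; lo≤hi = lo≤mid B ; f-lo = f-lo B ; f-hi = 0≤f } ,
    record { lo-mono = ℚₚ.≤-refl ; hi-mono = mid≤hi B
           ; halved  = solve 2 (λ a b → con ½ :* (a :+ b) :- a := con ½ :* (b :- a)) ≡.refl (lo B) (hi B) }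

  module Iterate (B₀ : Bracket) where
    bracket : ℕ → Bracket
    bracket zero    = B₀
    bracket (suc n) = proj₁ (halve (bracket n))

    nested-lo : ∀ {m n} → m ℕ.≤′ n → lo (bracket m) ℚ.≤ lo (bracket n)
    nested-lo ℕ.≤′-refl            = ℚₚ.≤-refl
    nested-lo (ℕ.≤′-step {n} m≤n) = ℚₚ.≤-trans (nested-lo m≤n) (Halves.lo-mono (proj₂ (halve (bracket n))))

    nested-hi : ∀ {m n} → m ℕ.≤′ n → hi (bracket n) ℚ.≤ hi (bracket m)
    nested-hi ℕ.≤′-refl            = ℚₚ.≤-refl
    nested-hi (ℕ.≤′-step {n} m≤n) = ℚₚ.≤-trans (Halves.hi-mono (proj₂ (halve (bracket n)))) (nested-hi m≤n)

    -- The widths decrease like powers of ½, but this linear estimate is enough for the Archimedean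
    -- property and avoids powers.
    width-bound : ∀ n → ℤ→ℚ (+ suc n) ℚ.* width (bracket n) ℚ.≤ width B₀
    width-bound zero    = ℚₚ.≤-reflexive (ℚₚ.*-identityˡ (width B₀))
    width-bound (suc n) = begin
      ℤ→ℚ (+ suc (suc n)) ℚ.* width (bracket (suc n))
        ≡⟨ ≡.cong₂ ℚ._*_ (ℤ→ℚ-+ (+ 2) (+ n)) (Halves.halved (proj₂ (halve (bracket n)))) ⟩
      (ℤ→ℚ (+ 2) ℚ.+ c) ℚ.* (½ ℚ.* w)
        ≡⟨ solve 2 (λ c w → (con (ℤ→ℚ (+ 2)) :+ c) :* (con ½ :* w) := (con 1ℚ :+ c) :* w :+ :- (con ½ :* (c :* w))) ≡.refl c w ⟩
      (1ℚ ℚ.+ c) ℚ.* w ℚ.+ ℚ.- (½ ℚ.* (c ℚ.* w))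
        ≤⟨ ℚₚ.+-monoʳ-≤ ((1ℚ ℚ.+ c) ℚ.* w) (ℚₚ.neg-antimono-≤ 0≤½cw) ⟩
      (1ℚ ℚ.+ c) ℚ.* w ℚ.+ 0ℚ
        ≡⟨ ≡.trans (ℚₚ.+-identityʳ _) (≡.cong (ℚ._* w) (≡.sym (ℤ→ℚ-+ (+ 1) (+ n)))) ⟩
      ℤ→ℚ (+ suc n) ℚ.* w
        ≤⟨ width-bound n ⟩
      width B₀ ∎
      where
      open ℚₚ.≤-Reasoning
      c w : ℚ
      c = ℤ→ℚ (+ n)
      w = width (bracket n)
      *-nonNeg : ∀ {p q} → 0ℚ ℚ.≤ p → 0ℚ ℚ.≤ q → 0ℚ ℚ.≤ p ℚ.* q
      *-nonNeg {p} {q} 0≤p 0≤q = ≡.subst (ℚ._≤ p ℚ.* q) (ℚₚ.*-zeroʳ p) (ℚₚ.*-monoˡ-≤-nonNeg p {{ℚ.nonNegative 0≤p}} 0≤q)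
      0≤½cw : 0ℚ ℚ.≤ ½ ℚ.* (c ℚ.* w)
      0≤½cw = *-nonNeg (ℚₚ.<⇒≤ (ℚₚ.positive⁻¹ ½)) (*-nonNeg (ℤ→ℚ-mono-≤ 0ℤ (+ n) (ℤ.+≤+ z≤n)) (0≤width (bracket n)))

    vanishing : ∀ ε → 0ℚ ℚ.< ε → ∃[ n ] width (bracket n) ℚ.< ε
    vanishing ε 0<ε with quotient 0<ε (ℚₚ.+-mono-<-≤ (ℚₚ.positive⁻¹ 1ℚ) (0≤width B₀))
    ... | r , _ , εr≡1+W with archimedean r
    ... | n , r≤n = n , ℚₚ.*-cancelˡ-<-nonNeg c {{ℚ.nonNegative 0≤c}} (begin-strict
        c ℚ.* width (bracket n) ≤⟨ width-bound n ⟩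
        width B₀                ≡⟨ ℚₚ.+-identityˡ (width B₀) ⟨
        0ℚ ℚ.+ width B₀         <⟨ ℚₚ.+-monoˡ-< (width B₀) (ℚₚ.positive⁻¹ 1ℚ) ⟩
        1ℚ ℚ.+ width B₀         ≡⟨ εr≡1+W ⟨
        ε ℚ.* r                 ≤⟨ ℚₚ.*-monoˡ-≤-nonNeg ε {{ℚ.nonNegative (ℚₚ.<⇒≤ 0<ε)}} (ℚₚ.≤-trans r≤n n≤c) ⟩
        ε ℚ.* c                 ≡⟨ ℚₚ.*-comm ε c ⟩
        c ℚ.* ε                 ∎)
      where
      open ℚₚ.≤-Reasoning
      c : ℚ
      c = ℤ→ℚ (+ suc n)
      n≤c : ℤ→ℚ (+ n) ℚ.≤ c
      n≤c = ℤ→ℚ-mono-≤ (+ n) (+ suc n) (ℤ.+≤+ (ℕₚ.n≤1+n n))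
      0≤c : 0ℚ ℚ.≤ c
      0≤c = ℤ→ℚ-mono-≤ 0ℤ (+ suc n) (ℤ.+≤+ z≤n)

    close : ∀ {N a b} → lo (bracket N) ℚ.≤ a → a ℚ.≤ hi (bracket N) → lo (bracket N) ℚ.≤ b → b ℚ.≤ hi (bracket N) →
      ∀ {ε} → width (bracket N) ℚ.< ε → ℚ.∣ a ℚ.- b ∣ ℚ.< ε
    close {N} {a} {b} lo≤a a≤hi lo≤b b≤hi {ε} w<ε = ∣p∣<ε
      (ℚₚ.≤-<-trans (ℚₚ.+-mono-≤ a≤hi (ℚₚ.neg-antimono-≤ lo≤b)) w<ε)
      (≡.subst (ℚ._< ε) (solve 2 (λ a b → b :- a := :- (a :- b)) ≡.refl a b)
        (ℚₚ.≤-<-trans (ℚₚ.+-mono-≤ b≤hi (ℚₚ.neg-antimono-≤ lo≤a)) w<ε))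

    lo≤hi′ : ∀ {N n} → N ℕ.≤ n → lo (bracket n) ℚ.≤ hi (bracket N)
    lo≤hi′ {N} {n} h = ℚₚ.≤-trans (lo≤hi (bracket n)) (nested-hi (ℕₚ.≤⇒≤′ h))

    lo≤hi″ : ∀ {N n} → N ℕ.≤ n → lo (bracket N) ℚ.≤ hi (bracket n)
    lo≤hi″ {N} {n} h = ℚₚ.≤-trans (nested-lo (ℕₚ.≤⇒≤′ h)) (lo≤hi (bracket n))

    lower upper : ℝ
    lower = mkℝ (λ n → lo (bracket n)) λ ε 0<ε → let N , w<ε = vanishing ε 0<ε in
      N , λ m n N≤m N≤n → close {N} (nested-lo (ℕₚ.≤⇒≤′ N≤m)) (lo≤hi′ N≤m) (nested-lo (ℕₚ.≤⇒≤′ N≤n)) (lo≤hi′ N≤n) w<ε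
    upper = mkℝ (λ n → hi (bracket n)) λ ε 0<ε → let N , w<ε = vanishing ε 0<ε in
      N , λ m n N≤m N≤n → close {N} (lo≤hi″ N≤m) (nested-hi (ℕₚ.≤⇒≤′ N≤m)) (lo≤hi″ N≤n) (nested-hi (ℕₚ.≤⇒≤′ N≤n)) w<ε

    lower≈upper : lower ≈ upper
    lower≈upper ε 0<ε = let N , w<ε = vanishing ε 0<ε in
      N , λ n N≤n → close {N} (nested-lo (ℕₚ.≤⇒≤′ N≤n)) (lo≤hi′ N≤n) (lo≤hi″ N≤n) (nested-hi (ℕₚ.≤⇒≤′ N≤n)) w<ε

    bounds : ∀ n → lo B₀ ℚ.≤ seq lower n × seq lower n ℚ.≤ hi B₀
    bounds n = nested-lo {0} {n} (ℕₚ.≤⇒≤′ z≤n) , lo≤hi′ {0} {n} z≤n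

-- The common limit x of the end points satisfies F x ≈ 0, because the values of F
-- at the two end points have opposite signs and a vanishing difference.
intermediate-zero : (F : ℝ → ℝ) → (∀ {x y} → x ≈ y → F x ≈ F y) →
  (∀ x n → seq (F x) n ≡ seq (F (fromℚ (seq x n))) 0) →
  ∀ a b → a ℚ.≤ b → seq (F (fromℚ a)) 0 ℚ.≤ 0ℚ → 0ℚ ℚ.≤ seq (F (fromℚ b)) 0 →
  ∃[ x ] (F x ≈ 0ℝ × ∀ n → a ℚ.≤ seq x n × seq x n ℚ.≤ b)
intermediate-zero F F-cong pointwise a b a≤b Fa≤0 0≤Fb = lower , F≈0 , bounds
  where
  -- By `pointwise`, F acts on each term of a sequence through `f`, so the signs at the end points
  -- of the brackets are signs of F at every index.
  f : ℚ → ℚ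
  f q = seq (F (fromℚ q)) 0
  open Bisection f
  B₀ : Bracket
  B₀ = record { lo = a ; hi = b ; lo≤hi = a≤b ; f-lo = Fa≤0 ; f-hi = 0≤Fb }
  open Iterate B₀
  squeeze : ∀ {p q ε} → 0ℚ ℚ.< ε → p ℚ.≤ 0ℚ → 0ℚ ℚ.≤ q → ℚ.∣ p ℚ.- q ∣ ℚ.< ε → ℚ.∣ p ℚ.- 0ℚ ∣ ℚ.< ε
  squeeze {p} {q} {ε} 0<ε p≤0 0≤q h = ≡.subst (λ q → ℚ.∣ q ∣ ℚ.< ε) (≡.sym (ℚₚ.+-identityʳ p))
    (∣p∣<ε (ℚₚ.≤-<-trans p≤0 0<ε) (begin-strict
      ℚ.- p           ≡⟨ ℚₚ.+-identityˡ (ℚ.- p) ⟨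
      0ℚ ℚ.+ ℚ.- p    ≤⟨ ℚₚ.+-monoˡ-≤ (ℚ.- p) 0≤q ⟩
      q ℚ.- p         ≡⟨ solve 2 (λ p q → q :- p := :- (p :- q)) ≡.refl p q ⟩
      ℚ.- (p ℚ.- q)   ≤⟨ -p≤∣p∣ (p ℚ.- q) ⟩
      ℚ.∣ p ℚ.- q ∣   <⟨ h ⟩
      ε               ∎))
    where
    open ℚₚ.≤-Reasoning
    open Data.Rational.Solver.+-*-Solver
  conclude : ∀ {x y : ℝ} → F x ≈ F y → (∀ n → seq (F x) n ℚ.≤ 0ℚ) → (∀ n → 0ℚ ℚ.≤ seq (F y) n) → F x ≈ 0ℝ
  conclude h Fx≤0 0≤Fy ε 0<ε = let N , close = h ε 0<ε in
    N , λ n N≤n → squeeze 0<ε (Fx≤0 n) (0≤Fy n) (close n N≤n)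
  F≈0 : F lower ≈ 0ℝ
  F≈0 = conclude {lower} {upper} (F-cong {lower} {upper} lower≈upper)
    (λ n → ≡.subst (ℚ._≤ 0ℚ) (≡.sym (pointwise lower n)) (Bracket.f-lo (bracket n)))
    (λ n → ≡.subst (0ℚ ℚ.≤_) (≡.sym (pointwise upper n)) (Bracket.f-hi (bracket n)))

¼ : ℚ
¼ = ½ ℚ.* ½

Positive⇒0≤ : ∀ x {q} → (∀ n → seq x n ≡ q) → Positive x → 0ℚ ℚ.≤ q
Positive⇒0≤ x {q} const (ε , 0<ε , N , p) = ≡.subst (0ℚ ℚ.≤_) (const N) (ℚₚ.≤-trans (ℚₚ.<⇒≤ 0<ε) (p N ℕₚ.≤-refl))

neg-involutive : ∀ q → ℚ.- (ℚ.- q) ≡ q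
neg-involutive = solve 1 (λ q → :- (:- q) := q) ≡.refl
  where open Data.Rational.Solver.+-*-Solver

Positive-neg⇒≤0 : ∀ x {q} → (∀ n → seq x n ≡ q) → Positive (- x) → q ℚ.≤ 0ℚ
Positive-neg⇒≤0 x {q} const p = ≡.subst (ℚ._≤ 0ℚ) (neg-involutive q)
  (ℚₚ.neg-antimono-≤ (Positive⇒0≤ (- x) (λ n → ≡.cong ℚ.-_ (const n)) p))

Positive-mono : ∀ {x y} → (∀ n → seq x n ℚ.≤ seq y n) → Positive x → Positive y
Positive-mono h (ε , 0<ε , N , p) = ε , 0<ε , N , λ n N≤n → ℚₚ.≤-trans (p n N≤n) (h n)

module RealRoots (m : ℕ) where
  open SalemPolynomial ℝ-algebra
  open SalemRoot ℝ-orderedRing m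
  open Conjugates ℝ-orderedRing m
  open Signs ℝ-orderedRing m

  private
    6κ 6κ+1 : ℝ
    6κ   = fromℤ (+ 6) * κ
    6κ+1 = fromℤ (+ 6) * κ + fromℤ (+ 1)

  salemRoot : ∃ IsSalemRoot
  salemRoot =
    let
      β , root , bounds = intermediate-zero (salem κ) (λ {x} {y} → salem-cong κ {x} {y}) (λ _ _ → ≡.refl)
        (seq 6κ 0) (seq 6κ+1 0) 6κ≤6κ+1
        (Positive-neg⇒≤0 (salem κ 6κ) (λ _ → ≡.refl) salem-neg-at-6κ)
        (Positive⇒0≤ (salem κ 6κ+1) (λ _ → ≡.refl) salem-pos-at-6κ+1)
    in β , record
      { >1   = Positive-mono {6κ - 1ℝ} {β - 1ℝ} (λ n → ℚₚ.+-monoˡ-≤ (ℚ.- 1ℚ) (proj₁ (bounds n))) Pos-6κ-1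
      ; root = root
      }
    where
    6κ≤6κ+1 : seq 6κ 0 ℚ.≤ seq 6κ+1 0
    6κ≤6κ+1 = ≡.subst (ℚ._≤ seq 6κ+1 0) (ℚₚ.+-identityʳ (seq 6κ 0)) (ℚₚ.+-monoʳ-≤ (seq 6κ 0) (ℚₚ.<⇒≤ (ℚₚ.positive⁻¹ 1ℚ)))

  private
    circle : ℝ → ℝ
    circle t = circlePolynomial κ (fromℤ (+ 1) + t * t)

    circle-cong : ∀ {s t} → s ≈ t → circle s ≈ circle t
    circle-cong {s} {t} h = circlePolynomial-cong {fromℤ (+ 1) + s * s} {fromℤ (+ 1) + t * t}
      (+-cong {fromℤ (+ 1)} {fromℤ (+ 1)} {s * s} {t * t} (pointwise {fromℤ (+ 1)} {fromℤ (+ 1)} λ _ → ≡.refl) (*-cong {s} {t} {s} {t} h h))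

    4* : ∀ q e → ℤ→ℚ (+ 4) ℚ.* q ≡ ℤ→ℚ e → fromℤ (+ 4) * fromℚ q ≈ fromℤ e
    4* q e h = pointwise {fromℤ (+ 4) * fromℚ q} {fromℤ e} λ _ → h

  circleRoot₂ : ∃[ t ] (circle t ≈ 0ℝ × ∀ n → 0ℚ ℚ.≤ seq t n × seq t n ℚ.≤ ¼)
  circleRoot₂ = intermediate-zero circle (λ {x} {y} → circle-cong {x} {y}) (λ _ _ → ≡.refl)
    0ℚ ¼ (from-yes (0ℚ ℚ.≤? ¼))
    (Positive-neg⇒≤0 (circle (fromℚ 0ℚ)) (λ _ → ≡.refl) (circle-neg-at-0 {fromℚ 0ℚ} (4* 0ℚ (+ 0) ≡.refl)))
    (Positive⇒0≤ (circle (fromℚ ¼)) (λ _ → ≡.refl) (circle-pos-at-¼ {fromℚ ¼} (4* ¼ (+ 1) ≡.refl)))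

  -- On this interval the sign goes from + to -, so the bisection is applied to the negative of the
  -- circle polynomial.
  circleRoot₁ : ∃[ t ] (circle t ≈ 0ℝ × ∀ n → ½ ℚ.≤ seq t n × seq t n ℚ.≤ 1ℚ)
  circleRoot₁ = conclude (intermediate-zero (λ t → - circle t)
    (λ {x} {y} h → -‿cong {circle x} {circle y} (circle-cong {x} {y} h)) (λ _ _ → ≡.refl)
    ½ 1ℚ (from-yes (½ ℚ.≤? 1ℚ))
    (Positive-neg⇒≤0 (- circle (fromℚ ½)) (λ _ → ≡.refl)
      (Positive-cong {circle (fromℚ ½)} { - (- circle (fromℚ ½))} (-‿involutive (circle (fromℚ ½)))
        (circle-pos-at-½ {fromℚ ½} (4* ½ (+ 2) ≡.refl))))
    (Positive⇒0≤ (- circle (fromℚ 1ℚ)) (λ _ → ≡.refl) (circle-neg-at-1 {fromℚ 1ℚ} (4* 1ℚ (+ 4) ≡.refl))))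
    where
    -‿involutive : ∀ x → x ≈ - (- x)
    -‿involutive x = pointwise {x} { - (- x)} λ n → ≡.sym (neg-involutive (seq x n))
    conclude : ∃[ t ] (- circle t ≈ 0ℝ × ∀ n → ½ ℚ.≤ seq t n × seq t n ℚ.≤ 1ℚ) →
      ∃[ t ] (circle t ≈ 0ℝ × ∀ n → ½ ℚ.≤ seq t n × seq t n ℚ.≤ 1ℚ)
    conclude (t , h , bounds) = t , ≈-trans {circle t} { - (- circle t)} {0ℝ} (-‿involutive (circle t))
      (≈-trans { - (- circle t)} { - 0ℝ} {0ℝ} (-‿cong { - circle t} {0ℝ} h) (pointwise { - 0ℝ} {0ℝ} λ _ → ≡.refl)) , bounds

  τ₁ τ₂ : ℝ
  τ₁ = proj₁ circleRoot₁
  τ₂ = proj₁ circleRoot₂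

  τ₁²>τ₂² : Positive (τ₁ * τ₁ - τ₂ * τ₂)
  τ₁²>τ₂² = ½ ℚ.* ½ ℚ.- ¼ ℚ.* ¼ , ℚₚ.positive⁻¹ (½ ℚ.* ½ ℚ.- ¼ ℚ.* ¼) , 0 , λ n _ →
    ℚₚ.+-mono-≤ (square-mono (ℚₚ.<⇒≤ (ℚₚ.positive⁻¹ ½)) (proj₁ (proj₂ (proj₂ circleRoot₁) n)))
      (ℚₚ.neg-antimono-≤ (square-mono (proj₁ (proj₂ (proj₂ circleRoot₂) n)) (proj₂ (proj₂ (proj₂ circleRoot₂) n))))
    where
    square-mono : ∀ {p q} → 0ℚ ℚ.≤ p → p ℚ.≤ q → p ℚ.* p ℚ.≤ q ℚ.* q
    square-mono {p} {q} 0≤p p≤q = ℚₚ.≤-trans (ℚₚ.*-monoˡ-≤-nonNeg p {{ℚ.nonNegative 0≤p}} p≤q)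
      (ℚₚ.*-monoʳ-≤-nonNeg q {{ℚ.nonNegative (ℚₚ.≤-trans 0≤p p≤q)}} p≤q)

  private
    1/64 : ℝ
    1/64 = fromℚ (¼ ℚ.* ¼ ℚ.* ¼)

    64*1/64≈1 : fromℤ (+ 64) * 1/64 ≈ fromℤ (+ 1)
    64*1/64≈1 = pointwise {fromℤ (+ 64) * 1/64} {fromℤ (+ 1)} λ _ → ≡.refl

  module C₁ = CircleRoot {1/64} 64*1/64≈1 τ₁ (proj₁ (proj₂ circleRoot₁))
  module C₂ = CircleRoot {1/64} 64*1/64≈1 τ₂ (proj₁ (proj₂ circleRoot₂))

  unit₁ : UnitRoot C₁.y
  unit₁ = record { c = C₁.c ; w = C₁.w ; y≈2c = C₁.y≈2c ; c²+w²≈1 = C₁.c²+w²≈1 ; w≉0 = C₁.w≉0 }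

  unit₂ : UnitRoot C₂.y
  unit₂ = record { c = C₂.c ; w = C₂.w ; y≈2c = C₂.y≈2c ; c²+w²≈1 = C₂.c²+w²≈1 ; w≉0 = C₂.w≉0 }

  allTraceRoots : ∀ {β} (isRoot : IsSalemRoot β) → TraceRoots κ C₁.y C₂.y (IsSalemRoot.y isRoot)
  allTraceRoots isRoot = traceRoots {C₁.y} {C₂.y} {y} C₁.trace≈0 C₂.trace≈0 trace≈0 (C₂.below {y} Pos-y-3) (C₁.below {y} Pos-y-3)
    (circleRoot-antitone {1/64} 64*1/64≈1 {τ₁} {τ₂} (proj₁ (proj₂ circleRoot₁)) (proj₁ (proj₂ circleRoot₂)) τ₁²>τ₂²)
    where open IsSalemRoot isRoot

-- The minimal polynomial

-- Evaluation over ℝ acts term by term, so polynomial identities over ℝ reduce to identities at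
-- rational points.
horner : ∀ {n} → Vec ℚ n → ℚ → ℚ
horner []       x = 0ℚ
horner (c ∷ cs) x = c ℚ.+ x ℚ.* horner cs x

seq-evalℝ : ∀ {n} (v : Vec ℚ n) x i → seq (evalℝ v x) i ≡ horner v (seq x i)
seq-evalℝ []      x i = ≡.refl
seq-evalℝ (c ∷ v) x i = ≡.cong (λ q → c ℚ.+ seq x i ℚ.* q) (seq-evalℝ v x i)

evalℝ-pointwise : ∀ {m n} (v : Vec ℚ m) (w : Vec ℚ n) x → (∀ q → horner v q ≡ horner w q) → evalℝ v x ≈ evalℝ w x
evalℝ-pointwise v w x h = pointwise {evalℝ v x} {evalℝ w x} λ i →
  ≡.trans (seq-evalℝ v x i) (≡.trans (h (seq x i)) (≡.sym (seq-evalℝ w x i)))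

horner-replicate-0 : ∀ n q → horner (Vec.replicate n 0ℚ) q ≡ 0ℚ
horner-replicate-0 zero    q = ≡.refl
horner-replicate-0 (suc n) q = ≡.trans (ℚₚ.+-identityˡ _)
  (≡.trans (≡.cong (q ℚ.*_) (horner-replicate-0 n q)) (ℚₚ.*-zeroʳ q))

horner-padRight : ∀ {m n} (m≤n : m ℕ.≤ n) (v : Vec ℚ m) q → horner (Vec.padRight m≤n 0ℚ v) q ≡ horner v q
horner-padRight {n = n} z≤n []      q = horner-replicate-0 n q
horner-padRight (s≤s m≤n)   (c ∷ v) q = ≡.cong (λ e → c ℚ.+ q ℚ.* e) (horner-padRight m≤n v q)

horner-scale : ∀ {n} c (v : Vec ℚ n) q → horner (Vec.map (c ℚ.*_) v) q ≡ c ℚ.* horner v q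
horner-scale c []      q = ≡.sym (ℚₚ.*-zeroʳ c)
horner-scale c (a ∷ v) q = ≡.trans (≡.cong (λ e → c ℚ.* a ℚ.+ q ℚ.* e) (horner-scale c v q))
  (solve 4 (λ a c q e → c :* a :+ q :* (c :* e) := c :* (a :+ q :* e)) ≡.refl a c q (horner v q))
  where open Data.Rational.Solver.+-*-Solver

horner-minus : ∀ {n} (v w : Vec ℚ n) q → horner (Vec.zipWith ℚ._-_ v w) q ≡ horner v q ℚ.- horner w q
horner-minus []      []      q = ≡.refl
horner-minus (a ∷ v) (b ∷ w) q = ≡.trans (≡.cong (λ e → a ℚ.- b ℚ.+ q ℚ.* e) (horner-minus v w q))
  (solve 5 (λ a b q e f → a :- b :+ q :* (e :- f) := (a :+ q :* e) :- (b :+ q :* f)) ≡.refl a b q (horner v q) (horner w q))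
  where open Data.Rational.Solver.+-*-Solver

denominator-* : ∀ q → ℤ→ℚ (ℚ.denominator q) ℚ.* q ≡ ℤ→ℚ (ℚ.numerator q)
denominator-* q@record{} = ℚₚ.toℚᵘ-injective (ℚᵘₚ.≃-trans (ℚₚ.toℚᵘ-homo-* (ℤ→ℚ (ℚ.denominator q)) q)
  (ℚᵘₚ.≃-trans (ℚᵘₚ.*-congʳ (toℚᵘ-ℤ→ℚ (ℚ.denominator q))) (ℚᵘₚ.≃-trans
    (ℚᵘ.*≡* (≡.trans (ℤₚ.*-identityʳ (ℚ.denominator q ℤ.* ℚ.numerator q))
      (≡.trans (ℤₚ.*-comm (ℚ.denominator q) (ℚ.numerator q))
        (≡.cong (λ d → ℚ.numerator q ℤ.* + suc d) (≡.sym (ℕₚ.+-identityʳ _))))))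
    (ℚᵘₚ.≃-sym (toℚᵘ-ℤ→ℚ (ℚ.numerator q))))))

clear-denominators : ∀ {n} (v : Vec ℚ n) →
  ∃₂ λ d (w : Vec ℤ n) → Vec.map ℤ→ℚ w ≡ Vec.map (ℤ→ℚ (+ suc d) ℚ.*_) v
clear-denominators []      = 0 , [] , ≡.refl
clear-denominators (q@(ℚ.mkℚ n e _) ∷ v) with clear-denominators v
-- The successor of this number is the product of the denominators `suc e` and `suc d`.
... | d , w , eq = d ℕ.+ e ℕ.* suc d , (+ suc d ℤ.* n) ∷ Vec.map (+ suc e ℤ.*_) w ,
  ≡.cong₂ _∷_ head (tail v w eq)
  where
  split : ℤ→ℚ (+ suc (d ℕ.+ e ℕ.* suc d)) ≡ ℤ→ℚ (+ suc e) ℚ.* ℤ→ℚ (+ suc d)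
  split = ≡.trans (≡.cong ℤ→ℚ (ℤₚ.pos-* (suc e) (suc d))) (ℤ→ℚ-* (+ suc e) (+ suc d))

  head : ℤ→ℚ (+ suc d ℤ.* n) ≡ ℤ→ℚ (+ suc (d ℕ.+ e ℕ.* suc d)) ℚ.* q
  head = begin
    ℤ→ℚ (+ suc d ℤ.* n)                        ≡⟨ ℤ→ℚ-* (+ suc d) n ⟩
    ℤ→ℚ (+ suc d) ℚ.* ℤ→ℚ n                    ≡⟨ ≡.cong (ℤ→ℚ (+ suc d) ℚ.*_) (denominator-* q) ⟨
    ℤ→ℚ (+ suc d) ℚ.* (ℤ→ℚ (+ suc e) ℚ.* q)    ≡⟨ ℚₚ.*-assoc (ℤ→ℚ (+ suc d)) (ℤ→ℚ (+ suc e)) q ⟨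
    ℤ→ℚ (+ suc d) ℚ.* ℤ→ℚ (+ suc e) ℚ.* q      ≡⟨ ≡.cong (ℚ._* q) (≡.trans (ℚₚ.*-comm (ℤ→ℚ (+ suc d)) (ℤ→ℚ (+ suc e))) (≡.sym split)) ⟩
    ℤ→ℚ (+ suc (d ℕ.+ e ℕ.* suc d)) ℚ.* q      ∎
    where open ≡.≡-Reasoning

  tail : ∀ {n} (v : Vec ℚ n) (w : Vec ℤ n) → Vec.map ℤ→ℚ w ≡ Vec.map (ℤ→ℚ (+ suc d) ℚ.*_) v →
    Vec.map ℤ→ℚ (Vec.map (+ suc e ℤ.*_) w) ≡ Vec.map (ℤ→ℚ (+ suc (d ℕ.+ e ℕ.* suc d)) ℚ.*_) v
  tail []      []      _  = ≡.refl
  tail (r ∷ v) (c ∷ w) eq = ≡.cong₂ _∷_ (begin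
    ℤ→ℚ (+ suc e ℤ.* c)                        ≡⟨ ℤ→ℚ-* (+ suc e) c ⟩
    ℤ→ℚ (+ suc e) ℚ.* ℤ→ℚ c                    ≡⟨ ≡.cong (ℤ→ℚ (+ suc e) ℚ.*_) (≡.cong Vec.head eq) ⟩
    ℤ→ℚ (+ suc e) ℚ.* (ℤ→ℚ (+ suc d) ℚ.* r)    ≡⟨ ℚₚ.*-assoc (ℤ→ℚ (+ suc e)) (ℤ→ℚ (+ suc d)) r ⟨
    ℤ→ℚ (+ suc e) ℚ.* ℤ→ℚ (+ suc d) ℚ.* r      ≡⟨ ≡.cong (ℚ._* r) split ⟨
    ℤ→ℚ (+ suc (d ℕ.+ e ℕ.* suc d)) ℚ.* r      ∎) (tail v w (≡.cong Vec.tail eq))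
    where open ≡.≡-Reasoning

All-last : ∀ {n} {P : ℚ → Set} {v : Vec ℚ (suc n)} → Allᵛ P v → P (Vec.last v)
All-last {v = _ ∷ []}    (p ∷ [])     = p
All-last {v = _ ∷ _ ∷ _} (_ ∷ q ∷ ps) = All-last (q ∷ ps)

padRight-zero⁻¹ : ∀ {m n} (m≤n : m ℕ.≤ n) (w : Vec ℤ m) → Allᵛ (_≡ 0ℤ) (Vec.padRight m≤n 0ℤ w) → Allᵛ (_≡ 0ℤ) w
padRight-zero⁻¹ z≤n       []      _        = []
padRight-zero⁻¹ (s≤s m≤n) (a ∷ w) (p ∷ ps) = p ∷ padRight-zero⁻¹ m≤n w ps

map-padRight : ∀ {m n} (m≤n : m ℕ.≤ n) (w : Vec ℤ m) → Vec.map ℤ→ℚ (Vec.padRight m≤n 0ℤ w) ≡ Vec.padRight m≤n 0ℚ (Vec.map ℤ→ℚ w)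
map-padRight {n = zero} z≤n []  = ≡.refl
map-padRight {n = suc n} z≤n [] = ≡.cong (0ℚ ∷_) (map-padRight {n = n} z≤n [])
map-padRight (s≤s m≤n) (a ∷ w)  = ≡.cong (ℤ→ℚ a ∷_) (map-padRight m≤n w)

positive-*-zero : ∀ d {q} → ℤ→ℚ (+ suc d) ℚ.* q ≡ 0ℚ → q ≡ 0ℚ
positive-*-zero d {q} eq = ℚₚ.≤-antisym
  (ℚₚ.*-cancelˡ-≤-pos (ℤ→ℚ (+ suc d)) (ℚₚ.≤-reflexive (≡.trans eq (≡.sym (ℚₚ.*-zeroʳ (ℤ→ℚ (+ suc d)))))))
  (ℚₚ.*-cancelˡ-≤-pos (ℤ→ℚ (+ suc d)) (ℚₚ.≤-reflexive (≡.trans (ℚₚ.*-zeroʳ (ℤ→ℚ (+ suc d))) (≡.sym eq))))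
  where
  instance
    positive : ℚ.Positive (ℤ→ℚ (+ suc d))
    positive = ℚ.positive (ℚₚ.<-≤-trans (ℚₚ.positive⁻¹ 1ℚ) (ℤ→ℚ-mono-≤ (+ 1) (+ suc d) (ℤ.+≤+ (s≤s z≤n))))

differences-zero : ∀ {n} (v w : Vec ℚ n) → Allᵛ (_≡ 0ℚ) (Vec.zipWith ℚ._-_ v w) → v ≡ w
differences-zero []      []      []       = ≡.refl
differences-zero (a ∷ v) (b ∷ w) (p ∷ ps) = ≡.cong₂ _∷_
  (≡.trans (p≡[p-q]+q a b) (≡.trans (≡.cong (ℚ._+ b) p) (ℚₚ.+-identityˡ b))) (differences-zero v w ps)

unscale : ∀ {n} d (v : Vec ℚ n) (w : Vec ℤ n) → Vec.map ℤ→ℚ w ≡ Vec.map (ℤ→ℚ (+ suc d) ℚ.*_) v →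
  Allᵛ (_≡ 0ℤ) w → Allᵛ (_≡ 0ℚ) v
unscale d []      []      _  []       = []
unscale d (q ∷ v) (a ∷ w) eq (p ∷ ps) =
  positive-*-zero d (≡.trans (≡.sym (≡.cong Vec.head eq)) (≡.cong ℤ→ℚ p)) ∷ unscale d v w (≡.cong Vec.tail eq) ps

module MinimalPolynomial (m : ℕ) {β : ℝ} (isRoot : SalemRoot.IsSalemRoot ℝ-orderedRing m β) where
  open SalemPolynomial ℝ-algebra
  open SalemRoot ℝ-orderedRing m
  open LinearIndependence ℝ-orderedRing m

  private
    Pₖ : Poly ℚ 6
    Pₖ = P (suc (suc m))

  P-root : IsRealRoot Pₖ β
  P-root = ≈-trans {evalℝ Pₖ β} {salem κ β} {0ℝ} (salem-integral (suc (suc m)) β) (IsSalemRoot.root isRoot)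

  independence-ℤ : ∀ (w : Vec ℤ 6) → IsRealRoot (Vec.map ℤ→ℚ w) β → Allᵛ (_≡ 0ℤ) w
  independence-ℤ (c₀ ∷ c₁ ∷ c₂ ∷ c₃ ∷ c₄ ∷ c₅ ∷ []) h = linear-independence isRoot c₀ c₁ c₂ c₃ c₄ c₅
    (≈-trans {polynomial isRoot (fromℤ c₀) (fromℤ c₁) (fromℤ c₂) (fromℤ c₃) (fromℤ c₄) (fromℤ c₅)}
             {evalℝ (Vec.map ℤ→ℚ (c₀ ∷ c₁ ∷ c₂ ∷ c₃ ∷ c₄ ∷ c₅ ∷ [])) β} {0ℝ}
      (pointwise {polynomial isRoot (fromℤ c₀) (fromℤ c₁) (fromℤ c₂) (fromℤ c₃) (fromℤ c₄) (fromℤ c₅)}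
        {evalℝ (Vec.map ℤ→ℚ (c₀ ∷ c₁ ∷ c₂ ∷ c₃ ∷ c₄ ∷ c₅ ∷ [])) β}
        λ n → ≡.cong (λ e → ℤ→ℚ c₀ ℚ.+ seq β n ℚ.* (ℤ→ℚ c₁ ℚ.+ seq β n ℚ.* (ℤ→ℚ c₂ ℚ.+ seq β n ℚ.* (ℤ→ℚ c₃
          ℚ.+ seq β n ℚ.* (ℤ→ℚ c₄ ℚ.+ seq β n ℚ.* e)))))
          (≡.sym (≡.trans (≡.cong (ℤ→ℚ c₅ ℚ.+_) (ℚₚ.*-zeroʳ (seq β n))) (ℚₚ.+-identityʳ (ℤ→ℚ c₅)))))
      h)

  -- Clearing denominators and padding with zeros leads to an integer relation between 1, β, ...,
  -- β⁵.
  independence : ∀ {n} → n ℕ.≤ 6 → (v : Vec ℚ n) → IsRealRoot v β → Allᵛ (_≡ 0ℚ) v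
  independence n≤6 v root with clear-denominators v
  ... | d , w , eq = unscale d v w eq (padRight-zero⁻¹ n≤6 w (independence-ℤ (Vec.padRight n≤6 0ℤ w)
    (≈-trans {evalℝ (Vec.map ℤ→ℚ (Vec.padRight n≤6 0ℤ w)) β} {fromℚ (ℤ→ℚ (+ suc d)) * evalℝ v β} {0ℝ}
      (pointwise {evalℝ (Vec.map ℤ→ℚ (Vec.padRight n≤6 0ℤ w)) β} {fromℚ (ℤ→ℚ (+ suc d)) * evalℝ v β} λ i → begin
        seq (evalℝ (Vec.map ℤ→ℚ (Vec.padRight n≤6 0ℤ w)) β) i ≡⟨ seq-evalℝ (Vec.map ℤ→ℚ (Vec.padRight n≤6 0ℤ w)) β i ⟩
        horner (Vec.map ℤ→ℚ (Vec.padRight n≤6 0ℤ w)) (seq β i) ≡⟨ ≡.cong (λ u → horner u (seq β i)) (map-padRight n≤6 w) ⟩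
        horner (Vec.padRight n≤6 0ℚ (Vec.map ℤ→ℚ w)) (seq β i) ≡⟨ horner-padRight n≤6 (Vec.map ℤ→ℚ w) (seq β i) ⟩
        horner (Vec.map ℤ→ℚ w) (seq β i)                       ≡⟨ ≡.cong (λ u → horner u (seq β i)) eq ⟩
        horner (Vec.map (ℤ→ℚ (+ suc d) ℚ.*_) v) (seq β i)      ≡⟨ horner-scale (ℤ→ℚ (+ suc d)) v (seq β i) ⟩
        ℤ→ℚ (+ suc d) ℚ.* horner v (seq β i)                   ≡⟨ ≡.cong (ℤ→ℚ (+ suc d) ℚ.*_) (seq-evalℝ v β i) ⟨
        ℤ→ℚ (+ suc d) ℚ.* seq (evalℝ v β) i                    ∎)
      (IntegerAlgebra.*-zero-cong ℝ-algebra {evalℝ v β} (fromℚ (ℤ→ℚ (+ suc d))) root))))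
    where open ≡.≡-Reasoning

  isMinimalPolynomial : IsMinimalPolynomial Pₖ β
  isMinimalPolynomial = record { monic = ≡.refl ; root = P-root ; minimal = minimal }
    where
    minimal : ∀ {n} (q : Poly ℚ n) → Monic q → IsRealRoot q β → 6 ℕ.≤ n
    minimal q monic root = ℕₚ.≮⇒≥ λ n<6 → 0≢1 (≡.trans (≡.sym (All-last (independence n<6 q root))) monic)
      where
      0≢1 : 0ℚ ≢ 1ℚ
      0≢1 ()

  private
    last-zero : (v : Vec ℚ 7) → Vec.last v ≡ 0ℚ → IsRealRoot v β → Allᵛ (_≡ 0ℚ) v
    last-zero (c₀ ∷ c₁ ∷ c₂ ∷ c₃ ∷ c₄ ∷ c₅ ∷ c₆ ∷ []) ≡.refl root = snoc (independence ℕₚ.≤-refl v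
        (≈-trans {evalℝ v β} {evalℝ (Vec.padRight (ℕₚ.n≤1+n 6) 0ℚ v) β} {0ℝ}
          (evalℝ-pointwise v (Vec.padRight (ℕₚ.n≤1+n 6) 0ℚ v) β λ q → ≡.sym (horner-padRight (ℕₚ.n≤1+n 6) v q)) root))
      where
      v : Vec ℚ 6
      v = c₀ ∷ c₁ ∷ c₂ ∷ c₃ ∷ c₄ ∷ c₅ ∷ []
      snoc : Allᵛ (_≡ 0ℚ) v → Allᵛ (_≡ 0ℚ) (c₀ ∷ c₁ ∷ c₂ ∷ c₃ ∷ c₄ ∷ c₅ ∷ 0ℚ ∷ [])
      snoc (z₀ ∷ z₁ ∷ z₂ ∷ z₃ ∷ z₄ ∷ z₅ ∷ []) = z₀ ∷ z₁ ∷ z₂ ∷ z₃ ∷ z₄ ∷ z₅ ∷ ≡.refl ∷ []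

    difference-root : ∀ {n} (v w : Vec ℚ n) → IsRealRoot v β → IsRealRoot w β → IsRealRoot (Vec.zipWith ℚ._-_ v w) β
    difference-root v w v-root w-root = ≈-trans {evalℝ (Vec.zipWith ℚ._-_ v w) β} {evalℝ v β - evalℝ w β} {0ℝ}
      (pointwise {evalℝ (Vec.zipWith ℚ._-_ v w) β} {evalℝ v β - evalℝ w β} λ i →
        ≡.trans (seq-evalℝ (Vec.zipWith ℚ._-_ v w) β i) (≡.trans (horner-minus v w (seq β i))
          (≡.sym (≡.cong₂ ℚ._-_ (seq-evalℝ v β i) (seq-evalℝ w β i)))))
      (IntegerAlgebra.x≈y⇒x-y≈0 ℝ-algebra {evalℝ v β} {evalℝ w β}
        (≈-trans {evalℝ v β} {0ℝ} {evalℝ w β} v-root (≈-sym {evalℝ w β} {0ℝ} w-root)))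

    monic-unique : (p : Vec ℚ 7) → Monic p → IsRealRoot p β → p ≡ Pₖ
    monic-unique p@(_ ∷ _ ∷ _ ∷ _ ∷ _ ∷ _ ∷ c₆ ∷ []) monic root = differences-zero p Pₖ
      (last-zero (Vec.zipWith ℚ._-_ p Pₖ) (≡.cong (ℚ._- 1ℚ) monic) (difference-root p Pₖ root P-root))

  -- A conjugate is a root of some minimal polynomial of β, so this is what makes it a root of P.
  -- The difference of two monic polynomials of degree 6 that vanish at β is a relation of degree at
  -- most 5.
  minimalPolynomial-unique : ∀ {n} (p : Poly ℚ n) → IsMinimalPolynomial p β →
    ∃ λ n≡6 → ≡.subst (Poly ℚ) n≡6 p ≡ Pₖ
  minimalPolynomial-unique {n} p isMin = n≡6 , conclude n≡6 p monic root
    where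
    open IsMinimalPolynomial isMin
    n≡6 : n ≡ 6
    n≡6 = ℕₚ.≤-antisym (minimal Pₖ ≡.refl P-root)
      (IsMinimalPolynomial.minimal isMinimalPolynomial p monic root)
    conclude : ∀ {n} (n≡6 : n ≡ 6) (p : Poly ℚ n) → Monic p → IsRealRoot p β → ≡.subst (Poly ℚ) n≡6 p ≡ Pₖ
    conclude ≡.refl p monic root = monic-unique p monic root

-- Salem numbers

Positive⇒< : ∀ {x y} → Positive (y - x) → x < y
Positive⇒< {x} {y} (ε , 0<ε , N , p) = ε , 0<ε , N , λ n N≤n →
  ≡.subst (seq x n ℚ.+ ε ℚ.≤_) (solve 2 (λ a b → a :+ (b :- a) := b) ≡.refl (seq x n) (seq y n))
    (ℚₚ.+-monoʳ-≤ (seq x n) (p n N≤n))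
  where open Data.Rational.Solver.+-*-Solver

<⇒Positive : ∀ {x y} → x < y → Positive (y - x)
<⇒Positive {x} {y} (ε , 0<ε , N , p) = ε , 0<ε , N , λ n N≤n →
  ≡.subst (ℚ._≤ seq y n ℚ.- seq x n) (solve 2 (λ a e → (a :+ e) :- a := e) ≡.refl (seq x n) ε)
    (ℚₚ.+-monoˡ-≤ (ℚ.- seq x n) (p n N≤n))
  where open Data.Rational.Solver.+-*-Solver

Positive⇒≤ : ∀ {x y} → Positive (y - x) → x ≤ y
Positive⇒≤ {x} {y} p y<x = ¬Positive-0 (Positive-cong {(y - x) + (x - y)} {0ℝ}
  (pointwise {(y - x) + (x - y)} {0ℝ} λ n → solve 2 (λ a b → (b :- a) :+ (a :- b) := con 0ℚ) ≡.refl (seq x n) (seq y n))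
  (Positive-+ {y - x} {x - y} p (<⇒Positive {y} {x} y<x)))
  where open Data.Rational.Solver.+-*-Solver

≤-refl-ℝ : ∀ {x} → x ≤ x
≤-refl-ℝ {x} x<x = ¬Positive-0 (Positive-cong {x - x} {0ℝ} (pointwise {x - x} {0ℝ} λ n → ℚₚ.+-inverseʳ (seq x n))
  (<⇒Positive {x} {x} x<x))

-- The sequence of x decides at a late index which of the two summands is large.
Positive-+⁻ : ∀ x y → Positive (x + y) → Positive x ⊎ Positive y
Positive-+⁻ x y (ε , 0<ε , N , p) = conclude (ℚₚ.≤-total (½ ℚ.* ε) (seq x M))
  where
  open ℚₚ.≤-Reasoning
  open Data.Rational.Solver.+-*-Solver
  ¼ε : ℚ
  ¼ε = ½ ℚ.* (½ ℚ.* ε)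
  0<¼ε : 0ℚ ℚ.< ¼ε
  0<¼ε = ½-pos (½-pos 0<ε)
  L M : ℕ
  L = proj₁ (cauchy x ¼ε 0<¼ε)
  M = L ℕ.⊔ N
  close : ∀ n → M ℕ.≤ n → ℚ.∣ seq x M ℚ.- seq x n ∣ ℚ.< ¼ε
  close n M≤n = proj₂ (cauchy x ¼ε 0<¼ε) M n (ℕₚ.m≤m⊔n L N) (ℕₚ.m⊔n≤o⇒m≤o L N M≤n)
  conclude : ½ ℚ.* ε ℚ.≤ seq x M ⊎ seq x M ℚ.≤ ½ ℚ.* ε → Positive x ⊎ Positive y
  conclude (inj₁ ½ε≤x) = inj₁ (¼ε , 0<¼ε , M , λ n M≤n → quarter-≤ ε (seq x M) (seq x n) ½ε≤x (close n M≤n))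
  conclude (inj₂ x≤½ε) = inj₂ (¼ε , 0<¼ε , M , λ n M≤n → ℚₚ.≮⇒≥ λ y<¼ε → ℚₚ.<-irrefl ≡.refl (begin-strict
    ε                                       ≤⟨ p n (ℕₚ.m⊔n≤o⇒n≤o L N M≤n) ⟩
    seq x n ℚ.+ seq y n                     ≡⟨ solve 3 (λ a b c → b :+ c := (:- (a :- b) :+ c) :+ a) ≡.refl (seq x M) (seq x n) (seq y n) ⟩
    (ℚ.- (seq x M ℚ.- seq x n) ℚ.+ seq y n) ℚ.+ seq x M
      ≤⟨ ℚₚ.+-mono-≤ (ℚₚ.+-monoˡ-≤ (seq y n) (-p≤∣p∣ (seq x M ℚ.- seq x n))) x≤½ε ⟩
    (ℚ.∣ seq x M ℚ.- seq x n ∣ ℚ.+ seq y n) ℚ.+ ½ ℚ.* ε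
      <⟨ ℚₚ.+-monoˡ-< (½ ℚ.* ε) (ℚₚ.+-mono-< (close n M≤n) y<¼ε) ⟩
    (¼ε ℚ.+ ¼ε) ℚ.+ ½ ℚ.* ε                 ≡⟨ ≡.cong (ℚ._+ ½ ℚ.* ε) (½+½ (½ ℚ.* ε)) ⟩
    ½ ℚ.* ε ℚ.+ ½ ℚ.* ε                     ≡⟨ ½+½ ε ⟩
    ε                                       ∎))

module SalemNumber (m : ℕ) {β : ℝ} (isRoot : SalemRoot.IsSalemRoot ℝ-orderedRing m β) where
  open SalemPolynomial ℝ-algebra
  open SalemRoot ℝ-orderedRing m
  open Conjugates ℝ-orderedRing m using (module ℂ-Salem; stable; complex-roots; unitRoot⇒complexRoot; module UnitRoot)
  open Complexification ℝ-algebra using (Complex; norm; embed; complexAlgebra)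
  open RealRoots m
  open MinimalPolynomial m isRoot
  open IsSalemRoot isRoot using (z; Pos-z; Pos-1-z)
  private
    module ℝᵢ = IntegerAlgebra ℝ-algebra
    module ℂᵢ = IntegerAlgebra complexAlgebra

    Pₖ : Poly ℚ 6
    Pₖ = P (suc (suc m))

    value salemValue : ℂ → Complex
    value α      = re (evalℂ Pₖ α) , im (evalℂ Pₖ α)
    salemValue α = ℂ-Salem.salem (embed κ) (re α , im α)

    value≈salemValue : ∀ α → value α ℂᵢ.≈ salemValue α
    value≈salemValue α = ℂ-Salem.salem-integral (suc (suc m)) (re α , im α)

    complexRoot⇒ : ∀ α → IsComplexRoot Pₖ α → salemValue α ℂᵢ.≈ ℂᵢ.0#
    complexRoot⇒ α root = ℂᵢ.trans {salemValue α} {value α} {ℂᵢ.0#} (ℂᵢ.sym {value α} {salemValue α} (value≈salemValue α)) root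

    ⇒complexRoot : ∀ α → salemValue α ℂᵢ.≈ ℂᵢ.0# → IsComplexRoot Pₖ α
    ⇒complexRoot α root = ℂᵢ.trans {value α} {salemValue α} {ℂᵢ.0#} (value≈salemValue α) root

    ∣α∣² : ℂ → ℝ
    ∣α∣² α = norm (re α , im α)

    -- |α|² ≈ 1 or |α|² ≈ z², and z² < 1 decides between the two.
    modulus : ∀ α → ¬ (¬ ∣α∣² α ≈ fromℤ (+ 1) × ¬ ∣α∣² α ≈ z * z) → ∃[ ρ ] (∣ α ∣≔ ρ × ρ ≤ 1ℝ)
    modulus α dichotomy = conclude (Positive-+⁻ (N - z * z) (1ℝ - N) gap)
      where
      N : ℝ
      N = ∣α∣² α
      -- N cancels from the sum, which leaves 1 - z²; a positive sum has a positive summand.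
      gap : Positive ((N - z * z) + (1ℝ - N))
      gap = Positive-cong {(1ℝ - z) * (1ℝ + z)} {(N - z * z) + (1ℝ - N)} difference-of-squares
        (Positive-* {1ℝ - z} {1ℝ + z} Pos-1-z (Positive-+ {1ℝ} {z} Positive-1 Pos-z))
        where
        open Data.Rational.Solver.+-*-Solver
        difference-of-squares : (1ℝ - z) * (1ℝ + z) ≈ (N - z * z) + (1ℝ - N)
        difference-of-squares = pointwise {(1ℝ - z) * (1ℝ + z)} {(N - z * z) + (1ℝ - N)} λ n →
          solve 2 (λ z a → (con 1ℚ :- z) :* (con 1ℚ :+ z) := (a :- z :* z) :+ (con 1ℚ :- a)) ≡.refl (seq z n) (seq N n)
      stable-≈ : ∀ {x y} → ¬ ¬ x ≈ y → x ≈ y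
      stable-≈ {x} {y} ¬¬h = ℝᵢ.x-y≈0⇒x≈y {x} {y} (stable {x - y} λ k → ¬¬h λ h → k (ℝᵢ.x≈y⇒x-y≈0 {x} {y} h))
      above⇒≉ : ∀ {x y} → Positive (x - y) → ¬ x ≈ y
      above⇒≉ {x} {y} p h = ¬Positive-0 (Positive-cong {x - y} {0ℝ} (ℝᵢ.x≈y⇒x-y≈0 {x} {y} h) p)
      conclude : Positive (N - z * z) ⊎ Positive (1ℝ - N) → ∃[ ρ ] (∣ α ∣≔ ρ × ρ ≤ 1ℝ)
      conclude (inj₁ >z²) = 1ℝ , (Positive⇒≤ {0ℝ} {1ℝ} (Positive-cong {1ℝ} {1ℝ - 0ℝ}
          (pointwise {1ℝ} {1ℝ - 0ℝ} λ _ → ≡.refl) Positive-1) ,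
        ≈-trans {1ℝ * 1ℝ} {1ℝ} {N} (pointwise {1ℝ * 1ℝ} {1ℝ} λ _ → ≡.refl)
          (≈-sym {N} {1ℝ} (stable-≈ {N} {1ℝ} λ ≉1 → dichotomy (≉1 , above⇒≉ {N} {z * z} >z²)))) , ≤-refl-ℝ {1ℝ}
      conclude (inj₂ <1) = z , (Positive⇒≤ {0ℝ} {z} (Positive-cong {z} {z - 0ℝ}
          (pointwise {z} {z - 0ℝ} λ n → ≡.sym (ℚₚ.+-identityʳ (seq z n))) Pos-z) ,
        ≈-sym {N} {z * z} (stable-≈ {N} {z * z} λ ≉z² →
          dichotomy ((λ h → above⇒≉ {1ℝ} {N} <1 (≈-sym {N} {1ℝ} h)) , ≉z²))) , Positive⇒≤ {z} {1ℝ} Pos-1-z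

  conjugate⇒complexRoot : ∀ α → IsConjugate β α → IsComplexRoot Pₖ α
  conjugate⇒complexRoot α (n , p , isMin , root) = transport (minimalPolynomial-unique p isMin) root
    where
    transport : ∀ {n} {p : Poly ℚ n} → (∃ λ n≡6 → ≡.subst (Poly ℚ) n≡6 p ≡ Pₖ) → IsComplexRoot p α → IsComplexRoot Pₖ α
    transport (≡.refl , p≡Pₖ) root = ≡.subst (λ p → IsComplexRoot p α) p≡Pₖ root

  isSalemNumber : IsSalemNumber β
  isSalemNumber = record
    { algebraicInteger = 6 , salemCoefficients (ℤ.- (+ 6 ℤ.* + suc (suc m)) ℤ.- + 3) , ≡.refl , P-root
    ; >1               = Positive⇒< {1ℝ} {β} (IsSalemRoot.>1 isRoot)
    ; conjugates≤1     = λ α (isConjugate , ≉β) → modulus α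
        (complex-roots {β} {C₁.y} {C₂.y} isRoot (allTraceRoots isRoot) unit₁ unit₂ {re α} {im α}
          (complexRoot⇒ α (conjugate⇒complexRoot α isConjugate)) ≉β)
    ; conjugate≈1      = γ , ((6 , Pₖ , isMinimalPolynomial , ⇒complexRoot γ (unitRoot⇒complexRoot {C₁.y} unit₁ C₁.trace≈0))
        , λ (_ , w≈0) → C₁.w≉0 w≈0) , 1ℝ ,
        (Positive⇒≤ {0ℝ} {1ℝ} (Positive-cong {1ℝ} {1ℝ - 0ℝ} (pointwise {1ℝ} {1ℝ - 0ℝ} λ _ → ≡.refl) Positive-1) ,
          ≈-trans {1ℝ * 1ℝ} {1ℝ} {∣α∣² γ} (pointwise {1ℝ * 1ℝ} {1ℝ} λ _ → ≡.refl) (≈-sym {∣α∣² γ} {1ℝ} C₁.c²+w²≈1)) ,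
        pointwise {1ℝ} {1ℝ} λ _ → ≡.refl
    }
    where
    γ : ℂ
    γ = C₁.c +i C₁.w

-- The greedy expansion over the real numbers

module Greedy (m : ℕ) {β : ℝ} (isRoot : SalemRoot.IsSalemRoot ℝ-orderedRing m β) where
  open Digits m public
  open Remainders ℝ-orderedRing m isRoot public
  open Expansion ℝ-orderedRing m using (InUnit)

  -- The floor conditions on a digit amount to 0 ≤ r < 1 for the remainder r that follows it.
  isGreedyExpansion : IsGreedyExpansion β digit remainder
  isGreedyExpansion = record
    { initial   = pointwise {1ℝ} {1ℝ} λ _ → ≡.refl
    ; digit     = λ n →
        Positive⇒≤ {fromℤ (digit (suc n))} {β * remainder n} (proj₁ (remainder∈[0,1] n)) ,
        Positive⇒< {β * remainder n} {fromℤ (digit (suc n) ℤ.+ 1ℤ)} (Positive-cong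
          {fromℤ (+ 1) - remainder (suc n)} {fromℤ (digit (suc n) ℤ.+ 1ℤ) - β * remainder n}
          (gap (β * remainder n) (digit (suc n))) (proj₂ (remainder∈[0,1] n)))
    ; remainder = λ n → pointwise {remainder (suc n)} {remainder (suc n)} λ _ → ≡.refl
    }
    where
    open Data.Rational.Solver.+-*-Solver
    gap : ∀ x d → fromℤ (+ 1) - (x - fromℤ d) ≈ fromℤ (d ℤ.+ 1ℤ) - x
    gap x d = pointwise {fromℤ (+ 1) - (x - fromℤ d)} {fromℤ (d ℤ.+ 1ℤ) - x} λ n → ≡.trans
      (solve 2 (λ x d → con 1ℚ :- (x :- d) := (d :+ con 1ℚ) :- x) ≡.refl (seq x n) (ℤ→ℚ d))
      (≡.cong (ℚ._- seq x n) (≡.sym (ℤ→ℚ-+ d 1ℤ)))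

  remainder≉0 : ∀ n → ¬ remainder n ≈ 0ℝ
  remainder≉0 zero    h = ¬Positive-0 (Positive-cong {1ℝ} {0ℝ} h Positive-1)
  remainder≉0 (suc n) h = ¬Positive-0 (Positive-cong {remainder (suc n)} {0ℝ} h (proj₁ (remainder∈[0,1] n)))

proposition5p1 : (k : ℕ) → 2 ℕ.≤ k →
    IsSalemPolynomial (P k) ×
    ((β : ℝ) → IsSalemNumber β → IsMinimalPolynomial (P k) β →
    Σ (ℕ → ℤ) λ c → Σ (ℕ → ℝ) λ r →
    IsGreedyExpansion β c r ×
    PeriodicFrom c 1 (8 ℕ.* k ℕ.+ 6) ×
    IsPreperiodLength c 1 ×
    IsPeriodLength c r (8 ℕ.* k ℕ.+ 6))
proposition5p1 k@(suc (suc m)) (s≤s (s≤s z≤n)) = salemPolynomial salemRoot , expansion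
  where
  open RealRoots m using (salemRoot)
  open SalemRoot ℝ-orderedRing m using (IsSalemRoot)

  salemPolynomial : ∃ IsSalemRoot → IsSalemPolynomial (P k)
  salemPolynomial (β , isRoot) = β , SalemNumber.isSalemNumber m isRoot , MinimalPolynomial.isMinimalPolynomial m isRoot

  expansion : (β : ℝ) → IsSalemNumber β → IsMinimalPolynomial (P k) β →
    Σ (ℕ → ℤ) λ c → Σ (ℕ → ℝ) λ r →
    IsGreedyExpansion β c r ×
    PeriodicFrom c 1 (8 ℕ.* k ℕ.+ 6) ×
    IsPreperiodLength c 1 ×
    IsPeriodLength c r (8 ℕ.* k ℕ.+ 6)
  expansion β isSalem isMin = digit , remainder , isGreedyExpansion , periodicFrom ,
    ((8 ℕ.* k ℕ.+ 6 , periodicFrom) , λ m′ p′ (1≤p′ , per) → preperiod-positive 1≤p′ per) ,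
    inj₂ (remainder≉0 , (1 , periodicFrom) , λ m′ p′ (1≤p′ , per) → ≡.subst (ℕ._≤ p′) L≡8k+6 (period-minimal 1≤p′ per))
    where
    isRoot : IsSalemRoot β
    isRoot = record
      { >1   = <⇒Positive {1ℝ} {β} (IsSalemNumber.>1 isSalem)
      ; root = ≈-trans {SalemPolynomial.salem ℝ-algebra (fromℤ (+ k)) β} {evalℝ (P k) β} {0ℝ}
          (≈-sym {evalℝ (P k) β} {SalemPolynomial.salem ℝ-algebra (fromℤ (+ k)) β}
            (SalemPolynomial.salem-integral ℝ-algebra k β))
          (IsMinimalPolynomial.root isMin)
      }
    open Greedy m isRoot
    periodicFrom : PeriodicFrom digit 1 (8 ℕ.* k ℕ.+ 6)
    periodicFrom = ≡.subst (PeriodicFrom digit 1) L≡8k+6 periodicFrom-1
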